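{- Fix a real number $\varepsilon>0$. Then for all sufficiently large integers $k$ (depending on $\varepsilon$) the following holds: for all integers $\ell$ with $1\leq \ell\leq k/\log^4 k$, \[\operatorname{ind}(k,\ell)\leq 90\cdot \ell^{ -1/4},\] and for all integers $\ell$ with $k/\log^4 k\leq \ell\leq (1-\varepsilon)k/2$, \[\operatorname{ind}(k,\ell)\leq 90\cdot k^{ -1/4}\cdot \log k.\]
   Context: All logarithms are to base 2. For integers $n\geq k\geq 1$ and $0\leq \ell\leq \binom{k}{2}$, let $I(n,k,\ell)$ be the maximum, over all (simple) graphs $G$ on $n$ vertices, of the probability that a uniformly random $k$-vertex subset of $V(G)$ spans exactly $\ell$ edges of $G$. $I(n,k,\ell)$ is non-increasing in $n$, and $\operatorname{ind}(k,\ell)=\lim_{n\to\infty}I(n,k,\ell)$. -}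

module Defs where

open import Data.Bool using (Bool; true; false; _∧_; if_then_else_)
open import Data.Nat using (ℕ; zero; suc; _+_; _*_; _^_; _≤_; _<_; _<ᵇ_; _≡ᵇ_)
open import Data.Nat.Combinatorics using (_C_)
open import Data.Fin using (Fin; toℕ)
open import Data.Vec using (Vec; []; _∷_; lookup)
open import Data.List using (List; []; _∷_; map; concatMap; allFin; _++_)
open import Data.Product using (Σ; ∃; ∃-syntax; _×_; _,_)

-- A simple graph on vertex set Fin n.  Only the entries adj i j with
-- toℕ i < toℕ j are ever read, so every function encodes exactly one
-- simple graph and every simple graph is encoded (by its upper triangle).
Graph : ℕ → Set
Graph n = Fin n → Fin n → Bool

Subset : ℕ → Set
Subset n = Vec Bool n

allSubsets : (n : ℕ) → List (Subset n)
allSubsets zero    = [] ∷ []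
allSubsets (suc n) = map (true ∷_) (allSubsets n) ++ map (false ∷_) (allSubsets n)

countTrue : List Bool → ℕ
countTrue []            = 0
countTrue (true  ∷ bs)  = suc (countTrue bs)
countTrue (false ∷ bs)  = countTrue bs

size : {n : ℕ} → Subset n → ℕ
size []          = 0
size (true  ∷ s) = suc (size s)
size (false ∷ s) = size s

edgesIn : {n : ℕ} → Graph n → Subset n → ℕ
edgesIn {n} G S = countTrue (concatMap (λ i → map (λ j →
  (toℕ i <ᵇ toℕ j) ∧ lookup S i ∧ lookup S j ∧ G i j) (allFin n)) (allFin n))

hits : (n k ℓ : ℕ) → Graph n → ℕ
hits n k ℓ G = countTrue (map (λ S → (size S ≡ᵇ k) ∧ (edgesIn G S ≡ᵇ ℓ)) (allSubsets n))

-- "I(n,k,ℓ) < p/q":  the maximum over all graphs G on n vertices of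
-- hits/C(n,k) is below p/q, i.e. hits * q < p * C(n,k) for every G.
IBelow : (n k ℓ p q : ℕ) → Set
IBelow n k ℓ p q = (G : Graph n) → hits n k ℓ G * q < p * (n C k)

-- "ind(k,ℓ) ≤ c", where c is a real number given through the predicate
-- Below p q  ⇔  c < p/q  (for naturals p, q with q ≥ 1).
-- Since I(n,k,ℓ) is non-increasing in n, ind(k,ℓ) = inf_{n ≥ k} I(n,k,ℓ),
-- and ind ≤ c  iff  for every rational r > c some I(n,k,ℓ) < r.
IndLe : (k ℓ : ℕ) → (Below : ℕ → ℕ → Set) → Set
IndLe k ℓ Below = (p q : ℕ) → 1 ≤ q → Below p q → ∃[ n ] (k ≤ n × IBelow n k ℓ p q)

-- "90 · ℓ^(-1/4) < p/q"   (ℓ ≥ 1)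
BelowA : ℕ → ℕ → ℕ → Set
BelowA ℓ p q = (90 ^ 4) * (q ^ 4) < (p ^ 4) * ℓ

-- "90 · k^(-1/4) · log₂ k < p/q": there is a rational a/b with
-- log₂ k < a/b  (i.e. k^b < 2^a) and (a/b)^4 < (p/q)^4 · k / 90^4.
BelowB : ℕ → ℕ → ℕ → Set
BelowB k p q = ∃[ a ] ∃[ b ] (1 ≤ b × (k ^ b < 2 ^ a) ×
  ((90 ^ 4) * (a ^ 4) * (q ^ 4) < (p ^ 4) * k * (b ^ 4)))

-- "ℓ ≤ k / log₂^4 k", i.e. ℓ · (log₂ k)^4 ≤ k: every rational a/b < log₂ k
-- (i.e. 2^a < k^b) satisfies ℓ (a/b)^4 ≤ k.
SmallL : ℕ → ℕ → Set
SmallL k ℓ = (a b : ℕ) → 1 ≤ b → 2 ^ a < k ^ b → ℓ * (a ^ 4) ≤ k * (b ^ 4)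

-- "k / log₂^4 k ≤ ℓ", i.e. k ≤ ℓ · (log₂ k)^4: every rational a/b > log₂ k
-- (i.e. k^b < 2^a) satisfies k ≤ ℓ (a/b)^4.
LargeL : ℕ → ℕ → Set
LargeL k ℓ = (a b : ℕ) → 1 ≤ b → k ^ b < 2 ^ a → k * (b ^ 4) ≤ ℓ * (a ^ 4)

{-# OPTIONS --safe #-}
module Submission where

-- A uniformly random sequence S of k vertices of G is coloured at random with q = ν² colours;
-- B is the set of indices of colour 0 and A the rest.  Let w be the proportion of vertices of G
-- adjacent to A, and Y the number of indices of B whose vertex is adjacent to A.  Given A and the
-- colours, Y − |B|w is a sum of independent centred variables, so X = (Y − |B|w)/√(kw) has
-- bounded variance.  Correlate X with the indicator of e(S) ≥ ℓ: only an index i that is pivotal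
-- (deleting it brings the number of edges below ℓ) contributes, positively if s_i is adjacent to
-- A and negatively otherwise.  A pivotal i has a neighbour, which lies in B with probability only
-- 1/q, so the negative contributions are dominated.  Every non-isolated index of a sample with
-- exactly ℓ edges is pivotal; there are at least √(2ℓ) of them, so such samples contribute about
-- ℓ^(1/4) each, and they have probability O(ℓ^(-1/4)).  Since ℓ < k/2, samples with at most ℓ
-- edges have many isolated vertices, so by Chebyshev's inequality w is bounded away from 1
-- except with probability O(1/k).

open import Defs

-- Probabilities are counts over the finite space of samples and colourings, and every inequality is
-- cleared of denominators and roots; this is why q is the square of ν and why `C` is an integer
-- substitute for √(k/w). The obstacle is the unknown w. A bound on the average of Y/√(kw) over the
-- samples with exactly ℓ edges says little when w is large. But |B|w/√(kw) is that quantity minus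
-- X, so its average is bounded as well, and it says little only when w is small. With Y about √ℓ
-- the two balance at kw about √ℓ, and AM-GM yields ℓ^(1/4) whatever w is. The parameter ν is the
-- inverse of the proportion of vertices required to be untouched by A. Positive contributions lose
-- a factor ν through this proportion, while the colouring favours them by a factor q - 1, so q = ν²
-- suffices as soon as ν ≥ 3. The isolated indices provide such a proportion, up to rare exceptions,
-- when k - 1 - 2ℓ is at least 3k/(2ν). For ℓ ≤ k/6 the value ν = 3 gives the constant 76, below the
-- required 90; for ℓ near k/2 the constant grows with ν and is absorbed by log k.

module SampleCounting where

  open import Data.Bool using (Bool; true; false; _∧_; _∨_; not) renaming (T to IsTrue)
  open import Data.Bool.Properties using (∨-comm)
  open import Data.Fin using (Fin; zero; suc; toℕ)
  import Data.Fin.Properties as FinP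
  open import Data.Integer as ℤ using (ℤ; +_; _+_; _*_; _-_; -_; _≤_; 0ℤ; 1ℤ; +≤+; nonNegative)
  open import Data.Integer.Properties using (≤-refl; ≤-trans; ≤-reflexive; ≤-antisym; ≤-total; ≤∧≢⇒<; <⇒≱; _≟_; ≤ᵇ⇒≤; ≤⇒≤ᵇ; i<j⇒suc[i]≤j; suc[i]≤j⇒i<j; drop‿+≤+; ⊖-≥; m-n≡m⊖n; +-mono-≤; *-monoˡ-≤-nonNeg; *-cancelˡ-≤-pos; i≤j⇒0≤j-i; pos-+; pos-*; +-comm; +-assoc; *-comm; *-zeroʳ; *-zeroˡ; *-identityˡ; *-identityʳ; +-identityˡ; +-identityʳ; module ≤-Reasoning)
  open import Data.Integer.Tactic.RingSolver using (solve-∀)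
  open import Data.List using (List; []; _∷_; _++_; map; concatMap; allFin; length)
  open import Data.List.Properties using (map-tabulate; length-tabulate)
  open import Data.Nat as ℕ using (ℕ; zero; suc; _!)
  import Data.Nat.Properties as ℕP
  open import Data.Product using (∃-syntax; _×_; _,_; proj₁; proj₂)
  open import Data.Sum using (_⊎_; inj₁; inj₂)
  open import Data.Unit using (tt)
  open import Data.Vec using (Vec; []; _∷_; lookup; replicate; _[_]≔_)
  open import Data.Vec.Properties using (lookup∘update; lookup∘update′; lookup-replicate)
  open import Function using (_∘_)
  open import Relation.Binary.PropositionalEquality using (_≡_; _≢_; refl; sym; trans; cong; cong₂; subst; module ≡-Reasoning)
  open import Relation.Nullary using (yes; no; contradiction; does)

  -- Finite sums

  0≤+ : ∀ {m} → 0ℤ ≤ + m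
  0≤+ = +≤+ ℕ.z≤n

  ≤-by : ∀ {a b} r → 0ℤ ≤ r → b ≡ a + r → a ≤ b
  ≤-by {a} r 0≤r refl = ≤-trans (≤-reflexive (sym (+-identityʳ a))) (+-mono-≤ (≤-refl {a}) 0≤r)

  *-monoˡ : ∀ {a b} c → 0ℤ ≤ c → a ≤ b → c * a ≤ c * b
  *-monoˡ c 0≤c a≤b = *-monoˡ-≤-nonNeg c {{nonNegative 0≤c}} a≤b

  0≤* : ∀ {a b} → 0ℤ ≤ a → 0ℤ ≤ b → 0ℤ ≤ a * b
  0≤* {a} 0≤a 0≤b = ≤-trans (≤-reflexive (sym (*-zeroʳ a))) (*-monoˡ a 0≤a 0≤b)

  0≤+⁺ : ∀ {a b} → 0ℤ ≤ a → 0ℤ ≤ b → 0ℤ ≤ a + b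
  0≤+⁺ = +-mono-≤

  *-mono : ∀ {a b c d} → 0ℤ ≤ a → 0ℤ ≤ d → a ≤ b → c ≤ d → a * c ≤ b * d
  *-mono {a} {b} {c} {d} 0≤a 0≤d a≤b c≤d = ≤-trans (*-monoˡ a 0≤a c≤d)
    (≤-trans (≤-reflexive (*-comm a d)) (≤-trans (*-monoˡ d 0≤d a≤b) (≤-reflexive (*-comm d b))))

  *-cancelˡ : ∀ {a b} c → 1ℤ ≤ c → c * a ≤ c * b → a ≤ b
  *-cancelˡ {a} {b} (+ suc m) _ p = *-cancelˡ-≤-pos a b (+ suc m) p
  *-cancelˡ (+ zero) (+≤+ ()) _

  0≤sq : ∀ a → 0ℤ ≤ a * a
  0≤sq (+ zero) = 0≤+
  0≤sq (+ suc m) = 0≤+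
  0≤sq ℤ.-[1+ m ] = 0≤+

  ⟦_⟧ : Bool → ℤ
  ⟦ true ⟧ = 1ℤ
  ⟦ false ⟧ = 0ℤ

  0≤⟦⟧ : ∀ b → 0ℤ ≤ ⟦ b ⟧
  0≤⟦⟧ true = 0≤+
  0≤⟦⟧ false = ≤-refl

  ⟦⟧≤1 : ∀ b → ⟦ b ⟧ ≤ 1ℤ
  ⟦⟧≤1 true = ≤-refl
  ⟦⟧≤1 false = 0≤+

  ∑ : {A : Set} → List A → (A → ℤ) → ℤ
  ∑ [] f = 0ℤ
  ∑ (x ∷ xs) f = f x + ∑ xs f

  module _ {A : Set} where

    ∑-cong : (xs : List A) {f g : A → ℤ} → (∀ x → f x ≡ g x) → ∑ xs f ≡ ∑ xs g
    ∑-cong [] e = refl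
    ∑-cong (x ∷ xs) e = cong₂ _+_ (e x) (∑-cong xs e)

    ∑-mono : (xs : List A) {f g : A → ℤ} → (∀ x → f x ≤ g x) → ∑ xs f ≤ ∑ xs g
    ∑-mono [] e = ≤-refl
    ∑-mono (x ∷ xs) e = +-mono-≤ (e x) (∑-mono xs e)

    ∑-0 : (xs : List A) → ∑ xs (λ _ → 0ℤ) ≡ 0ℤ
    ∑-0 [] = refl
    ∑-0 (x ∷ xs) = trans (+-identityˡ _) (∑-0 xs)

    ∑-nonneg : (xs : List A) {f : A → ℤ} → (∀ x → 0ℤ ≤ f x) → 0ℤ ≤ ∑ xs f
    ∑-nonneg xs e = ≤-trans (≤-reflexive (sym (∑-0 xs))) (∑-mono xs e)

    ∑-+ : (xs : List A) (f g : A → ℤ) → ∑ xs (λ x → f x + g x) ≡ ∑ xs f + ∑ xs g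
    ∑-+ [] f g = refl
    ∑-+ (x ∷ xs) f g = trans (cong (λ z → (f x + g x) + z) (∑-+ xs f g)) (interchange (f x) (g x) (∑ xs f) (∑ xs g))
      where
        interchange : ∀ a b c d → (a + b) + (c + d) ≡ (a + c) + (b + d)
        interchange = solve-∀

    ∑-*ˡ : (xs : List A) (c : ℤ) (f : A → ℤ) → ∑ xs (λ x → c * f x) ≡ c * ∑ xs f
    ∑-*ˡ [] c f = sym (*-zeroʳ c)
    ∑-*ˡ (x ∷ xs) c f = trans (cong (λ z → c * f x + z) (∑-*ˡ xs c f)) (distrib c (f x) (∑ xs f))
      where
        distrib : ∀ a b c → a * b + a * c ≡ a * (b + c)
        distrib = solve-∀

    ∑-const : (xs : List A) (c : ℤ) → ∑ xs (λ _ → c) ≡ + length xs * c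
    ∑-const [] c = sym (*-zeroˡ c)
    ∑-const (x ∷ xs) c = trans (cong (λ z → c + z) (∑-const xs c))
      (trans (step c (+ length xs)) (cong (_* c) (sym (pos-+ 1 (length xs)))))
      where
        step : ∀ c l → c + l * c ≡ (1ℤ + l) * c
        step = solve-∀

    ∑-++ : (xs ys : List A) (f : A → ℤ) → ∑ (xs ++ ys) f ≡ ∑ xs f + ∑ ys f
    ∑-++ [] ys f = sym (+-identityˡ _)
    ∑-++ (x ∷ xs) ys f = trans (cong (λ z → f x + z) (∑-++ xs ys f)) (sym (+-assoc (f x) (∑ xs f) (∑ ys f)))

  ∑-map : {A B : Set} (h : A → B) (xs : List A) (f : B → ℤ) → ∑ (map h xs) f ≡ ∑ xs (f ∘ h)
  ∑-map h [] f = refl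
  ∑-map h (x ∷ xs) f = cong (λ z → f (h x) + z) (∑-map h xs f)

  ∑-concatMap : {A B : Set} (h : A → List B) (xs : List A) (f : B → ℤ) →
    ∑ (concatMap h xs) f ≡ ∑ xs (λ x → ∑ (h x) f)
  ∑-concatMap h [] f = refl
  ∑-concatMap h (x ∷ xs) f = trans (∑-++ (h x) (concatMap h xs) f) (cong (λ z → ∑ (h x) f + z) (∑-concatMap h xs f))

  ∑-swap : {A B : Set} (xs : List A) (ys : List B) (f : A → B → ℤ) →
    ∑ xs (λ x → ∑ ys (f x)) ≡ ∑ ys (λ y → ∑ xs (λ x → f x y))
  ∑-swap [] ys f = sym (∑-0 ys)
  ∑-swap (x ∷ xs) ys f = trans (cong (λ z → ∑ ys (f x) + z) (∑-swap xs ys f)) (sym (∑-+ ys (f x) (λ y → ∑ xs (λ x → f x y))))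

  ∑-*-∑ : {A B : Set} (xs : List A) (ys : List B) (f : A → ℤ) (g : B → ℤ) →
    ∑ xs f * ∑ ys g ≡ ∑ xs (λ x → ∑ ys (λ y → f x * g y))
  ∑-*-∑ xs ys f g = begin
    ∑ xs f * ∑ ys g                       ≡⟨ *-comm (∑ xs f) (∑ ys g) ⟩
    ∑ ys g * ∑ xs f                       ≡⟨ ∑-*ˡ xs (∑ ys g) f ⟨
    ∑ xs (λ x → ∑ ys g * f x)             ≡⟨ ∑-cong xs (λ x → trans (*-comm (∑ ys g) (f x)) (sym (∑-*ˡ ys (f x) g))) ⟩
    ∑ xs (λ x → ∑ ys (λ y → f x * g y))   ∎
    where open ≡-Reasoning

  ∑-allFin-suc : ∀ k (f : Fin (suc k) → ℤ) → ∑ (allFin (suc k)) f ≡ f zero + ∑ (allFin k) (f ∘ suc)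
  ∑-allFin-suc k f = cong (λ z → f zero + z)
    (trans (cong (λ l → ∑ l f) (sym (map-tabulate (λ i → i) suc))) (∑-map suc (allFin k) f))

  ∑-allFin-const : ∀ k c → ∑ (allFin k) (λ _ → c) ≡ + k * c
  ∑-allFin-const k c = trans (∑-const (allFin k) c) (cong (λ l → + l * c) (length-tabulate (λ (i : Fin k) → i)))

  ∑-single : ∀ {k} (i : Fin k) (f : Fin k → ℤ) → (∀ j → j ≢ i → f j ≡ 0ℤ) → ∑ (allFin k) f ≡ f i
  ∑-single {suc k} zero f e = trans (∑-allFin-suc k f)
    (trans (cong (λ z → f zero + z) (trans (∑-cong (allFin k) (λ j → e (suc j) (λ ()))) (∑-0 (allFin k)))) (+-identityʳ _))
  ∑-single {suc k} (suc i) f e = trans (∑-allFin-suc k f)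
    (trans (cong₂ _+_ (e zero (λ ())) (∑-single i (f ∘ suc) (λ j j≢i → e (suc j) (j≢i ∘ FinP.suc-injective)))) (+-identityˡ _))

  term≤∑ : ∀ {k} (i : Fin k) (f : Fin k → ℤ) → (∀ j → 0ℤ ≤ f j) → f i ≤ ∑ (allFin k) f
  term≤∑ {suc k} zero f e = ≤-by (∑ (allFin k) (f ∘ suc)) (∑-nonneg (allFin k) (e ∘ suc)) (∑-allFin-suc k f)
  term≤∑ {suc k} (suc i) f e = ≤-trans (term≤∑ i (f ∘ suc) (e ∘ suc))
    (≤-by (f zero) (e zero) (trans (∑-allFin-suc k f) (+-comm (f zero) (∑ (allFin k) (f ∘ suc)))))

  -- Expanding the square leaves only the diagonal terms. It serves as the additivity of variance,
  -- once for random colours and once for random vertices.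
  ∑-orthogonal : {Ω : Set} (ω : List Ω) (k : ℕ) (η : Fin k → Ω → ℤ) (B : Fin k → ℤ) →
    (∀ i j → j ≢ i → ∑ ω (λ x → η i x * η j x) ≡ 0ℤ) →
    (∀ i → ∑ ω (λ x → η i x * η i x) ≤ B i) →
    ∑ ω (λ x → ∑ (allFin k) (λ i → η i x) * ∑ (allFin k) (λ i → η i x)) ≤ ∑ (allFin k) B
  ∑-orthogonal ω k η B orth bound = begin
    ∑ ω (λ x → ∑ I (λ i → η i x) * ∑ I (λ i → η i x))
      ≡⟨ ∑-cong ω (λ x → ∑-*-∑ I I (λ i → η i x) (λ i → η i x)) ⟩
    ∑ ω (λ x → ∑ I (λ i → ∑ I (λ j → η i x * η j x)))
      ≡⟨ ∑-swap ω I _ ⟩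
    ∑ I (λ i → ∑ ω (λ x → ∑ I (λ j → η i x * η j x)))
      ≡⟨ ∑-cong I (λ i → ∑-swap ω I _) ⟩
    ∑ I (λ i → ∑ I (λ j → ∑ ω (λ x → η i x * η j x)))
      ≡⟨ ∑-cong I (λ i → ∑-single i _ (orth i)) ⟩
    ∑ I (λ i → ∑ ω (λ x → η i x * η i x))
      ≤⟨ ∑-mono I bound ⟩
    ∑ I B ∎
    where
      open ≤-Reasoning
      I = allFin k

  -- Uniform random sequences and resampling of one entry

  vecs : {X : Set} → List X → (k : ℕ) → List (Vec X k)
  vecs xs zero = [] ∷ []
  vecs xs (suc k) = concatMap (λ x → map (x ∷_) (vecs xs k)) xs

  module _ {X : Set} (xs : List X) where

    ∑-vecs-suc : ∀ k (F : Vec X (suc k) → ℤ) →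
      ∑ (vecs xs (suc k)) F ≡ ∑ xs (λ x → ∑ (vecs xs k) (λ v → F (x ∷ v)))
    ∑-vecs-suc k F = trans (∑-concatMap _ xs F) (∑-cong xs (λ x → ∑-map (x ∷_) (vecs xs k) F))

    -- The old i-th entry is forgotten, so each sequence arises `length xs` times. This is how
    -- independence of the entries is used throughout: fix all entries but one and average over that
    -- one.
    resample : ∀ {k} (i : Fin k) (F : Vec X k → ℤ) →
      ∑ (vecs xs k) (λ S → ∑ xs (λ v → F (S [ i ]≔ v))) ≡ + length xs * ∑ (vecs xs k) F
    resample {suc k} zero F = begin
      ∑ (vecs xs (suc k)) (λ S → ∑ xs (λ v → F (S [ zero ]≔ v)))
        ≡⟨ ∑-vecs-suc k _ ⟩
      ∑ xs (λ x → ∑ (vecs xs k) (λ S → ∑ xs (λ v → F (v ∷ S))))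
        ≡⟨ ∑-const xs _ ⟩
      + length xs * ∑ (vecs xs k) (λ S → ∑ xs (λ v → F (v ∷ S)))
        ≡⟨ cong (+ length xs *_) (trans (∑-swap (vecs xs k) xs _) (sym (∑-vecs-suc k F))) ⟩
      + length xs * ∑ (vecs xs (suc k)) F ∎
      where open ≡-Reasoning
    resample {suc k} (suc i) F = begin
      ∑ (vecs xs (suc k)) (λ S → ∑ xs (λ v → F (S [ suc i ]≔ v)))
        ≡⟨ ∑-vecs-suc k _ ⟩
      ∑ xs (λ x → ∑ (vecs xs k) (λ S → ∑ xs (λ v → F (x ∷ (S [ i ]≔ v)))))
        ≡⟨ ∑-cong xs (λ x → resample i (λ S → F (x ∷ S))) ⟩
      ∑ xs (λ x → + length xs * ∑ (vecs xs k) (λ S → F (x ∷ S)))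
        ≡⟨ ∑-*ˡ xs (+ length xs) _ ⟩
      + length xs * ∑ xs (λ x → ∑ (vecs xs k) (λ S → F (x ∷ S)))
        ≡⟨ cong (+ length xs *_) (sym (∑-vecs-suc k F)) ⟩
      + length xs * ∑ (vecs xs (suc k)) F ∎
      where open ≡-Reasoning

    length-vecs : ∀ k → + length (vecs xs k) ≡ + (length xs ℕ.^ k)
    length-vecs k = trans (sym (trans (∑-const (vecs xs k) 1ℤ) (*-identityʳ _))) (go k)
      where
        go : ∀ k → ∑ (vecs xs k) (λ _ → 1ℤ) ≡ + (length xs ℕ.^ k)
        go zero = refl
        go (suc k) = trans (∑-vecs-suc k _) (trans (∑-cong xs (λ _ → go k)) (trans (∑-const xs _) (sym (pos-* (length xs) _))))

    module _ (nonempty : 1ℤ ≤ + length xs) where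

      -- Integrates a bound on the conditional mean of F, given all entries but the i-th.
      resample-≤ : ∀ {k} (i : Fin k) (F G : Vec X k → ℤ) →
        (∀ S → ∑ xs (λ v → F (S [ i ]≔ v)) ≤ + length xs * G S) → ∑ (vecs xs k) F ≤ ∑ (vecs xs k) G
      resample-≤ {k} i F G e = *-cancelˡ (+ length xs) nonempty (≤-trans (≤-reflexive (sym (resample i F)))
        (≤-trans (∑-mono (vecs xs k) e) (≤-reflexive (∑-*ˡ (vecs xs k) (+ length xs) G))))

      resample-≡ : ∀ {k} (i : Fin k) (F G : Vec X k → ℤ) →
        (∀ S → ∑ xs (λ v → F (S [ i ]≔ v)) ≡ + length xs * G S) → ∑ (vecs xs k) F ≡ ∑ (vecs xs k) G
      resample-≡ {k} i F G e = ≤-antisym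
        (resample-≤ i F G (λ S → ≤-reflexive (e S)))
        (*-cancelˡ (+ length xs) nonempty (≤-trans (≤-reflexive (sym (∑-*ˡ (vecs xs k) (+ length xs) G)))
          (≤-trans (∑-mono (vecs xs k) (λ S → ≤-reflexive (sym (e S)))) (≤-reflexive (resample i F)))))

      resample-0 : ∀ {k} (i : Fin k) (F : Vec X k → ℤ) →
        (∀ S → ∑ xs (λ v → F (S [ i ]≔ v)) ≡ 0ℤ) → ∑ (vecs xs k) F ≡ 0ℤ
      resample-0 {k} i F e = trans (resample-≡ i F (λ _ → 0ℤ) (λ S → trans (e S) (sym (*-zeroʳ (+ length xs))))) (∑-0 (vecs xs k))

  -- The graph on the indices of a sample

  anyF : ∀ {k} → (Fin k → Bool) → Bool
  anyF {zero} p = false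
  anyF {suc k} p = p zero ∨ anyF (p ∘ suc)

  anyF-intro : ∀ {k} (p : Fin k → Bool) i → p i ≡ true → anyF p ≡ true
  anyF-intro p zero e rewrite e = refl
  anyF-intro p (suc i) e with p zero
  ... | true = refl
  ... | false = anyF-intro (p ∘ suc) i e

  anyF-elim : ∀ {k} (p : Fin k → Bool) → anyF p ≡ true → ∃[ i ] p i ≡ true
  anyF-elim {suc k} p e with p zero in eq
  ... | true = zero , eq
  ... | false with anyF-elim (p ∘ suc) e
  ... | i , e′ = suc i , e′

  anyF-cong : ∀ {k} {p r : Fin k → Bool} → (∀ i → p i ≡ r i) → anyF p ≡ anyF r
  anyF-cong {zero} e = refl
  anyF-cong {suc k} e = cong₂ _∨_ (e zero) (anyF-cong (e ∘ suc))

  anyF-none : ∀ {k} (p : Fin k → Bool) → anyF p ≡ false → ∀ i → p i ≡ false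
  anyF-none p e i with p i in eq
  ... | false = refl
  ... | true with trans (sym e) (anyF-intro p i eq)
  ... | ()

  toℕ𝔹 : Bool → ℕ
  toℕ𝔹 true = 1
  toℕ𝔹 false = 0

  count : ∀ {k} → (Fin k → Bool) → ℕ
  count {zero} p = 0
  count {suc k} p = toℕ𝔹 (p zero) ℕ.+ count (p ∘ suc)

  count-cong : ∀ {k} {p r : Fin k → Bool} → (∀ i → p i ≡ r i) → count p ≡ count r
  count-cong {zero} e = refl
  count-cong {suc k} e = cong₂ ℕ._+_ (cong toℕ𝔹 (e zero)) (count-cong (e ∘ suc))

  count-∑ : ∀ {k} (p : Fin k → Bool) → + count p ≡ ∑ (allFin k) (λ i → ⟦ p i ⟧)
  count-∑ {zero} p = refl
  count-∑ {suc k} p = trans (pos-+ (toℕ𝔹 (p zero)) (count (p ∘ suc)))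
    (trans (cong₂ _+_ (lem (p zero)) (count-∑ (p ∘ suc))) (sym (∑-allFin-suc k (λ i → ⟦ p i ⟧))))
    where
      lem : ∀ b → + toℕ𝔹 b ≡ ⟦ b ⟧
      lem true = refl
      lem false = refl

  toℕ𝔹≤1 : ∀ b → toℕ𝔹 b ℕ.≤ 1
  toℕ𝔹≤1 true = ℕP.≤-refl
  toℕ𝔹≤1 false = ℕ.z≤n

  count≤ : ∀ {k} (p : Fin k → Bool) → count p ℕ.≤ k
  count≤ {zero} p = ℕ.z≤n
  count≤ {suc k} p = ℕP.+-mono-≤ (toℕ𝔹≤1 (p zero)) (count≤ (p ∘ suc))

  count-none : ∀ k → count {k} (λ _ → false) ≡ 0
  count-none zero = refl
  count-none (suc k) = count-none k

  -- Used to trim the non-isolated indices to exactly λ² marked ones, so that the number of marked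
  -- indices in B is at most λ² for every colouring.
  subset-of-size : ∀ {k} (p : Fin k → Bool) t → t ℕ.≤ count p →
    ∃[ M ] (count M ≡ t × (∀ i → M i ≡ true → p i ≡ true))
  subset-of-size {k} p zero _ = (λ _ → false) , count-none k , λ _ ()
  subset-of-size {suc k} p (suc t) t≤ with p zero in eq
  ... | true with subset-of-size (p ∘ suc) t (ℕ.s≤s⁻¹ t≤)
  ...   | M , c , s = (λ { zero → true ; (suc i) → M i }) , cong suc c , λ { zero _ → eq ; (suc i) e → s i e }
  subset-of-size {suc k} p (suc t) t≤ | false with subset-of-size (p ∘ suc) (suc t) t≤
  ...   | M , c , s = (λ { zero → false ; (suc i) → M i }) , c , λ { (suc i) e → s i e }

  neq : ∀ {k} → Fin k → Fin k → Bool
  neq i j = not (does (i FinP.≟ j))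

  neq-true : ∀ {k} {i j : Fin k} → i ≢ j → neq i j ≡ true
  neq-true {i = i} {j} i≢j with i FinP.≟ j
  ... | yes e = contradiction e i≢j
  ... | no _ = refl

  neq⇒≢ : ∀ {k} {i j : Fin k} → neq i j ≡ true → i ≢ j
  neq⇒≢ {i = i} {j} e with i FinP.≟ j
  neq⇒≢ () | yes _
  ... | no i≢j = i≢j

  neq-refl : ∀ {k} (i : Fin k) → neq i i ≡ false
  neq-refl i with i FinP.≟ i
  ... | yes _ = refl
  ... | no i≢i = contradiction refl i≢i

  neq-sym : ∀ {k} (i j : Fin k) → neq i j ≡ neq j i
  neq-sym i j with i FinP.≟ j
  ... | yes refl = sym (neq-refl i)
  ... | no i≢j = sym (neq-true (i≢j ∘ sym))

  ∧-true : ∀ {a b} → a ∧ b ≡ true → a ≡ true × b ≡ true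
  ∧-true {true} {true} _ = refl , refl

  ∧-intro : ∀ {a b} → a ≡ true → b ≡ true → a ∧ b ≡ true
  ∧-intro refl refl = refl

  ∧-zeroʳ : ∀ a → a ∧ false ≡ false
  ∧-zeroʳ true = refl
  ∧-zeroʳ false = refl

  ⟦⟧-mono : ∀ a b → (a ≡ true → b ≡ true) → ⟦ a ⟧ ≤ ⟦ b ⟧
  ⟦⟧-mono false b _ = 0≤⟦⟧ b
  ⟦⟧-mono true b f rewrite f refl = ≤-refl

  isZero : ∀ {q} → Fin q → Bool
  isZero zero = true
  isZero (suc _) = false

  module IndexGraph {n : ℕ} (g : Fin n → Fin n → Bool) (g-sym : ∀ u v → g u v ≡ g v u) (k : ℕ) where

    nbr : Vec (Fin n) k → Fin k → Fin k → Bool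
    nbr S i j = neq i j ∧ g (lookup S i) (lookup S j)

    nbr-sym : ∀ S i j → nbr S i j ≡ nbr S j i
    nbr-sym S i j = cong₂ _∧_ (neq-sym i j) (g-sym _ _)

    -- Twice the number of edges on the indices selected by m.
    D : (Fin k → Bool) → Vec (Fin n) k → ℤ
    D m S = ∑ (allFin k) (λ i → ∑ (allFin k) (λ j → ⟦ m i ∧ (m j ∧ nbr S i j) ⟧))

    full : Fin k → Bool
    full _ = true

    minus : Fin k → Fin k → Bool
    minus i j = neq j i

    -- Makes the edge count after deletion of i independent of the i-th vertex, and hence orthogonal
    -- to centred functions of that vertex.
    D-minus-update : ∀ i S v → D (minus i) (S [ i ]≔ v) ≡ D (minus i) S
    D-minus-update i S v = ∑-cong (allFin k) (λ a → ∑-cong (allFin k) (λ b → cong ⟦_⟧ (eq a b)))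
      where
        eq : ∀ a b → minus i a ∧ (minus i b ∧ nbr (S [ i ]≔ v) a b) ≡ minus i a ∧ (minus i b ∧ nbr S a b)
        eq a b with a FinP.≟ i | b FinP.≟ i
        ... | yes _ | _ = refl
        ... | no _ | yes _ = refl
        ... | no a≢i | no b≢i = cong (neq a b ∧_) (cong₂ g (lookup∘update′ a≢i S v) (lookup∘update′ b≢i S v))

    private
      drop-mask : ∀ i S a b → minus i a ∧ (minus i b ∧ nbr S a b) ≡ true → nbr S a b ≡ true
      drop-mask i S a b e = proj₂ (∧-true {minus i b} (proj₂ (∧-true {minus i a} e)))

    D-minus≤D : ∀ i S → D (minus i) S ≤ D full S
    D-minus≤D i S = ∑-mono (allFin k) (λ a → ∑-mono (allFin k) (λ b → ⟦⟧-mono _ _ (drop-mask i S a b)))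

    -- The ordered pair (i, j) is lost with i. Its indicator is written as a double sum with a
    -- single nonzero term, so that the comparison can be made termwise.
    D-minus<D : ∀ i j S → nbr S i j ≡ true → D (minus i) S + 1ℤ ≤ D full S
    D-minus<D i j S e = begin
      D (minus i) S + 1ℤ
        ≡⟨ cong (λ z → D (minus i) S + z) (sym (trans (∑-single i _ (λ a a≢i → off a a≢i)) (trans (∑-single j _ (λ b b≢j → at b b≢j)) on))) ⟩
      D (minus i) S + ∑ I (λ a → ∑ I (λ b → ⟦ not (neq a i) ∧ not (neq b j) ⟧))
        ≡⟨ trans (∑-cong I (λ a → ∑-+ I _ _)) (∑-+ I _ _) ⟨
      ∑ I (λ a → ∑ I (λ b → ⟦ minus i a ∧ (minus i b ∧ nbr S a b) ⟧ + ⟦ not (neq a i) ∧ not (neq b j) ⟧))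
        ≤⟨ ∑-mono I (λ a → ∑-mono I (λ b → le a b)) ⟩
      D full S ∎
      where
        open ≤-Reasoning
        I = allFin k
        off : ∀ a → a ≢ i → ∑ I (λ b → ⟦ not (neq a i) ∧ not (neq b j) ⟧) ≡ 0ℤ
        off a a≢i rewrite neq-true a≢i = ∑-0 I
        at : ∀ b → b ≢ j → ⟦ not (neq i i) ∧ not (neq b j) ⟧ ≡ 0ℤ
        at b b≢j rewrite neq-refl i | neq-true b≢j = refl
        on : ⟦ not (neq i i) ∧ not (neq j j) ⟧ ≡ 1ℤ
        on rewrite neq-refl i | neq-refl j = refl
        le : ∀ a b → ⟦ minus i a ∧ (minus i b ∧ nbr S a b) ⟧ + ⟦ not (neq a i) ∧ not (neq b j) ⟧ ≤ ⟦ nbr S a b ⟧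
        le a b with a FinP.≟ i | b FinP.≟ j
        ... | yes refl | yes refl rewrite e = ≤-refl
        ... | yes _ | no _ = 0≤⟦⟧ (nbr S a b)
        ... | no _ | _ = ≤-trans (≤-reflexive (+-identityʳ _)) (⟦⟧-mono (minus i b ∧ nbr S a b) _ (λ e → proj₂ (∧-true {minus i b} e)))

    isolated-D : ∀ i S → (∀ j → nbr S i j ≡ false) → D full S ≡ D (minus i) S
    isolated-D i S none = ∑-cong (allFin k) (λ a → ∑-cong (allFin k) (λ b → cong ⟦_⟧ (eq a b)))
      where
        eq : ∀ a b → nbr S a b ≡ minus i a ∧ (minus i b ∧ nbr S a b)
        eq a b with a FinP.≟ i | b FinP.≟ i
        ... | yes refl | _ = none b
        ... | no _ | yes refl = trans (nbr-sym S a b) (none a)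
        ... | no _ | no _ = refl

    isolated : (Fin k → Bool) → Vec (Fin n) k → Fin k → Bool
    isolated m S i = m i ∧ not (anyF (λ j → m j ∧ nbr S i j))

    -- Every selected index that is not isolated begins at least one ordered adjacent pair.
    count≤isolated+D : ∀ m S → + count m ≤ + count (isolated m S) + D m S
    count≤isolated+D m S = begin
      + count m
        ≡⟨ count-∑ m ⟩
      ∑ I (λ i → ⟦ m i ⟧)
        ≤⟨ ∑-mono I le ⟩
      ∑ I (λ i → ⟦ isolated m S i ⟧ + ∑ I (λ j → ⟦ m i ∧ (m j ∧ nbr S i j) ⟧))
        ≡⟨ ∑-+ I _ _ ⟩
      ∑ I (λ i → ⟦ isolated m S i ⟧) + D m S
        ≡⟨ cong (_+ D m S) (count-∑ (isolated m S)) ⟨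
      + count (isolated m S) + D m S ∎
      where
        open ≤-Reasoning
        I = allFin k
        le : ∀ i → ⟦ m i ⟧ ≤ ⟦ isolated m S i ⟧ + ∑ I (λ j → ⟦ m i ∧ (m j ∧ nbr S i j) ⟧)
        le i with m i | anyF (λ j → m j ∧ nbr S i j) in eq
        ... | false | _ = ≤-reflexive (sym (trans (+-identityˡ _) (∑-0 I)))
        ... | true | false = ≤-by _ (∑-nonneg I (λ j → 0≤⟦⟧ (m j ∧ nbr S i j))) refl
        ... | true | true with anyF-elim _ eq
        ...   | j , e = ≤-trans (≤-reflexive (sym (cong ⟦_⟧ e)))
                  (≤-trans (term≤∑ j (λ j → ⟦ m j ∧ nbr S i j ⟧) (λ j → 0≤⟦⟧ (m j ∧ nbr S i j))) (≤-reflexive (sym (+-identityˡ _))))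

    nonIsolated : Vec (Fin n) k → Fin k → Bool
    nonIsolated S i = anyF (nbr S i)

    -- Adjacent pairs join non-isolated indices only, so ℓ edges force at least √(2ℓ) of them.
    D≤nonIsolated² : ∀ S → D full S ≤ + count (nonIsolated S) * + count (nonIsolated S)
    D≤nonIsolated² S = begin
      D full S
        ≤⟨ ∑-mono I (λ i → ∑-mono I (λ j → le i j)) ⟩
      ∑ I (λ i → ∑ I (λ j → ⟦ nonIsolated S i ⟧ * ⟦ nonIsolated S j ⟧))
        ≡⟨ ∑-*-∑ I I _ _ ⟨
      ∑ I (λ i → ⟦ nonIsolated S i ⟧) * ∑ I (λ j → ⟦ nonIsolated S j ⟧)
        ≡⟨ cong₂ _*_ (count-∑ (nonIsolated S)) (count-∑ (nonIsolated S)) ⟨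
      + count (nonIsolated S) * + count (nonIsolated S) ∎
      where
        open ≤-Reasoning
        I = allFin k
        le : ∀ i j → ⟦ nbr S i j ⟧ ≤ ⟦ nonIsolated S i ⟧ * ⟦ nonIsolated S j ⟧
        le i j with nbr S i j in e
        ... | false = 0≤* (0≤⟦⟧ (nonIsolated S i)) (0≤⟦⟧ (nonIsolated S j))
        ... | true rewrite anyF-intro (nbr S i) j e | anyF-intro (nbr S j) i (trans (nbr-sym S j i) e) = ≤-refl

  -- Random colourings and samples

  centred-sum : ∀ {n} (p : Fin n → Bool) → ∑ (allFin n) (λ v → + n * ⟦ p v ⟧ + - (+ count p)) ≡ 0ℤ
  centred-sum {n} p = begin
    ∑ (allFin n) (λ v → + n * ⟦ p v ⟧ + - (+ count p))
      ≡⟨ ∑-+ (allFin n) _ _ ⟩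
    ∑ (allFin n) (λ v → + n * ⟦ p v ⟧) + ∑ (allFin n) (λ _ → - (+ count p))
      ≡⟨ cong₂ _+_ (trans (∑-*ˡ (allFin n) (+ n) _) (cong (+ n *_) (sym (count-∑ p)))) (∑-allFin-const n _) ⟩
    + n * + count p + + n * - (+ count p)
      ≡⟨ cancel (+ n) (+ count p) ⟩
    0ℤ ∎
    where
      open ≡-Reasoning
      cancel : ∀ a b → a * b + a * - b ≡ 0ℤ
      cancel = solve-∀

  -- This is n³ times the variance of a Bernoulli variable with mean w/n.
  centred-square : ∀ {n} (p : Fin n → Bool) → let w = + count p in
    ∑ (allFin n) (λ v → (+ n * ⟦ p v ⟧ + - w) * (+ n * ⟦ p v ⟧ + - w)) ≡ + n * (w * (+ n - w))
  centred-square {n} p = begin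
    ∑ (allFin n) (λ v → (+ n * ⟦ p v ⟧ + - w) * (+ n * ⟦ p v ⟧ + - w))
      ≡⟨ ∑-cong (allFin n) (λ v → expand (p v)) ⟩
    ∑ (allFin n) (λ v → (N * N - + 2 * N * w) * ⟦ p v ⟧ + w * w)
      ≡⟨ ∑-+ (allFin n) _ _ ⟩
    ∑ (allFin n) (λ v → (N * N - + 2 * N * w) * ⟦ p v ⟧) + ∑ (allFin n) (λ _ → w * w)
      ≡⟨ cong₂ _+_ (trans (∑-*ˡ (allFin n) (N * N - + 2 * N * w) _) (cong ((N * N - + 2 * N * w) *_) (sym (count-∑ p)))) (∑-allFin-const n _) ⟩
    (N * N - + 2 * N * w) * w + N * (w * w)
      ≡⟨ collect N w ⟩
    N * (w * (N - w)) ∎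
    where
      open ≡-Reasoning
      N = + n
      w = + count p
      collect : ∀ N w → (N * N - + 2 * N * w) * w + N * (w * w) ≡ N * (w * (N - w))
      collect = solve-∀
      expand1 : ∀ N w → (N * 1ℤ + - w) * (N * 1ℤ + - w) ≡ (N * N - + 2 * N * w) * 1ℤ + w * w
      expand1 = solve-∀
      expand0 : ∀ N w → (N * 0ℤ + - w) * (N * 0ℤ + - w) ≡ (N * N - + 2 * N * w) * 0ℤ + w * w
      expand0 = solve-∀
      expand : ∀ b → (N * ⟦ b ⟧ + - w) * (N * ⟦ b ⟧ + - w) ≡ (N * N - + 2 * N * w) * ⟦ b ⟧ + w * w
      expand true = expand1 N w
      expand false = expand0 N w

  length-allFin : ∀ n → length (allFin n) ≡ n
  length-allFin n = length-tabulate (λ (i : Fin n) → i)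

  count-isZero : ∀ {q} → 1 ℕ.≤ q → count (isZero {q}) ≡ 1
  count-isZero {suc q} _ = cong suc (count-none q)

  -- Each index receives a uniformly random colour; the indices of colour 0 form the set B.
  module Colouring (k : ℕ) {q : ℕ} (1≤q : 1 ℕ.≤ q) where

    colours : List (Fin q)
    colours = allFin q

    κs : List (Vec (Fin q) k)
    κs = vecs colours k

    inB : Vec (Fin q) k → Fin k → Bool
    inB κ i = isZero (lookup κ i)

    colours-nonempty : 1ℤ ≤ + length colours
    colours-nonempty = ≤-trans (+≤+ 1≤q) (≤-reflexive (cong +_ (sym (length-allFin q))))

    ∑-κs-1 : ∀ c → ∑ κs (λ _ → c) ≡ + (q ℕ.^ k) * c
    ∑-κs-1 c = trans (∑-const κs c) (cong (_* c) (trans (length-vecs colours k) (cong (λ l → + (l ℕ.^ k)) (length-allFin q))))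

    inB-update : ∀ κ i c → inB (κ [ i ]≔ c) i ≡ isZero c
    inB-update κ i c = cong isZero (lookup∘update i κ c)

    inB-update′ : ∀ κ {i j} c → j ≢ i → inB (κ [ i ]≔ c) j ≡ inB κ j
    inB-update′ κ c j≢i = cong isZero (lookup∘update′ j≢i κ c)

    ∑-isZero : ∀ x → ∑ colours (λ c → ⟦ isZero c ⟧ * x) ≡ x
    ∑-isZero x = begin
      ∑ colours (λ c → ⟦ isZero c ⟧ * x)  ≡⟨ ∑-cong colours (λ c → *-comm ⟦ isZero c ⟧ x) ⟩
      ∑ colours (λ c → x * ⟦ isZero c ⟧)  ≡⟨ ∑-*ˡ colours x (λ c → ⟦ isZero c ⟧) ⟩
      x * ∑ colours (λ c → ⟦ isZero c ⟧)  ≡⟨ cong (x *_) (trans (sym (count-∑ {q} isZero)) (cong +_ (count-isZero 1≤q))) ⟩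
      x * 1ℤ                              ≡⟨ *-identityʳ x ⟩
      x                                   ∎
      where open ≡-Reasoning

    colour-independent : ∀ i (h : Vec (Fin q) k → ℤ) → (∀ κ c → h (κ [ i ]≔ c) ≡ h κ) →
      + q * ∑ κs (λ κ → ⟦ inB κ i ⟧ * h κ) ≡ ∑ κs h
    colour-independent i h inv = begin
      + q * ∑ κs (λ κ → ⟦ inB κ i ⟧ * h κ)
        ≡⟨ cong (λ l → + l * ∑ κs (λ κ → ⟦ inB κ i ⟧ * h κ)) (length-allFin q) ⟨
      + length colours * ∑ κs (λ κ → ⟦ inB κ i ⟧ * h κ)
        ≡⟨ resample colours i _ ⟨
      ∑ κs (λ κ → ∑ colours (λ c → ⟦ inB (κ [ i ]≔ c) i ⟧ * h (κ [ i ]≔ c)))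
        ≡⟨ ∑-cong κs (λ κ → trans (∑-cong colours (λ c → cong₂ (λ a b → ⟦ a ⟧ * b) (inB-update κ i c) (inv κ c))) (∑-isZero (h κ))) ⟩
      ∑ κs h ∎
      where open ≡-Reasoning

    ∑-inB : ∀ i → + q * ∑ κs (λ κ → ⟦ inB κ i ⟧) ≡ + (q ℕ.^ k)
    ∑-inB i = trans (cong (+ q *_) (∑-cong κs (λ κ → sym (*-identityʳ ⟦ inB κ i ⟧))))
      (trans (colour-independent i (λ _ → 1ℤ) (λ _ _ → refl)) (trans (∑-κs-1 1ℤ) (*-identityʳ _)))

    ∑-inB-inB : ∀ {i j} → j ≢ i → + q * + q * ∑ κs (λ κ → ⟦ inB κ i ⟧ * ⟦ inB κ j ⟧) ≡ + (q ℕ.^ k)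
    ∑-inB-inB {i} {j} j≢i = trans (assoc (+ q) (+ q) _) (trans (cong (+ q *_)
      (colour-independent i (λ κ → ⟦ inB κ j ⟧) (λ κ c → cong ⟦_⟧ (inB-update′ κ c j≢i)))) (∑-inB j))
      where
        assoc : ∀ a b c → a * b * c ≡ a * (b * c)
        assoc = solve-∀

    -- The value is q times the number of indices of P in B, minus the size of P. One centred
    -- summand for each index makes the summands orthogonal under random colours.
    deviation : (Fin k → Bool) → Vec (Fin q) k → ℤ
    deviation P κ = ∑ (allFin k) (λ i → ⟦ P i ⟧ * (+ q * ⟦ inB κ i ⟧ + - 1ℤ))

    private
      colour-mean : ∑ colours (λ c → + q * ⟦ isZero c ⟧ + - 1ℤ) ≡ 0ℤ
      colour-mean = subst (λ w → ∑ colours (λ c → + q * ⟦ isZero c ⟧ + - (+ w)) ≡ 0ℤ) (count-isZero 1≤q) (centred-sum {q} isZero)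

      colour-square : ∑ colours (λ c → (+ q * ⟦ isZero c ⟧ + - 1ℤ) * (+ q * ⟦ isZero c ⟧ + - 1ℤ)) ≤ + q * + q
      colour-square = ≤-by (+ q) 0≤+ (trans (collect (+ q)) (cong (_+ + q) (sym
        (subst (λ w → ∑ colours (λ c → (+ q * ⟦ isZero c ⟧ + - (+ w)) * (+ q * ⟦ isZero c ⟧ + - (+ w))) ≡ + q * (+ w * (+ q - + w)))
          (count-isZero 1≤q) (centred-square {q} isZero)))))
        where
          collect : ∀ q → q * q ≡ q * (1ℤ * (q - 1ℤ)) + q
          collect = solve-∀

    deviation² : ∀ P → ∑ κs (λ κ → deviation P κ * deviation P κ) ≤ + k * (+ (q ℕ.^ k) * + q)
    deviation² P = ≤-trans (∑-orthogonal κs k η (λ _ → + (q ℕ.^ k) * + q) orth diag) (≤-reflexive (∑-allFin-const k _))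
      where
        η : Fin k → Vec (Fin q) k → ℤ
        η i κ = ⟦ P i ⟧ * (+ q * ⟦ inB κ i ⟧ + - 1ℤ)
        u : Fin q → ℤ
        u c = + q * ⟦ isZero c ⟧ + - 1ℤ
        upd : ∀ κ i c → η i (κ [ i ]≔ c) ≡ ⟦ P i ⟧ * u c
        upd κ i c = cong (λ b → ⟦ P i ⟧ * (+ q * ⟦ b ⟧ + - 1ℤ)) (inB-update κ i c)
        rearrange : ∀ p z e → p * z * e ≡ p * e * z
        rearrange = solve-∀
        orth : ∀ i j → j ≢ i → ∑ κs (λ κ → η i κ * η j κ) ≡ 0ℤ
        orth i j j≢i = resample-0 colours colours-nonempty i _ λ κ → begin
          ∑ colours (λ c → η i (κ [ i ]≔ c) * η j (κ [ i ]≔ c))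
            ≡⟨ ∑-cong colours (λ c → trans (cong₂ _*_ (upd κ i c)
                 (cong (λ b → ⟦ P j ⟧ * (+ q * ⟦ b ⟧ + - 1ℤ)) (inB-update′ κ c j≢i))) (rearrange ⟦ P i ⟧ (u c) (η j κ))) ⟩
          ∑ colours (λ c → ⟦ P i ⟧ * η j κ * u c)
            ≡⟨ trans (∑-*ˡ colours (⟦ P i ⟧ * η j κ) u) (trans (cong (⟦ P i ⟧ * η j κ *_) colour-mean) (*-zeroʳ (⟦ P i ⟧ * η j κ))) ⟩
          0ℤ ∎
          where open ≡-Reasoning
        square : ∀ b z → (⟦ b ⟧ * z) * (⟦ b ⟧ * z) ≤ z * z
        square true z = ≤-reflexive (one z)
          where
            one : ∀ z → (1ℤ * z) * (1ℤ * z) ≡ z * z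
            one = solve-∀
        square false z = 0≤sq z
        diag : ∀ i → ∑ κs (λ κ → η i κ * η i κ) ≤ + (q ℕ.^ k) * + q
        diag i = ≤-trans (resample-≤ colours colours-nonempty i _ (λ _ → + q) (λ κ → ≤-trans
          (∑-mono colours (λ c → ≤-trans (≤-reflexive (cong₂ _*_ (upd κ i c) (upd κ i c))) (square (P i) (u c))))
          (≤-trans colour-square (≤-reflexive (cong (λ l → + l * + q) (sym (length-allFin q))))))) (≤-reflexive (∑-κs-1 (+ q)))

  module Sampling {n : ℕ} (1≤n : 1 ℕ.≤ n) (g : Fin n → Fin n → Bool) (k : ℕ) {q : ℕ} (1≤q : 1 ℕ.≤ q) where

    open Colouring k 1≤q public

    V : List (Fin n)
    V = allFin n

    Ss : List (Vec (Fin n) k)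
    Ss = vecs V k

    N : ℤ
    N = + n

    V-nonempty : 1ℤ ≤ + length V
    V-nonempty = ≤-trans (+≤+ 1≤n) (≤-reflexive (cong +_ (sym (length-allFin n))))

    ∑-Ss-1 : ∀ c → ∑ Ss (λ _ → c) ≡ + (n ℕ.^ k) * c
    ∑-Ss-1 c = trans (∑-const Ss c) (cong (_* c) (trans (length-vecs V k) (cong (λ l → + (l ℕ.^ k)) (length-allFin n))))

    -- v is adjacent to the part of the sample whose colour is not 0.
    touch : Vec (Fin n) k → Vec (Fin q) k → Fin n → Bool
    touch S κ v = anyF (λ j → not (inB κ j) ∧ g v (lookup S j))

    -- Entries in B have no influence on which vertices are touched. Hence `touch` and `W` stay
    -- fixed while the vertices of B are still random.
    touch-update : ∀ S κ i u → inB κ i ≡ true → ∀ v → touch (S [ i ]≔ u) κ v ≡ touch S κ v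
    touch-update S κ i u i∈B v = anyF-cong eq
      where
        eq : ∀ j → not (inB κ j) ∧ g v (lookup (S [ i ]≔ u) j) ≡ not (inB κ j) ∧ g v (lookup S j)
        eq j with j FinP.≟ i
        ... | yes refl rewrite i∈B = refl
        ... | no j≢i = cong (λ w → not (inB κ j) ∧ g v w) (lookup∘update′ j≢i S u)

    W : Vec (Fin n) k → Vec (Fin q) k → ℕ
    W S κ = count (touch S κ)

    W-update : ∀ S κ i u → inB κ i ≡ true → W (S [ i ]≔ u) κ ≡ W S κ
    W-update S κ i u i∈B = count-cong (touch-update S κ i u i∈B)

    -- For i in B this is n times the indicator that the i-th vertex is touched, minus n times its
    -- conditional probability W/n.
    ξ : Vec (Fin q) k → Fin k → Vec (Fin n) k → ℤ
    ξ κ i S = ⟦ inB κ i ⟧ * (N * ⟦ touch S κ (lookup S i) ⟧ + - (+ W S κ))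

    ξ-update : ∀ κ i S v → inB κ i ≡ true → ξ κ i (S [ i ]≔ v) ≡ N * ⟦ touch S κ v ⟧ + - (+ W S κ)
    ξ-update κ i S v i∈B rewrite i∈B | W-update S κ i v i∈B | lookup∘update i S v | touch-update S κ i v i∈B v = *-identityˡ _

    ξ-update′ : ∀ κ {i j} S v → inB κ i ≡ true → j ≢ i → ξ κ j (S [ i ]≔ v) ≡ ξ κ j S
    ξ-update′ κ {i} {j} S v i∈B j≢i rewrite W-update S κ i v i∈B | lookup∘update′ j≢i S v | touch-update S κ i v i∈B (lookup S j) = refl

    -- For i in B the i-th vertex is uniform while `touch` and h are fixed, so the conditional mean
    -- of ξ is 0; for i outside B, ξ vanishes.
    ξ-mean : ∀ κ i (h : Vec (Fin n) k → ℤ) → (inB κ i ≡ true → ∀ S v → h (S [ i ]≔ v) ≡ h S) →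
      ∑ Ss (λ S → h S * ξ κ i S) ≡ 0ℤ
    ξ-mean κ i h inv with inB κ i in i∈B
    ... | false = trans (∑-cong Ss (λ S → trans (cong (h S *_) (*-zeroˡ (N * ⟦ touch S κ (lookup S i) ⟧ + - (+ W S κ)))) (*-zeroʳ (h S)))) (∑-0 Ss)
    ... | true = trans (∑-cong Ss (λ S → cong (λ b → h S * (⟦ b ⟧ * (N * ⟦ touch S κ (lookup S i) ⟧ + - (+ W S κ)))) (sym i∈B)))
      (resample-0 V V-nonempty i (λ S → h S * ξ κ i S) λ S → begin
        ∑ V (λ v → h (S [ i ]≔ v) * ξ κ i (S [ i ]≔ v))
          ≡⟨ ∑-cong V (λ v → cong₂ _*_ (inv refl S v) (ξ-update κ i S v i∈B)) ⟩
        ∑ V (λ v → h S * (N * ⟦ touch S κ v ⟧ + - (+ W S κ)))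
          ≡⟨ trans (∑-*ˡ V (h S) _) (trans (cong (h S *_) (centred-sum (touch S κ))) (*-zeroʳ (h S))) ⟩
        0ℤ ∎)
      where open ≡-Reasoning

    -- For i in B, neither the weight nor any other ξ sees the i-th vertex, which kills the cross
    -- terms. The diagonal term has conditional mean w² W (N - W).
    ξ-variance : ∀ κ (w : Vec (Fin n) k → ℤ) (β : ℤ) →
      (∀ i → inB κ i ≡ true → ∀ S v → w (S [ i ]≔ v) ≡ w S) →
      (∀ S → w S * w S * (+ W S κ * (N - + W S κ)) ≤ β) →
      ∑ Ss (λ S → ∑ (allFin k) (λ i → w S * ξ κ i S) * ∑ (allFin k) (λ i → w S * ξ κ i S))
        ≤ ∑ (allFin k) (λ i → ⟦ inB κ i ⟧ * (+ (n ℕ.^ k) * β))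
    ξ-variance κ w β inv bound = ∑-orthogonal Ss k (λ i S → w S * ξ κ i S) _ orth diag
      where
        rearrange : ∀ w x y → w * x * (w * y) ≡ w * w * y * x
        rearrange = solve-∀
        orth : ∀ i j → j ≢ i → ∑ Ss (λ S → w S * ξ κ i S * (w S * ξ κ j S)) ≡ 0ℤ
        orth i j j≢i = trans (∑-cong Ss (λ S → rearrange (w S) (ξ κ i S) (ξ κ j S)))
          (ξ-mean κ i (λ S → w S * w S * ξ κ j S) (λ i∈B S v →
            cong₂ _*_ (cong₂ _*_ (inv i i∈B S v) (inv i i∈B S v)) (ξ-update′ κ S v i∈B j≢i)))
        assemble : ∀ w x → w * x * (w * x) ≡ w * w * (x * x)
        assemble = solve-∀
        commute : ∀ a b c → a * (b * c) ≡ b * (a * c)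
        commute = solve-∀
        diag : ∀ i → ∑ Ss (λ S → w S * ξ κ i S * (w S * ξ κ i S)) ≤ ⟦ inB κ i ⟧ * (+ (n ℕ.^ k) * β)
        diag i with inB κ i in i∈B
        ... | false = ≤-reflexive (trans (∑-cong Ss (λ S → cong (λ z → z * z) (zero-term (w S) (N * ⟦ touch S κ (lookup S i) ⟧ + - (+ W S κ))))) (trans (∑-0 Ss) (sym (*-zeroˡ (+ (n ℕ.^ k) * β)))))
          where
            zero-term : ∀ w x → w * (0ℤ * x) ≡ 0ℤ
            zero-term = solve-∀
        ... | true = ≤-trans (≤-reflexive (∑-cong Ss (λ S → cong (λ b → w S * (⟦ b ⟧ * (N * ⟦ touch S κ (lookup S i) ⟧ + - (+ W S κ))) * (w S * (⟦ b ⟧ * (N * ⟦ touch S κ (lookup S i) ⟧ + - (+ W S κ))))) (sym i∈B))))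
          (≤-trans (resample-≤ V V-nonempty i (λ S → w S * ξ κ i S * (w S * ξ κ i S)) (λ _ → β) step) (≤-reflexive (trans (∑-Ss-1 β) (sym (*-identityˡ _)))))
          where
            step : ∀ S → ∑ V (λ v → w (S [ i ]≔ v) * ξ κ i (S [ i ]≔ v) * (w (S [ i ]≔ v) * ξ κ i (S [ i ]≔ v))) ≤ + length V * β
            step S = begin
              ∑ V (λ v → w (S [ i ]≔ v) * ξ κ i (S [ i ]≔ v) * (w (S [ i ]≔ v) * ξ κ i (S [ i ]≔ v)))
                ≡⟨ ∑-cong V (λ v → trans (cong (λ z → z * z) (cong₂ _*_ (inv i i∈B S v) (ξ-update κ i S v i∈B))) (assemble (w S) (x v))) ⟩
              ∑ V (λ v → w S * w S * (x v * x v))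
                ≡⟨ trans (∑-*ˡ V (w S * w S) (λ v → x v * x v)) (cong (w S * w S *_) (centred-square (touch S κ))) ⟩
              w S * w S * (N * (+ W S κ * (N - + W S κ)))
                ≡⟨ commute (w S * w S) N (+ W S κ * (N - + W S κ)) ⟩
              N * (w S * w S * (+ W S κ * (N - + W S κ)))
                ≤⟨ *-monoˡ N 0≤+ (bound S) ⟩
              N * β
                ≡⟨ cong (λ l → + l * β) (length-allFin n) ⟨
              + length V * β ∎
              where
                open ≤-Reasoning
                x : Fin n → ℤ
                x v = N * ⟦ touch S κ v ⟧ + - (+ W S κ)

  -- Colourings leaving few vertices untouched are rare

  ≤ᵇ-true : ∀ a b → (a ℕ.≤ᵇ b) ≡ true → a ℕ.≤ b
  ≤ᵇ-true a b e = ℕP.≤ᵇ⇒≤ a b (subst IsTrue (sym e) tt)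

  ≤ᵇ-false : ∀ a b → (a ℕ.≤ᵇ b) ≡ false → b ℕ.≤ a
  ≤ᵇ-false a b e with ℕP.≤-total b a
  ... | inj₁ b≤a = b≤a
  ... | inj₂ a≤b with subst IsTrue e (ℕP.≤⇒≤ᵇ a≤b)
  ... | ()

  ∧-false : ∀ {a b} → a ∧ b ≡ false → a ≡ false ⊎ b ≡ false
  ∧-false {false} _ = inj₁ refl
  ∧-false {true} e = inj₂ e

  square-mono : ∀ {a b} → 0ℤ ≤ a → a ≤ b → a * a ≤ b * b
  square-mono 0≤a a≤b = *-mono 0≤a (≤-trans 0≤a a≤b) a≤b a≤b

  -- Cauchy-Schwarz for three terms; 12 is 2² times 3.
  square-of-three : ∀ {t} a b c → 0ℤ ≤ t → t ≤ + 2 * (a + b + c) → t * t ≤ + 12 * (a * a + b * b + c * c)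
  square-of-three {t} a b c 0≤t t≤ = ≤-trans (square-mono 0≤t t≤)
    (≤-by (+ 4 * ((a - b) * (a - b) + (a - c) * (a - c) + (b - c) * (b - c)))
      (0≤* {+ 4} 0≤+ (0≤+⁺ (0≤+⁺ (0≤sq (a - b)) (0≤sq (a - c))) (0≤sq (b - c)))) (identity a b c))
    where
      identity : ∀ a b c → + 12 * (a * a + b * b + c * c) ≡ + 2 * (a + b + c) * (+ 2 * (a + b + c)) +
        + 4 * ((a - b) * (a - b) + (a - c) * (a - c) + (b - c) * (b - c))
      identity = solve-∀

  0≤-diff : ∀ {a b} → a ≤ b → 0ℤ ≤ b - a
  0≤-diff = i≤j⇒0≤j-i

  -- Chebyshev's inequality in multiplied-out form: if too few vertices are not adjacent to A
  -- although c indices are isolated, then one of the three deviations is large.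
  chebyshev-dense : ∀ {N k ν q W y b I c} → 0ℤ ≤ N → 0ℤ ≤ k → 0ℤ ≤ ν → 0ℤ ≤ q → W ≤ N → ν * (N - W) ≤ N →
    I + y ≤ b → + 3 * k ≤ + 2 * ν * c →
    let Z = N * y - b * W ; Z' = q * I - c ; Z'' = q * b - k in
    (k * N) * (k * N) ≤ + 12 * (ν * ν * (q * q)) * (Z * Z) + + 12 * (N * N * (ν * ν)) * (Z' * Z') + + 112 * (N * N) * (Z'' * Z'')
  chebyshev-dense {N} {k} {ν} {q} {W} {y} {b} {I} {c} 0≤N 0≤k 0≤ν 0≤q W≤N dense I+y≤b 3k≤2νc =
    ≤-trans (square-of-three (- (ν * q * Z)) (- (N * ν * Z')) (ν * (N - W) * Z'') (0≤* 0≤k 0≤N)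
      -- Substituting `q I = c + Z'`, `N y = b W + Z` and `q b = k + Z''` into `I + y ≤ b` gives
      -- `N c + N Z' + q Z ≤ (k + Z'') (N - W)`. As νc is at least 3k/2 but ν(N - W) is at most N, a
      -- gap of kN/2 is left to the deviations.
      (≤-by (+ 2 * (ν * q * N) * (b - (I + y)) + N * (+ 2 * ν * c - + 3 * k) + + 2 * k * (N - ν * (N - W)))
        (0≤+⁺ (0≤+⁺ (0≤* (0≤* {+ 2} 0≤+ (0≤* (0≤* 0≤ν 0≤q) 0≤N)) (0≤-diff I+y≤b)) (0≤* 0≤N (0≤-diff 3k≤2νc)))
          (0≤* (0≤* {+ 2} 0≤+ 0≤k) (0≤-diff dense)))
        (expand N k ν q W y b I c)))
    (≤-by (+ 100 * (N * N) * (Z'' * Z'') + + 12 * ((N * N - ν * (N - W) * (ν * (N - W))) * (Z'' * Z'')))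
      (0≤+⁺ (0≤* (0≤* {+ 100} 0≤+ (0≤sq N)) (0≤sq Z''))
        (0≤* {+ 12} 0≤+ (0≤* (0≤-diff (square-mono (0≤* 0≤ν (0≤-diff W≤N)) dense)) (0≤sq Z''))))
      (collect N ν q (N - W) Z Z' Z''))
    where
      Z = N * y - b * W
      Z' = q * I - c
      Z'' = q * b - k
      expand : ∀ N k ν q W y b I c →
        + 2 * (- (ν * q * (N * y - b * W)) + - (N * ν * (q * I - c)) + ν * (N - W) * (q * b - k)) ≡ k * N +
        (+ 2 * (ν * q * N) * (b - (I + y)) + N * (+ 2 * ν * c - + 3 * k) + + 2 * k * (N - ν * (N - W)))
      expand = solve-∀
      collect : ∀ N ν q U Z Z' Z'' →
        + 12 * (ν * ν * (q * q)) * (Z * Z) + + 12 * (N * N * (ν * ν)) * (Z' * Z') + + 112 * (N * N) * (Z'' * Z'') ≡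
        + 12 * (- (ν * q * Z) * - (ν * q * Z) + - (N * ν * Z') * - (N * ν * Z') + ν * U * Z'' * (ν * U * Z'')) +
        (+ 100 * (N * N) * (Z'' * Z'') + + 12 * ((N * N - ν * U * (ν * U)) * (Z'' * Z'')))
      collect = solve-∀

  -- Here `q b` alone deviates from k by at least k/10, which costs a factor 100. With 112 = 100 +
  -- 12 both cases fit under the same coefficient of the third deviation.
  chebyshev-few : ∀ {N k qb} → 0ℤ ≤ N → 0ℤ ≤ k → + 10 * qb ≤ + 9 * k → let Z'' = qb - k in
    (k * N) * (k * N) ≤ + 112 * (N * N) * (Z'' * Z'')
  chebyshev-few {N} {k} {qb} 0≤N 0≤k few = ≤-trans
    (square-mono (0≤* 0≤k 0≤N) (≤-by (N * (+ 9 * k - + 10 * qb)) (0≤* 0≤N (0≤-diff few)) (expand N k qb)))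
    (≤-by (+ 12 * (N * N) * (Z'' * Z'')) (0≤* (0≤* {+ 12} 0≤+ (0≤sq N)) (0≤sq Z'')) (collect N Z''))
    where
      Z'' = qb - k
      expand : ∀ N k x → N * (- (+ 10) * (x - k)) ≡ k * N + N * (+ 9 * k - + 10 * x)
      expand = solve-∀
      collect : ∀ N z → + 112 * (N * N) * (z * z) ≡ N * (- (+ 10) * z) * (N * (- (+ 10) * z)) + + 12 * (N * N) * (z * z)
      collect = solve-∀

  -- Second moments over samples and colourings

  module Bounds {n : ℕ} (1≤n : 1 ℕ.≤ n) (g : Fin n → Fin n → Bool) (k : ℕ) (1≤k : 1 ℕ.≤ k)
    (ν : ℕ) {q : ℕ} (1≤q : 1 ℕ.≤ q) where

    open Sampling 1≤n g k 1≤q public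

    I : List (Fin k)
    I = allFin k

    E : (Vec (Fin n) k → Vec (Fin q) k → ℤ) → ℤ
    E F = ∑ Ss (λ S → ∑ κs (F S))

    E-cong : ∀ {F G} → (∀ S κ → F S κ ≡ G S κ) → E F ≡ E G
    E-cong e = ∑-cong Ss (λ S → ∑-cong κs (e S))

    E-mono : ∀ {F G} → (∀ S κ → F S κ ≤ G S κ) → E F ≤ E G
    E-mono e = ∑-mono Ss (λ S → ∑-mono κs (e S))

    E-+ : ∀ F G → E (λ S κ → F S κ + G S κ) ≡ E F + E G
    E-+ F G = trans (∑-cong Ss (λ S → ∑-+ κs (F S) (G S))) (∑-+ Ss _ _)

    E-*ˡ : ∀ c F → E (λ S κ → c * F S κ) ≡ c * E F
    E-*ˡ c F = trans (∑-cong Ss (λ S → ∑-*ˡ κs c (F S))) (∑-*ˡ Ss c _)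

    E-∑ : ∀ (F : Fin k → Vec (Fin n) k → Vec (Fin q) k → ℤ) → E (λ S κ → ∑ I (λ i → F i S κ)) ≡ ∑ I (λ i → E (F i))
    E-∑ F = trans (∑-cong Ss (λ S → ∑-swap κs I _)) (∑-swap Ss I _)

    -- The number of outcomes, by which `E` has to be divided to become an expectation.
    M : ℤ
    M = + (n ℕ.^ k) * + (q ℕ.^ k)

    0≤M : 0ℤ ≤ M
    0≤M = 0≤* {+ (n ℕ.^ k)} {+ (q ℕ.^ k)} 0≤+ 0≤+

    E-const : ∀ c → E (λ _ _ → c) ≡ M * c
    E-const c = trans (∑-cong Ss (λ _ → ∑-κs-1 c)) (trans (∑-Ss-1 _) (assoc (+ (n ℕ.^ k)) (+ (q ℕ.^ k)) c))
      where
        assoc : ∀ a b c → a * (b * c) ≡ a * b * c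
        assoc = solve-∀

    b : Vec (Fin q) k → ℕ
    b κ = count (inB κ)

    y : Vec (Fin n) k → Vec (Fin q) k → Fin k → ℤ
    y S κ i = ⟦ inB κ i ⟧ * ⟦ touch S κ (lookup S i) ⟧

    Y : Vec (Fin n) k → Vec (Fin q) k → ℤ
    Y S κ = ∑ I (y S κ)

    0≤y : ∀ S κ i → 0ℤ ≤ y S κ i
    0≤y S κ i = 0≤* (0≤⟦⟧ (inB κ i)) (0≤⟦⟧ (touch S κ (lookup S i)))

    ∑ξ : ∀ S κ → ∑ I (λ i → ξ κ i S) ≡ N * Y S κ - + b κ * + W S κ
    ∑ξ S κ = begin
      ∑ I (λ i → ξ κ i S)
        ≡⟨ ∑-cong I (λ i → split ⟦ inB κ i ⟧ N ⟦ touch S κ (lookup S i) ⟧ (+ W S κ)) ⟩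
      ∑ I (λ i → N * y S κ i + - (+ W S κ) * ⟦ inB κ i ⟧)
        ≡⟨ trans (∑-+ I _ _) (cong₂ _+_ (∑-*ˡ I N (y S κ)) (trans (∑-*ˡ I (- (+ W S κ)) (λ i → ⟦ inB κ i ⟧)) (cong (- (+ W S κ) *_) (sym (count-∑ (inB κ)))))) ⟩
      N * Y S κ + - (+ W S κ) * + b κ
        ≡⟨ collect (N * Y S κ) (+ W S κ) (+ b κ) ⟩
      N * Y S κ - + b κ * + W S κ ∎
      where
        open ≡-Reasoning
        split : ∀ a N t w → a * (N * t + - w) ≡ N * (a * t) + - w * a
        split = solve-∀
        collect : ∀ x w b → x + - w * b ≡ x - b * w
        collect = solve-∀

    W≤N : ∀ S κ → + W S κ ≤ N
    W≤N S κ = +≤+ (count≤ (touch S κ))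

    isoB : (Fin k → Bool) → Vec (Fin q) k → ℤ
    isoB P κ = ∑ I (λ i → ⟦ P i ⟧ * ⟦ inB κ i ⟧)

    deviation-value : ∀ P κ → deviation P κ ≡ + q * isoB P κ - + count P
    deviation-value P κ = begin
      deviation P κ
        ≡⟨ ∑-cong I (λ i → split ⟦ P i ⟧ (+ q) ⟦ inB κ i ⟧) ⟩
      ∑ I (λ i → + q * (⟦ P i ⟧ * ⟦ inB κ i ⟧) + - 1ℤ * ⟦ P i ⟧)
        ≡⟨ trans (∑-+ I _ _) (cong₂ _+_ (∑-*ˡ I (+ q) _) (trans (∑-*ˡ I (- 1ℤ) (λ i → ⟦ P i ⟧)) (cong (- 1ℤ *_) (sym (count-∑ P))))) ⟩
      + q * isoB P κ + - 1ℤ * + count P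
        ≡⟨ collect (+ q * isoB P κ) (+ count P) ⟩
      + q * isoB P κ - + count P ∎
      where
        open ≡-Reasoning
        split : ∀ p q z → p * (q * z + - 1ℤ) ≡ q * (p * z) + - 1ℤ * p
        split = solve-∀
        collect : ∀ a c → a + - 1ℤ * c ≡ a - c
        collect = solve-∀

    all : Fin k → Bool
    all _ = true

    deviation-all : ∀ κ → deviation all κ ≡ + q * + b κ - + k
    deviation-all κ = trans (deviation-value all κ) (cong₂ (λ x c → + q * x - c)
      (trans (∑-cong I (λ i → *-identityˡ ⟦ inB κ i ⟧)) (sym (count-∑ (inB κ))))
      (trans (count-∑ all) (trans (∑-allFin-const k 1ℤ) (*-identityʳ (+ k)))))

    -- The colour classes for which B is not too small and A leaves a proportion 1/ν of all vertices untouched.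
    cut : Vec (Fin n) k → Vec (Fin q) k → Bool
    cut S κ = (ν ℕ.* W S κ ℕ.+ n ℕ.≤ᵇ ν ℕ.* n) ∧ (9 ℕ.* k ℕ.≤ᵇ 10 ℕ.* (q ℕ.* b κ))

    private
      10qb : ∀ κ → + (10 ℕ.* (q ℕ.* b κ)) ≡ + 10 * (+ q * + b κ)
      10qb κ = trans (pos-* 10 (q ℕ.* b κ)) (cong (+ 10 *_) (pos-* q (b κ)))

    cut-true : ∀ S κ → cut S κ ≡ true → N ≤ + ν * (N - + W S κ) × + 9 * + k ≤ + 10 * (+ q * + b κ)
    cut-true S κ e = ≤-by _ (0≤-diff p) (rearrange (+ ν) (+ W S κ) N) , r
      where
        p : + ν * + W S κ + N ≤ + ν * N
        p = ≤-trans (≤-reflexive (cong (_+ N) (sym (pos-* ν (W S κ)))))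
          (≤-trans (+≤+ (≤ᵇ-true _ _ (proj₁ (∧-true e)))) (≤-reflexive (pos-* ν n)))
        r : + 9 * + k ≤ + 10 * (+ q * + b κ)
        r = ≤-trans (≤-reflexive (sym (pos-* 9 k)))
          (≤-trans (+≤+ (≤ᵇ-true _ _ (proj₂ (∧-true {ν ℕ.* W S κ ℕ.+ n ℕ.≤ᵇ ν ℕ.* n} e)))) (≤-reflexive (10qb κ)))
        rearrange : ∀ ν w N → ν * (N - w) ≡ N + (ν * N - (ν * w + N))
        rearrange = solve-∀

    cut-false : ∀ S κ → cut S κ ≡ false → (+ ν * (N - + W S κ) ≤ N) ⊎ (+ 10 * (+ q * + b κ) ≤ + 9 * + k)
    cut-false S κ e with ∧-false {ν ℕ.* W S κ ℕ.+ n ℕ.≤ᵇ ν ℕ.* n} e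
    ... | inj₁ p = inj₁ (≤-by _ (0≤-diff p′) (rearrange (+ ν) (+ W S κ) N))
      where
        p′ : + ν * N ≤ + ν * + W S κ + N
        p′ = ≤-trans (≤-reflexive (sym (pos-* ν n)))
          (≤-trans (+≤+ (≤ᵇ-false _ _ p)) (≤-reflexive (cong (_+ N) (pos-* ν (W S κ)))))
        rearrange : ∀ ν w N → N ≡ ν * (N - w) + ((ν * w + N) - ν * N)
        rearrange = solve-∀
    ... | inj₂ r = inj₂ (≤-trans (≤-reflexive (sym (10qb κ)))
        (≤-trans (+≤+ (≤ᵇ-false _ _ r)) (≤-reflexive (pos-* 9 k))))

    cut-update : ∀ S κ i v → inB κ i ≡ true → cut (S [ i ]≔ v) κ ≡ cut S κ
    cut-update S κ i v i∈B = cong (λ w → (ν ℕ.* w ℕ.+ n ℕ.≤ᵇ ν ℕ.* n) ∧ (9 ℕ.* k ℕ.≤ᵇ 10 ℕ.* (q ℕ.* b κ))) (W-update S κ i v i∈B)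

    -- An index lies in B for one colouring in q, which accounts for the factor q on the left.
    E-variance : ∀ (w : Vec (Fin n) k → Vec (Fin q) k → ℤ) (β : ℤ) →
      (∀ κ i → inB κ i ≡ true → ∀ S v → w (S [ i ]≔ v) κ ≡ w S κ) →
      (∀ S κ → w S κ * w S κ * (+ W S κ * (N - + W S κ)) ≤ β) →
      + q * E (λ S κ → ∑ I (λ i → w S κ * ξ κ i S) * ∑ I (λ i → w S κ * ξ κ i S)) ≤ + k * (M * β)
    E-variance w β inv bound = begin
      + q * E (λ S κ → ∑ I (λ i → w S κ * ξ κ i S) * ∑ I (λ i → w S κ * ξ κ i S))
        ≡⟨ cong (+ q *_) (∑-swap Ss κs _) ⟩
      + q * ∑ κs (λ κ → ∑ Ss (λ S → ∑ I (λ i → w S κ * ξ κ i S) * ∑ I (λ i → w S κ * ξ κ i S)))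
        ≤⟨ *-monoˡ (+ q) 0≤+ (∑-mono κs (λ κ → ξ-variance κ (λ S → w S κ) β (inv κ) (λ S → bound S κ))) ⟩
      + q * ∑ κs (λ κ → ∑ I (λ i → ⟦ inB κ i ⟧ * (+ (n ℕ.^ k) * β)))
        ≡⟨ cong (+ q *_) (∑-swap κs I _) ⟩
      + q * ∑ I (λ i → ∑ κs (λ κ → ⟦ inB κ i ⟧ * (+ (n ℕ.^ k) * β)))
        ≡⟨ ∑-*ˡ I (+ q) _ ⟨
      ∑ I (λ i → + q * ∑ κs (λ κ → ⟦ inB κ i ⟧ * (+ (n ℕ.^ k) * β)))
        ≡⟨ ∑-cong I (λ i → trans (colour-independent i (λ _ → + (n ℕ.^ k) * β) (λ _ _ → refl)) (∑-κs-1 _)) ⟩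
      ∑ I (λ i → + (q ℕ.^ k) * (+ (n ℕ.^ k) * β))
        ≡⟨ ∑-allFin-const k _ ⟩
      + k * (+ (q ℕ.^ k) * (+ (n ℕ.^ k) * β))
        ≡⟨ cong (+ k *_) (commute (+ (q ℕ.^ k)) (+ (n ℕ.^ k)) β) ⟩
      + k * (M * β) ∎
      where
        open ≤-Reasoning
        commute : ∀ a b c → a * (b * c) ≡ b * a * c
        commute = solve-∀

    -- The three second moments of Chebyshev's inequality contribute 12ν²q, 12ν²q and 112q, in units
    -- of k N² M.
    τ : ℤ
    τ = + q * (+ 24 * (+ ν * + ν) + + 112)

    -- Indices of `P S` in B are untouched, so they are disjoint from those counted by `Y` and
    -- `isoB + Y ≤ b`. Outside `cut` one of the deviations then has square of order (kN)², while its
    -- mean square is of order kN²; Markov's inequality leaves a probability of at most τ/k.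
    ¬cut-rare : (Ev : Vec (Fin n) k → Vec (Fin q) k → Bool) (P : Vec (Fin n) k → Fin k → Bool) →
      (∀ S κ → Ev S κ ≡ true → + 3 * + k ≤ + 2 * + ν * + count (P S)) →
      (∀ S κ i → Ev S κ ≡ true → P S i ≡ true → inB κ i ≡ true → touch S κ (lookup S i) ≡ false) →
      + k * E (λ S κ → ⟦ Ev S κ ∧ not (cut S κ) ⟧) ≤ M * τ
    ¬cut-rare Ev P many untouched = *-cancelˡ (+ k * (N * N)) 1≤kN² (begin
      + k * (N * N) * (+ k * X)
        ≡⟨ regroup (+ k) N X ⟩
      (+ k * N) * (+ k * N) * X
        ≡⟨ E-*ˡ ((+ k * N) * (+ k * N)) _ ⟨
      E (λ S κ → (+ k * N) * (+ k * N) * ⟦ Ev S κ ∧ not (cut S κ) ⟧)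
        ≤⟨ E-mono pointwise ⟩
      E (λ S κ → c₁ * (Z S κ * Z S κ) + c₂ * (Z′ S κ * Z′ S κ) + c₃ * (Z″ κ * Z″ κ))
        ≡⟨ trans (E-+ _ _) (cong₂ _+_ (trans (E-+ _ _) (cong₂ _+_ (E-*ˡ c₁ _) (E-*ˡ c₂ _))) (E-*ˡ c₃ _)) ⟩
      c₁ * E (λ S κ → Z S κ * Z S κ) + c₂ * E (λ S κ → Z′ S κ * Z′ S κ) + c₃ * E (λ S κ → Z″ κ * Z″ κ)
        ≡⟨ cong (λ z → z + c₂ * E (λ S κ → Z′ S κ * Z′ S κ) + c₃ * E (λ S κ → Z″ κ * Z″ κ)) (pull-q (+ ν) (+ q) (E (λ S κ → Z S κ * Z S κ))) ⟩
      + 12 * (+ ν * + ν * + q) * (+ q * E (λ S κ → Z S κ * Z S κ)) + c₂ * E (λ S κ → Z′ S κ * Z′ S κ) + c₃ * E (λ S κ → Z″ κ * Z″ κ)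
        ≤⟨ +-mono-≤ (+-mono-≤ (*-monoˡ (+ 12 * (+ ν * + ν * + q)) (0≤* {+ 12} 0≤+ (0≤* {+ ν * + ν} (0≤sq (+ ν)) (0≤+ {q}))) EZ²) (*-monoˡ c₂ (0≤* {+ 12} 0≤+ (0≤* (0≤sq N) (0≤sq (+ ν)))) (Edev² P)))
             (*-monoˡ c₃ (0≤* {+ 112} 0≤+ (0≤sq N)) (Edev² (λ _ → all))) ⟩
      + 12 * (+ ν * + ν * + q) * (+ k * (M * (N * N))) + c₂ * (M * (+ k * + q)) + c₃ * (M * (+ k * + q))
        ≡⟨ total (+ k) N (+ ν) (+ q) M ⟩
      + k * (N * N) * (M * τ) ∎)
      where
        open ≤-Reasoning
        X = E (λ S κ → ⟦ Ev S κ ∧ not (cut S κ) ⟧)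
        c₁ = + 12 * (+ ν * + ν * (+ q * + q))
        c₂ = + 12 * (N * N * (+ ν * + ν))
        c₃ = + 112 * (N * N)
        Z : Vec (Fin n) k → Vec (Fin q) k → ℤ
        Z S κ = ∑ I (λ i → ξ κ i S)
        Z′ : Vec (Fin n) k → Vec (Fin q) k → ℤ
        Z′ S κ = deviation (P S) κ
        Z″ : Vec (Fin q) k → ℤ
        Z″ κ = deviation all κ
        1≤kN² : 1ℤ ≤ + k * (N * N)
        1≤kN² = *-mono {1ℤ} {+ k} {1ℤ} {N * N} 0≤+ (0≤sq N) (+≤+ 1≤k) (*-mono {1ℤ} {N} {1ℤ} {N} 0≤+ 0≤+ (+≤+ 1≤n) (+≤+ 1≤n))
        regroup : ∀ k N x → k * (N * N) * (k * x) ≡ (k * N) * (k * N) * x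
        regroup = solve-∀
        pull-q : ∀ ν q z → + 12 * (ν * ν * (q * q)) * z ≡ + 12 * (ν * ν * q) * (q * z)
        pull-q = solve-∀
        total : ∀ k N ν q M → + 12 * (ν * ν * q) * (k * (M * (N * N))) + + 12 * (N * N * (ν * ν)) * (M * (k * q)) + + 112 * (N * N) * (M * (k * q))
          ≡ k * (N * N) * (M * (q * (+ 24 * (ν * ν) + + 112)))
        total = solve-∀
        EZ² : + q * E (λ S κ → Z S κ * Z S κ) ≤ + k * (M * (N * N))
        EZ² = ≤-trans (≤-reflexive (cong (+ q *_) (E-cong (λ S κ → cong (λ z → z * z) (∑-cong I (λ i → sym (*-identityˡ (ξ κ i S))))))))
          (E-variance (λ _ _ → 1ℤ) (N * N) (λ _ _ _ _ _ → refl) (λ S κ → ≤-trans (≤-reflexive (*-identityˡ (+ W S κ * (N - + W S κ))))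
            (*-mono {+ W S κ} {N} 0≤+ 0≤+ (W≤N S κ) (≤-by {N - + W S κ} {N} (+ W S κ) 0≤+ (diff N (+ W S κ))))))
          where
            diff : ∀ N w → N ≡ N - w + w
            diff = solve-∀
        Edev² : ∀ (P : Vec (Fin n) k → Fin k → Bool) → E (λ S κ → deviation (P S) κ * deviation (P S) κ) ≤ M * (+ k * + q)
        Edev² P = ≤-trans (∑-mono Ss (λ S → deviation² (P S))) (≤-reflexive (trans (∑-Ss-1 _) (commute (+ (n ℕ.^ k)) (+ k) (+ (q ℕ.^ k)) (+ q))))
          where
            commute : ∀ a k b q → a * (k * (b * q)) ≡ a * b * (k * q)
            commute = solve-∀
        iso+y≤b : ∀ S κ → Ev S κ ≡ true → isoB (P S) κ + Y S κ ≤ + b κ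
        iso+y≤b S κ ev = ≤-trans (≤-reflexive (sym (∑-+ I _ _))) (≤-trans (∑-mono I le) (≤-reflexive (sym (count-∑ (inB κ)))))
          where
            le : ∀ i → ⟦ P S i ⟧ * ⟦ inB κ i ⟧ + y S κ i ≤ ⟦ inB κ i ⟧
            le i with P S i in p | inB κ i in ib | touch S κ (lookup S i) in t
            ... | false | false | false = ≤-refl
            ... | false | false | true = ≤-refl
            ... | false | true | false = 0≤+
            ... | false | true | true = ≤-refl
            ... | true | false | false = ≤-refl
            ... | true | false | true = ≤-refl
            ... | true | true | false = ≤-refl
            ... | true | true | true with trans (sym t) (untouched S κ i ev p ib)
            ...   | ()
        nonneg : ∀ S κ → 0ℤ ≤ c₁ * (Z S κ * Z S κ) + c₂ * (Z′ S κ * Z′ S κ)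
        nonneg S κ = 0≤+⁺ (0≤* {c₁} (0≤* {+ 12} 0≤+ (0≤* (0≤sq (+ ν)) (0≤sq (+ q)))) (0≤sq (Z S κ)))
          (0≤* {c₂} (0≤* {+ 12} 0≤+ (0≤* (0≤sq N) (0≤sq (+ ν)))) (0≤sq (Z′ S κ)))
        pointwise : ∀ S κ → (+ k * N) * (+ k * N) * ⟦ Ev S κ ∧ not (cut S κ) ⟧ ≤
          c₁ * (Z S κ * Z S κ) + c₂ * (Z′ S κ * Z′ S κ) + c₃ * (Z″ κ * Z″ κ)
        pointwise S κ with Ev S κ in ev | cut S κ in ct
        ... | false | _ = ≤-trans (≤-reflexive (*-zeroʳ ((+ k * N) * (+ k * N)))) (0≤+⁺ (nonneg S κ) (0≤* {c₃} (0≤* {+ 112} 0≤+ (0≤sq N)) (0≤sq (Z″ κ))))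
        ... | true | true = ≤-trans (≤-reflexive (*-zeroʳ ((+ k * N) * (+ k * N)))) (0≤+⁺ (nonneg S κ) (0≤* {c₃} (0≤* {+ 112} 0≤+ (0≤sq N)) (0≤sq (Z″ κ))))
        ... | true | false with cut-false S κ ct
        ...   | inj₁ dense = ≤-trans (≤-reflexive (*-identityʳ ((+ k * N) * (+ k * N))))
                  (≤-trans (chebyshev-dense {N} {+ k} {+ ν} {+ q} {+ W S κ} {Y S κ} {+ b κ} {isoB (P S) κ} {+ count (P S)} 0≤+ 0≤+ 0≤+ 0≤+ (W≤N S κ) dense (iso+y≤b S κ ev) (many S κ ev))
                  (≤-reflexive (cong₂ _+_ (cong₂ _+_ (cong (λ z → c₁ * (z * z)) (sym (∑ξ S κ))) (cong (λ z → c₂ * (z * z)) (sym (deviation-value (P S) κ)))) (cong (λ z → c₃ * (z * z)) (sym (deviation-all κ))))))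
        ...   | inj₂ few = ≤-trans (≤-reflexive (*-identityʳ ((+ k * N) * (+ k * N))))
                  (≤-trans (chebyshev-few {N} {+ k} {+ q * + b κ} 0≤+ 0≤+ few)
                  (≤-by (c₁ * (Z S κ * Z S κ) + c₂ * (Z′ S κ * Z′ S κ)) (nonneg S κ)
                    (trans (cong (λ z → c₁ * (Z S κ * Z S κ) + c₂ * (Z′ S κ * Z′ S κ) + c₃ * (z * z)) (deviation-all κ)) (+-comm (c₁ * (Z S κ * Z S κ) + c₂ * (Z′ S κ * Z′ S κ)) (c₃ * ((+ q * + b κ - + k) * (+ q * + b κ - + k)))))))

  ≤ᵇℤ-true : ∀ a b → (a ℤ.≤ᵇ b) ≡ true → a ≤ b
  ≤ᵇℤ-true a b e = ≤ᵇ⇒≤ (subst IsTrue (sym e) tt)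

  ≤ᵇℤ-intro : ∀ a b → a ≤ b → (a ℤ.≤ᵇ b) ≡ true
  ≤ᵇℤ-intro a b a≤b with a ℤ.≤ᵇ b in eq
  ... | true = refl
  ... | false with subst IsTrue eq (≤⇒≤ᵇ a≤b)
  ... | ()

  ≤ᵇℤ-false : ∀ a b → (a ℤ.≤ᵇ b) ≡ false → b ≤ a
  ≤ᵇℤ-false a b e with ≤-total b a
  ... | inj₁ b≤a = b≤a
  ... | inj₂ a≤b with trans (sym e) (≤ᵇℤ-intro a b a≤b)
  ... | ()

  square-cancel : ∀ {a b} → 0ℤ ≤ b → a * a ≤ b * b → a ≤ b
  square-cancel {a} {b} 0≤b a²≤b² with ≤-total a b
  ... | inj₁ a≤b = a≤b
  ... | inj₂ b≤a with a ≟ b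
  ...   | yes refl = ≤-refl
  ...   | no a≢b = contradiction a²≤b² (<⇒≱ b²<a²)
    where
      b+1≤a : b + 1ℤ ≤ a
      b+1≤a = ≤-trans (≤-reflexive (+-comm b 1ℤ)) (i<j⇒suc[i]≤j (≤∧≢⇒< b≤a (a≢b ∘ sym)))
      expand : ∀ b → (b + 1ℤ) * (b + 1ℤ) ≡ 1ℤ + b * b + + 2 * b
      expand = solve-∀
      b²<a² : b * b ℤ.< a * a
      b²<a² = suc[i]≤j⇒i<j (≤-trans (≤-by (+ 2 * b) (0≤* {+ 2} 0≤+ 0≤b) (expand b)) (square-mono (0≤+⁺ 0≤b 0≤+) b+1≤a))

  count-0 : ∀ {n} (p : Fin n → Bool) → count p ≡ 0 → ∀ v → p v ≡ false
  count-0 {suc n} p e zero with p zero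
  ... | false = refl
  count-0 {suc n} p e (suc v) with p zero
  ... | false = count-0 (p ∘ suc) e v

  count-minus : ∀ {k} (i : Fin k) → + count (λ j → neq j i) + 1ℤ ≡ + k
  count-minus {k} i = begin
    + count (λ j → neq j i) + 1ℤ
      ≡⟨ cong₂ _+_ (count-∑ (λ j → neq j i)) (sym (trans (∑-single i (λ j → ⟦ not (neq j i) ⟧) off) on)) ⟩
    ∑ (allFin k) (λ j → ⟦ neq j i ⟧) + ∑ (allFin k) (λ j → ⟦ not (neq j i) ⟧)
      ≡⟨ ∑-+ (allFin k) _ _ ⟨
    ∑ (allFin k) (λ j → ⟦ neq j i ⟧ + ⟦ not (neq j i) ⟧)
      ≡⟨ ∑-cong (allFin k) (λ j → compl (neq j i)) ⟩
    ∑ (allFin k) (λ _ → 1ℤ)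
      ≡⟨ trans (∑-allFin-const k 1ℤ) (*-identityʳ (+ k)) ⟩
    + k ∎
    where
      open ≡-Reasoning
      off : ∀ j → j ≢ i → ⟦ not (neq j i) ⟧ ≡ 0ℤ
      off j j≢i = cong (λ b → ⟦ not b ⟧) (neq-true j≢i)
      on : ⟦ not (neq i i) ⟧ ≡ 1ℤ
      on = cong (λ b → ⟦ not b ⟧) (neq-refl i)
      compl : ∀ b → ⟦ b ⟧ + ⟦ not b ⟧ ≡ 1ℤ
      compl true = refl
      compl false = refl

  -- Weights C w of order √(kn/w), where h = ⌊√k⌋.
  record Weight (n k h : ℕ) : Set where
    field
      C       : ℕ → ℕ
      -- The four bounds serve, in this order, to cap the variance of X, to keep positive
      -- contributions large, to cap negative contributions, and to reverse the first bound up to a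
      -- factor 2 in the final AM-GM step.
      C²w≤kn  : ∀ w → w ℕ.≤ n → + C w * + C w * + w ≤ + k * + n
      h≤C     : ∀ w → w ℕ.≤ n → + h ≤ + C w
      Cw≤     : ∀ w → w ℕ.≤ n → + C w * + w ≤ + n * (+ h + 1ℤ)
      kn≤2C²w : ∀ w → 1 ℕ.≤ w → w ℕ.≤ n → + k * + n ≤ + 2 * (+ C w * + C w * + w)

  -- P and R are the two summands before `9k ≤ 10 ν² b` is applied. Their product contains C² W,
  -- from which W disappears at the cost of a factor 2, so AM-GM bounds P + R below uniformly in W.
  -- Since Ym ≤ λ², the square root of Ym is at least Ym/λ.
  amgm : ∀ {k N ν λ' C W b Ym Y} → 0ℤ ≤ k → 0ℤ ≤ N → 1ℤ ≤ ν → 0ℤ ≤ λ' → 0ℤ ≤ C → 0ℤ ≤ W → 0ℤ ≤ Ym →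
    Ym ≤ λ' * λ' → Ym ≤ Y → k * N ≤ + 2 * (C * C * W) → + 9 * k ≤ + 10 * (ν * ν * b) →
    + 18 * (k * N) * Ym ≤ λ' * ν * (C * (+ 9 * (N * Y) + + 20 * (b * W)))
  amgm {k} {N} {ν} {l} {C} {W} {b} {Ym} {Y} 0≤k 0≤N 1≤ν 0≤l 0≤C 0≤W 0≤Ym Ym≤l² Ym≤Y kN≤ 9k≤ = *-cancelˡ ν 1≤ν (begin
    ν * (+ 18 * (k * N) * Ym)
      ≡⟨ regroup ν k N Ym ⟩
    + 9 * (+ 2 * (ν * (k * N * Ym)))
      ≤⟨ *-monoˡ (+ 9) 0≤+ (square-cancel (0≤+⁺ 0≤P 0≤R) squares) ⟩
    + 9 * (P + R)
      ≤⟨ ≤-by (+ 9 * (l * C * (ν * ν) * N * (Y - Ym)) + + 2 * (l * C * W) * (+ 10 * (ν * ν * b) - + 9 * k))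
          (0≤+⁺ (0≤* {+ 9} 0≤+ (0≤* (0≤* (0≤* (0≤* 0≤l 0≤C) (0≤sq ν)) 0≤N) (0≤-diff Ym≤Y)))
            (0≤* (0≤* {+ 2} 0≤+ (0≤* (0≤* 0≤l 0≤C) 0≤W)) (0≤-diff 9k≤)))
          (final k N ν l C W b Ym Y) ⟩
    ν * (l * ν * (C * (+ 9 * (N * Y) + + 20 * (b * W)))) ∎)
    where
      open ≤-Reasoning
      P = l * C * (ν * ν) * N * Ym
      R = l * C * (+ 2 * (k * W))
      0≤P : 0ℤ ≤ P
      0≤P = 0≤* (0≤* (0≤* (0≤* 0≤l 0≤C) (0≤sq ν)) 0≤N) 0≤Ym
      0≤R : 0ℤ ≤ R
      0≤R = 0≤* (0≤* 0≤l 0≤C) (0≤* {+ 2} 0≤+ (0≤* 0≤k 0≤W))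
      regroup : ∀ ν k N y → ν * (+ 18 * (k * N) * y) ≡ + 9 * (+ 2 * (ν * (k * N * y)))
      regroup = solve-∀
      final : ∀ k N ν l C W b Ym Y → ν * (l * ν * (C * (+ 9 * (N * Y) + + 20 * (b * W)))) ≡
        + 9 * (l * C * (ν * ν) * N * Ym + l * C * (+ 2 * (k * W))) +
        (+ 9 * (l * C * (ν * ν) * N * (Y - Ym)) + + 2 * (l * C * W) * (+ 10 * (ν * ν * b) - + 9 * k))
      final = solve-∀
      product : ∀ k N ν l C W y → + 4 * ((l * l * (ν * ν * (k * N) * y)) * (+ 2 * (C * C * W))) ≡
        + 4 * ((l * C * (ν * ν) * N * y) * (l * C * (+ 2 * (k * W))))
      product = solve-∀
      squared : ∀ k N ν y → + 2 * (ν * (k * N * y)) * (+ 2 * (ν * (k * N * y))) ≡ + 4 * ((y * (ν * ν * (k * N) * y)) * (k * N))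
      squared = solve-∀
      am-gm : ∀ p r → (p + r) * (p + r) ≡ + 4 * (p * r) + (p - r) * (p - r)
      am-gm = solve-∀
      0≤T : 0ℤ ≤ ν * ν * (k * N) * Ym
      0≤T = 0≤* (0≤* (0≤sq ν) (0≤* 0≤k 0≤N)) 0≤Ym
      squares : + 2 * (ν * (k * N * Ym)) * (+ 2 * (ν * (k * N * Ym))) ≤ (P + R) * (P + R)
      squares = begin
        + 2 * (ν * (k * N * Ym)) * (+ 2 * (ν * (k * N * Ym)))
          ≡⟨ squared k N ν Ym ⟩
        + 4 * ((Ym * (ν * ν * (k * N) * Ym)) * (k * N))
          ≤⟨ *-monoˡ (+ 4) 0≤+ (*-mono (0≤* 0≤Ym 0≤T) (≤-trans (0≤* 0≤k 0≤N) kN≤) (*-mono 0≤Ym 0≤T Ym≤l² ≤-refl) kN≤) ⟩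
        + 4 * ((l * l * (ν * ν * (k * N) * Ym)) * (+ 2 * (C * C * W)))
          ≡⟨ product k N ν l C W Ym ⟩
        + 4 * (P * R)
          ≤⟨ ≤-by ((P - R) * (P - R)) (0≤sq (P - R)) (am-gm P R) ⟩
        (P + R) * (P + R) ∎

  -- Anticoncentration of the number of edges

  zero-or-positive : ∀ n → n ≡ 0 ⊎ 1 ℕ.≤ n
  zero-or-positive zero = inj₁ refl
  zero-or-positive (suc n) = inj₂ (ℕ.s≤s ℕ.z≤n)

  -- L is twice the number ℓ of edges, and X is the weighted deviation of Y from its conditional mean.
  module Anticoncentration {n : ℕ} (1≤n : 1 ℕ.≤ n) (g : Fin n → Fin n → Bool) (g-sym : ∀ u v → g u v ≡ g v u)
    (k : ℕ) (1≤k : 1 ℕ.≤ k) (ν : ℕ) (1≤ν : 1 ℕ.≤ ν) {h : ℕ} (weight : Weight n k h)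
    (L : ℕ) (few : + 3 * + k + + 2 * + ν * (1ℤ + + L) ≤ + 2 * + ν * + k) where

    q : ℕ
    q = ν ℕ.* ν

    q≡ν² : + q ≡ + ν * + ν
    q≡ν² = pos-* ν ν

    1≤q : 1 ℕ.≤ q
    1≤q = ℕP.*-mono-≤ 1≤ν 1≤ν

    open Bounds 1≤n g k 1≤k ν 1≤q
    open IndexGraph g g-sym k
    open Weight weight

    nᵏ qᵏ : ℤ
    nᵏ = + (n ℕ.^ k)
    qᵏ = + (q ℕ.^ k)

    -- The indicator of `cut` belongs to the weight because N - W has no useful lower bound
    -- elsewhere. Both factors depend on A and the colours only, so the weighted ξ remain centred.
    K : Vec (Fin n) k → Vec (Fin q) k → ℤ
    K S κ = ⟦ cut S κ ⟧ * + C (W S κ)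

    0≤K : ∀ S κ → 0ℤ ≤ K S κ
    0≤K S κ = 0≤* (0≤⟦⟧ (cut S κ)) (0≤+ {C (W S κ)})

    K-update : ∀ κ i → inB κ i ≡ true → ∀ S v → K (S [ i ]≔ v) κ ≡ K S κ
    K-update κ i i∈B S v = cong₂ (λ c w → ⟦ c ⟧ * + C w) (cut-update S κ i v i∈B) (W-update S κ i v i∈B)

    W≤n : ∀ S κ → W S κ ℕ.≤ n
    W≤n S κ = count≤ (touch S κ)

    X : Vec (Fin n) k → Vec (Fin q) k → ℤ
    X S κ = ∑ I (λ i → K S κ * ξ κ i S)

    X-value : ∀ S κ → X S κ ≡ K S κ * (N * Y S κ - + b κ * + W S κ)
    X-value S κ = trans (∑-*ˡ I (K S κ) _) (cong (K S κ *_) (∑ξ S κ))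

    E-weighted-ξ : ∀ i (r : Vec (Fin n) k → ℤ) → (∀ S v → r (S [ i ]≔ v) ≡ r S) → E (λ S κ → r S * (K S κ * ξ κ i S)) ≡ 0ℤ
    E-weighted-ξ i r inv = trans (∑-swap Ss κs _) (trans (∑-cong κs (λ κ → trans
      (∑-cong Ss (λ S → assoc (r S) (K S κ) (ξ κ i S)))
      (ξ-mean κ i (λ S → r S * K S κ) (λ i∈B S v → cong₂ _*_ (inv S v) (K-update κ i i∈B S v))))) (∑-0 κs))
      where
        assoc : ∀ a b c → a * (b * c) ≡ a * b * c
        assoc = solve-∀

    EX : E X ≡ 0ℤ
    EX = trans (E-∑ (λ i S κ → K S κ * ξ κ i S)) (trans (∑-cong I (λ i → trans
      (E-cong (λ S κ → sym (*-identityˡ (K S κ * ξ κ i S)))) (E-weighted-ξ i (λ _ → 1ℤ) (λ _ _ → refl)))) (∑-0 I))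

    -- With q = ν² this says that the standard deviation of X is at most kN/ν.
    EX² : + q * E (λ S κ → X S κ * X S κ) ≤ + k * (M * (+ k * N * N))
    EX² = E-variance K (+ k * N * N) K-update bound
      where
        rearrange : ∀ c w r → c * c * (w * r) ≡ c * c * w * r
        rearrange = solve-∀
        diff : ∀ N w → N ≡ N - w + w
        diff = solve-∀
        bound : ∀ S κ → K S κ * K S κ * (+ W S κ * (N - + W S κ)) ≤ + k * N * N
        bound S κ with cut S κ
        ... | false = 0≤* {+ k * N} {N} (0≤* {+ k} {N} 0≤+ 0≤+) 0≤+
        ... | true = begin
          1ℤ * c * (1ℤ * c) * (w * (N - w))
            ≡⟨ cong (λ z → z * z * (w * (N - w))) (*-identityˡ c) ⟩
          c * c * (w * (N - w))
            ≡⟨ rearrange c w (N - w) ⟩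
          c * c * w * (N - w)
            ≤⟨ *-mono {c * c * w} (0≤* (0≤sq c) (0≤+ {W S κ})) (0≤+ {n}) (C²w≤kn (W S κ) (W≤n S κ)) (≤-by {N - w} w 0≤+ (diff N w)) ⟩
          + k * N * N ∎
          where
            open ≤-Reasoning
            c = + C (W S κ)
            w = + W S κ

    1≤kN : 1ℤ ≤ + k * N
    1≤kN = *-mono {1ℤ} {+ k} {1ℤ} {N} 0≤+ 0≤+ (+≤+ 1≤k) (+≤+ 1≤n)

    -- As X has mean 0, its correlation with an event is at most half of E|X|, hence at most half
    -- the standard deviation. Subtracting a multiple of `E X` replaces the indicator by a sign,
    -- after which AM-GM applies pointwise. Both signs s are needed later.
    deviation-bound : (σ : Vec (Fin n) k → Bool) (s : ℤ) → s * s ≡ 1ℤ → + 2 * + ν * E (λ S κ → ⟦ σ S ⟧ * (s * X S κ)) ≤ M * (+ k * N)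
    deviation-bound σ s s²≡1 = *-cancelˡ (+ 2 * (+ k * N)) (*-mono {1ℤ} {+ 2} {1ℤ} {+ k * N} 0≤+ (≤-trans 0≤+ 1≤kN) (+≤+ (ℕ.s≤s ℕ.z≤n)) 1≤kN) (begin
      + 2 * (+ k * N) * (+ 2 * + ν * E (λ S κ → ⟦ σ S ⟧ * (s * X S κ)))
        ≡⟨ doubled (+ k * N) (+ ν) (E (λ S κ → ⟦ σ S ⟧ * (s * X S κ))) ⟩
      + 4 * (+ ν * (+ k * N)) * E (λ S κ → ⟦ σ S ⟧ * (s * X S κ)) + 0ℤ
        ≡⟨ cong₂ _+_ (sym (E-*ˡ (+ 4 * (+ ν * (+ k * N))) _)) (sym (trans (E-*ˡ (- (+ 2 * (+ ν * (+ k * N)) * s)) X) (trans (cong (- (+ 2 * (+ ν * (+ k * N)) * s) *_) EX) (*-zeroʳ (- (+ 2 * (+ ν * (+ k * N)) * s)))))) ⟩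
      E (λ S κ → + 4 * (+ ν * (+ k * N)) * (⟦ σ S ⟧ * (s * X S κ))) + E (λ S κ → - (+ 2 * (+ ν * (+ k * N)) * s) * X S κ)
        ≡⟨ E-+ _ _ ⟨
      E (λ S κ → + 4 * (+ ν * (+ k * N)) * (⟦ σ S ⟧ * (s * X S κ)) + - (+ 2 * (+ ν * (+ k * N)) * s) * X S κ)
        ≤⟨ E-mono (λ S κ → pointwise (σ S) (X S κ)) ⟩
      E (λ S κ → + ν * + ν * (X S κ * X S κ) + (+ k * N) * (+ k * N))
        ≡⟨ trans (E-+ _ _) (cong₂ _+_ (E-*ˡ (+ ν * + ν) _) (E-const _)) ⟩
      + ν * + ν * E (λ S κ → X S κ * X S κ) + M * ((+ k * N) * (+ k * N))
        ≡⟨ cong (λ z → z * E (λ S κ → X S κ * X S κ) + M * ((+ k * N) * (+ k * N))) (sym q≡ν²) ⟩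
      + q * E (λ S κ → X S κ * X S κ) + M * ((+ k * N) * (+ k * N))
        ≤⟨ +-mono-≤ EX² ≤-refl ⟩
      + k * (M * (+ k * N * N)) + M * ((+ k * N) * (+ k * N))
        ≡⟨ total (+ k) M N ⟩
      + 2 * (+ k * N) * (M * (+ k * N)) ∎)
      where
        open ≤-Reasoning
        doubled : ∀ a ν e → + 2 * a * (+ 2 * ν * e) ≡ + 4 * (ν * a) * e + 0ℤ
        doubled = solve-∀
        total : ∀ k M N → k * (M * (k * N * N)) + M * ((k * N) * (k * N)) ≡ + 2 * (k * N) * (M * (k * N))
        total = solve-∀
        case₁ : ∀ ν a s x → ν * ν * (x * x) + a * a * (s * s) ≡ + 4 * (ν * a) * (1ℤ * (s * x)) + - (+ 2 * (ν * a) * s) * x + (ν * x - a * s) * (ν * x - a * s)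
        case₁ = solve-∀
        case₀ : ∀ ν a s x → ν * ν * (x * x) + a * a * (s * s) ≡ + 4 * (ν * a) * (0ℤ * (s * x)) + - (+ 2 * (ν * a) * s) * x + (ν * x + a * s) * (ν * x + a * s)
        case₀ = solve-∀
        unit : ∀ a → a * a ≡ a * a * (s * s)
        unit a = sym (trans (cong (a * a *_) s²≡1) (*-identityʳ (a * a)))
        pointwise : ∀ c x → + 4 * (+ ν * (+ k * N)) * (⟦ c ⟧ * (s * x)) + - (+ 2 * (+ ν * (+ k * N)) * s) * x ≤ + ν * + ν * (x * x) + (+ k * N) * (+ k * N)
        pointwise true x = ≤-by _ (0≤sq (+ ν * x - + k * N * s)) (trans (cong (λ z → + ν * + ν * (x * x) + z) (unit (+ k * N))) (case₁ (+ ν) (+ k * N) s x))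
        pointwise false x = ≤-by _ (0≤sq (+ ν * x + + k * N * s)) (trans (cong (λ z → + ν * + ν * (x * x) + z) (unit (+ k * N))) (case₀ (+ ν) (+ k * N) s x))

    -- Pivotal indices

    f : Vec (Fin n) k → Bool
    f S = + L ℤ.≤ᵇ D full S

    low : Fin k → Vec (Fin n) k → Bool
    low i S = not (+ L ℤ.≤ᵇ D (minus i) S)

    piv : Fin k → Vec (Fin n) k → Bool
    piv i S = f S ∧ low i S

    gd : Vec (Fin n) k → Bool
    gd S = f S ∧ (D full S ℤ.≤ᵇ + L)

    low-D : ∀ i S → low i S ≡ true → D (minus i) S ≤ + L
    low-D i S e with + L ℤ.≤ᵇ D (minus i) S in eq
    low-D i S () | true
    ... | false = ≤ᵇℤ-false _ _ eq

    -- If at least L remains after deleting i, then L was reached before. The last summand does not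
    -- see the i-th vertex, so it is uncorrelated with ξ at i and only the pivotal part survives.
    f-split : ∀ i S → ⟦ f S ⟧ ≡ ⟦ piv i S ⟧ + ⟦ not (low i S) ⟧
    f-split i S with + L ℤ.≤ᵇ D (minus i) S in eq
    ... | false = trans (cong ⟦_⟧ (sym (true-∧ (f S)))) (sym (+-identityʳ _))
      where
        true-∧ : ∀ b → b ∧ true ≡ b
        true-∧ true = refl
        true-∧ false = refl
    ... | true rewrite ≤ᵇℤ-intro (+ L) (D full S) (≤-trans (≤ᵇℤ-true _ _ eq) (D-minus≤D i S)) = refl

    -- Deleting an isolated index would leave `D` unchanged.
    piv-nbr : ∀ i S → piv i S ≡ true → ∃[ j ] nbr S i j ≡ true
    piv-nbr i S e with anyF (nbr S i) in eq
    ... | true = anyF-elim (nbr S i) eq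
    ... | false = contradiction (trans (sym lowD) (cong (λ d → not (+ L ℤ.≤ᵇ d)) (sym same))) λ e′ → clash (trans e′ (cong not fD))
      where
        same : D full S ≡ D (minus i) S
        same = isolated-D i S (anyF-none (nbr S i) eq)
        fD : f S ≡ true
        fD = proj₁ (∧-true e)
        lowD : low i S ≡ true
        lowD = proj₂ (∧-true {f S} e)
        clash : true ≢ false
        clash ()

    touched : ∀ S κ {i j} → nbr S i j ≡ true → inB κ j ≡ false → touch S κ (lookup S i) ≡ true
    touched S κ {i} {j} e jA = anyF-intro _ j (∧-intro (cong not jA) (proj₂ (∧-true {neq i j} e)))

    touch-nbr : ∀ S κ i → inB κ i ≡ true → touch S κ (lookup S i) ≡ true → ∃[ j ] (inB κ j ≡ false × nbr S i j ≡ true)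
    touch-nbr S κ i i∈B t with anyF-elim _ t
    ... | j , e = j , jA , ∧-intro (neq-true i≢j) (proj₂ (∧-true {not (inB κ j)} e))
      where
        flip : ∀ {c} → not c ≡ true → c ≡ false
        flip {false} _ = refl
        jA : inB κ j ≡ false
        jA = flip (proj₁ (∧-true {not (inB κ j)} e))
        i≢j : i ≢ j
        i≢j refl with trans (sym i∈B) jA
        ... | ()

    z : Vec (Fin n) k → Vec (Fin q) k → Fin k → ℤ
    z S κ i = ⟦ inB κ i ⟧ * ⟦ not (touch S κ (lookup S i)) ⟧

    0≤z : ∀ S κ i → 0ℤ ≤ z S κ i
    0≤z S κ i = 0≤* (0≤⟦⟧ (inB κ i)) (0≤⟦⟧ (not (touch S κ (lookup S i))))

    nbr-≢ : ∀ S {i j} → nbr S i j ≡ true → j ≢ i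
    nbr-≢ S {i} {j} e = neq⇒≢ (proj₁ (∧-true e)) ∘ sym

    -- If the neighbour j were in A, then i would be touched. Hence i and j are both in B, which has
    -- probability 1/q².
    ∑-z : ∀ S {i j} → nbr S i j ≡ true → + q * + q * ∑ κs (λ κ → z S κ i) ≤ qᵏ
    ∑-z S {i} {j} e = ≤-trans (*-monoˡ (+ q * + q) (0≤sq (+ q)) (∑-mono κs le)) (≤-reflexive (∑-inB-inB (nbr-≢ S e)))
      where
        le : ∀ κ → z S κ i ≤ ⟦ inB κ i ⟧ * ⟦ inB κ j ⟧
        le κ = *-monoˡ ⟦ inB κ i ⟧ (0≤⟦⟧ (inB κ i)) le′
          where
            le′ : ⟦ not (touch S κ (lookup S i)) ⟧ ≤ ⟦ inB κ j ⟧
            le′ with inB κ j in jB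
            ... | true = ⟦⟧≤1 _
            ... | false rewrite touched S κ e jB = ≤-refl

    -- It is enough that i is in B and its neighbour j is not, which has probability 1/q - 1/q².
    ∑-y : ∀ S {i j} → nbr S i j ≡ true → (+ q - 1ℤ) * qᵏ ≤ + q * + q * ∑ κs (λ κ → y S κ i)
    ∑-y S {i} {j} e = begin
      (+ q - 1ℤ) * qᵏ
        ≡⟨ expand (+ q) qᵏ ⟩
      + q * qᵏ + - qᵏ
        ≡⟨ cong₂ (λ a c → + q * a + - c) (∑-inB i) (∑-inB-inB (nbr-≢ S e)) ⟨
      + q * (+ q * ∑ κs (λ κ → ⟦ inB κ i ⟧)) + - (+ q * + q * ∑ κs (λ κ → ⟦ inB κ i ⟧ * ⟦ inB κ j ⟧))
        ≡⟨ collect (+ q) (∑ κs (λ κ → ⟦ inB κ i ⟧)) (∑ κs (λ κ → ⟦ inB κ i ⟧ * ⟦ inB κ j ⟧)) ⟩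
      + q * + q * (∑ κs (λ κ → ⟦ inB κ i ⟧) + - 1ℤ * ∑ κs (λ κ → ⟦ inB κ i ⟧ * ⟦ inB κ j ⟧))
        ≡⟨ cong (+ q * + q *_) (trans (∑-+ κs _ _) (cong (λ w → ∑ κs (λ κ → ⟦ inB κ i ⟧) + w) (∑-*ˡ κs (- 1ℤ) _))) ⟨
      + q * + q * ∑ κs (λ κ → ⟦ inB κ i ⟧ + - 1ℤ * (⟦ inB κ i ⟧ * ⟦ inB κ j ⟧))
        ≤⟨ *-monoˡ (+ q * + q) (0≤sq (+ q)) (∑-mono κs le) ⟩
      + q * + q * ∑ κs (λ κ → y S κ i) ∎
      where
        open ≤-Reasoning
        expand : ∀ q x → (q - 1ℤ) * x ≡ q * x + - x
        expand = solve-∀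
        collect : ∀ q a c → q * (q * a) + - (q * q * c) ≡ q * q * (a + - 1ℤ * c)
        collect = solve-∀
        le : ∀ κ → ⟦ inB κ i ⟧ + - 1ℤ * (⟦ inB κ i ⟧ * ⟦ inB κ j ⟧) ≤ y S κ i
        le κ with inB κ i | inB κ j in jB
        ... | false | _ = ≤-refl
        ... | true | true = ≤-trans 0≤+ (0≤* {1ℤ} 0≤+ (0≤⟦⟧ (touch S κ (lookup S i))))
        ... | true | false rewrite touched S κ e jB = ≤-refl

    -- Of the at least k - 1 selected indices at most L fail to be isolated; the 1 allows for a
    -- deleted index. The hypothesis `few` says that k - 1 - L is at least 3k/(2ν).
    many-isolated : ∀ m S → + k ≤ + count m + 1ℤ → D m S ≤ + L → + 3 * + k ≤ + 2 * + ν * + count (isolated m S)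
    many-isolated m S k≤ D≤L = ≤-by _ (0≤+⁺ (0≤* {+ 2 * + ν} (0≤* {+ 2} {+ ν} 0≤+ 0≤+) (0≤+⁺ (0≤+⁺ (0≤-diff (count≤isolated+D m S)) (0≤-diff D≤L)) (0≤-diff k≤))) (0≤-diff few))
      (rearrange (+ k) (+ ν) (+ L) (+ count m) (+ count (isolated m S)) (D m S))
      where
        rearrange : ∀ k ν L c i d → + 2 * ν * i ≡ + 3 * k + (+ 2 * ν * ((i + d) - c + (L - d) + ((c + 1ℤ) - k)) + (+ 2 * ν * k - (+ 3 * k + + 2 * ν * (1ℤ + L))))
        rearrange = solve-∀

    isolated-untouched : ∀ m S κ a → (∀ j → inB κ j ≡ false → m j ≡ true) → isolated m S a ≡ true → inB κ a ≡ true → touch S κ (lookup S a) ≡ false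
    isolated-untouched m S κ a A⊆m iso a∈B with touch S κ (lookup S a) in t
    ... | false = refl
    ... | true with touch-nbr S κ a a∈B t
    ...   | j , jA , e with trans (sym (proj₂ (∧-true {m a} iso))) (cong not (anyF-intro (λ j → m j ∧ nbr S a j) j (∧-intro (A⊆m j jA) e)))
    ...     | ()

    -- The event includes that i is in B: then A avoids i, and an index that is isolated after
    -- deletion of i has no neighbour in A.
    rare-low : ∀ i → + k * E (λ S κ → ⟦ (inB κ i ∧ low i S) ∧ not (cut S κ) ⟧) ≤ M * τ
    rare-low i = ¬cut-rare (λ S κ → inB κ i ∧ low i S) (λ S → isolated (minus i) S)
      (λ S κ e → many-isolated (minus i) S (≤-reflexive (sym (count-minus i))) (low-D i S (proj₂ (∧-true {inB κ i} e))))
      (λ S κ a e iso a∈B → isolated-untouched (minus i) S κ a (A⊆ κ (proj₁ (∧-true e))) iso a∈B)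
      where
        A⊆ : ∀ κ → inB κ i ≡ true → ∀ j → inB κ j ≡ false → minus i j ≡ true
        A⊆ κ i∈B j jA = neq-true {i = j} {i} λ { refl → clash (trans (sym i∈B) jA) }
          where
            clash : true ≢ false
            clash ()

    rare-gd : + k * E (λ S κ → ⟦ gd S ∧ not (cut S κ) ⟧) ≤ M * τ
    rare-gd = ¬cut-rare (λ S κ → gd S) (λ S → isolated full S)
      (λ S κ e → many-isolated full S (≤-by 1ℤ 0≤+ (cong (_+ 1ℤ) all-k)) (≤ᵇℤ-true _ _ (proj₂ (∧-true {f S} e))))
      (λ S κ a e iso a∈B → isolated-untouched full S κ a (λ _ _ → refl) iso a∈B)
      where
        all-k : + count full ≡ + k
        all-k = trans (count-∑ full) (trans (∑-allFin-const k 1ℤ) (*-identityʳ (+ k)))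

    -- Positive and negative contributions to the correlation

    w̄ : Vec (Fin n) k → Vec (Fin q) k → ℤ
    w̄ S κ = N - + W S κ

    Pos Neg : Fin k → ℤ
    Pos i = E (λ S κ → ⟦ piv i S ⟧ * (K S κ * (y S κ i * w̄ S κ)))
    Neg i = E (λ S κ → ⟦ piv i S ⟧ * (K S κ * (z S κ i * + W S κ)))

    Π : Fin k → ℤ
    Π i = ∑ Ss (λ S → ⟦ piv i S ⟧)

    T : Fin k → ℤ
    T i = E (λ S κ → ⟦ (inB κ i ∧ low i S) ∧ not (cut S κ) ⟧)

    ξ-split : ∀ S κ i → ξ κ i S ≡ y S κ i * w̄ S κ + - (z S κ i * + W S κ)
    ξ-split S κ i with touch S κ (lookup S i)
    ... | true = one ⟦ inB κ i ⟧ N (+ W S κ)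
      where
        one : ∀ a N w → a * (N * 1ℤ + - w) ≡ a * 1ℤ * (N - w) + - (a * 0ℤ * w)
        one = solve-∀
    ... | false = nought ⟦ inB κ i ⟧ N (+ W S κ)
      where
        nought : ∀ a N w → a * (N * 0ℤ + - w) ≡ a * 0ℤ * (N - w) + - (a * 1ℤ * w)
        nought = solve-∀

    E-fX : E (λ S κ → ⟦ f S ⟧ * (1ℤ * X S κ)) ≡ ∑ I (λ i → Pos i + - 1ℤ * Neg i)
    E-fX = begin
      E (λ S κ → ⟦ f S ⟧ * (1ℤ * X S κ))
        ≡⟨ E-cong (λ S κ → trans (cong (⟦ f S ⟧ *_) (*-identityˡ (X S κ))) (sym (∑-*ˡ I ⟦ f S ⟧ _))) ⟩
      E (λ S κ → ∑ I (λ i → ⟦ f S ⟧ * (K S κ * ξ κ i S)))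
        ≡⟨ E-∑ (λ i S κ → ⟦ f S ⟧ * (K S κ * ξ κ i S)) ⟩
      ∑ I (λ i → E (λ S κ → ⟦ f S ⟧ * (K S κ * ξ κ i S)))
        ≡⟨ ∑-cong I each ⟩
      ∑ I (λ i → Pos i + - 1ℤ * Neg i) ∎
      where
        open ≡-Reasoning
        distrib : ∀ a c x → (a + c) * x ≡ a * x + c * x
        distrib = solve-∀
        spread : ∀ p K a c → p * (K * (a + - c)) ≡ p * (K * a) + - 1ℤ * (p * (K * c))
        spread = solve-∀
        low-update : ∀ i S v → ⟦ not (low i (S [ i ]≔ v)) ⟧ ≡ ⟦ not (low i S) ⟧
        low-update i S v = cong (λ d → ⟦ not (not (+ L ℤ.≤ᵇ d)) ⟧) (D-minus-update i S v)
        each : ∀ i → E (λ S κ → ⟦ f S ⟧ * (K S κ * ξ κ i S)) ≡ Pos i + - 1ℤ * Neg i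
        each i = begin
          E (λ S κ → ⟦ f S ⟧ * (K S κ * ξ κ i S))
            ≡⟨ E-cong (λ S κ → trans (cong (_* (K S κ * ξ κ i S)) (f-split i S)) (distrib ⟦ piv i S ⟧ ⟦ not (low i S) ⟧ (K S κ * ξ κ i S))) ⟩
          E (λ S κ → ⟦ piv i S ⟧ * (K S κ * ξ κ i S) + ⟦ not (low i S) ⟧ * (K S κ * ξ κ i S))
            ≡⟨ trans (E-+ _ _) (trans (cong (λ e → E (λ S κ → ⟦ piv i S ⟧ * (K S κ * ξ κ i S)) + e) (E-weighted-ξ i (λ S → ⟦ not (low i S) ⟧) (low-update i))) (+-identityʳ _)) ⟩
          E (λ S κ → ⟦ piv i S ⟧ * (K S κ * ξ κ i S))
            ≡⟨ E-cong (λ S κ → trans (cong (λ x → ⟦ piv i S ⟧ * (K S κ * x)) (ξ-split S κ i)) (spread ⟦ piv i S ⟧ (K S κ) (y S κ i * w̄ S κ) (z S κ i * + W S κ))) ⟩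
          E (λ S κ → ⟦ piv i S ⟧ * (K S κ * (y S κ i * w̄ S κ)) + - 1ℤ * (⟦ piv i S ⟧ * (K S κ * (z S κ i * + W S κ))))
            ≡⟨ trans (E-+ _ _) (cong (λ e → Pos i + e) (E-*ˡ (- 1ℤ) _)) ⟩
          Pos i + - 1ℤ * Neg i ∎

    K*W≤ : ∀ S κ → K S κ * + W S κ ≤ N * (+ h + 1ℤ)
    K*W≤ S κ with cut S κ
    ... | false = 0≤* {N} {+ h + 1ℤ} 0≤+ 0≤+
    ... | true = ≤-trans (≤-reflexive (cong (_* + W S κ) (*-identityˡ (+ C (W S κ))))) (Cw≤ (W S κ) (W≤n S κ))

    -- The factor K W is at most N(h + 1), and a pivotal index is in B and untouched with
    -- probability at most 1/q².
    Neg-bound : ∀ i → + q * + q * Neg i ≤ N * (+ h + 1ℤ) * qᵏ * Π i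
    Neg-bound i = begin
      + q * + q * Neg i
        ≤⟨ *-monoˡ (+ q * + q) (0≤sq (+ q)) (E-mono pointwise) ⟩
      + q * + q * E (λ S κ → c * (⟦ piv i S ⟧ * z S κ i))
        ≡⟨ cong (+ q * + q *_) (E-*ˡ c _) ⟩
      + q * + q * (c * E (λ S κ → ⟦ piv i S ⟧ * z S κ i))
        ≡⟨ swap (+ q) c (E (λ S κ → ⟦ piv i S ⟧ * z S κ i)) ⟩
      c * (+ q * + q * E (λ S κ → ⟦ piv i S ⟧ * z S κ i))
        ≡⟨ cong (c *_) (∑-*ˡ Ss (+ q * + q) _) ⟨
      c * ∑ Ss (λ S → + q * + q * ∑ κs (λ κ → ⟦ piv i S ⟧ * z S κ i))
        ≤⟨ *-monoˡ c (0≤* {N} {+ h + 1ℤ} 0≤+ 0≤+) (∑-mono Ss per-S) ⟩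
      c * ∑ Ss (λ S → qᵏ * ⟦ piv i S ⟧)
        ≡⟨ trans (cong (c *_) (∑-*ˡ Ss qᵏ _)) (assoc c qᵏ (Π i)) ⟩
      c * qᵏ * Π i ∎
      where
        open ≤-Reasoning
        c = N * (+ h + 1ℤ)
        swap : ∀ q c x → q * q * (c * x) ≡ c * (q * q * x)
        swap = solve-∀
        assoc : ∀ a b c → a * (b * c) ≡ a * b * c
        assoc = solve-∀
        shuffle : ∀ p K z w → p * (K * (z * w)) ≡ p * z * (K * w)
        shuffle = solve-∀
        pointwise : ∀ S κ → ⟦ piv i S ⟧ * (K S κ * (z S κ i * + W S κ)) ≤ c * (⟦ piv i S ⟧ * z S κ i)
        pointwise S κ = ≤-trans (≤-reflexive (shuffle ⟦ piv i S ⟧ (K S κ) (z S κ i) (+ W S κ)))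
          (≤-trans (*-monoˡ (⟦ piv i S ⟧ * z S κ i) (0≤* (0≤⟦⟧ (piv i S)) (0≤z S κ i)) (K*W≤ S κ)) (≤-reflexive (*-comm (⟦ piv i S ⟧ * z S κ i) c)))
        per-S : ∀ S → + q * + q * ∑ κs (λ κ → ⟦ piv i S ⟧ * z S κ i) ≤ qᵏ * ⟦ piv i S ⟧
        per-S S with piv i S in e
        ... | false = ≤-reflexive (trans (cong (+ q * + q *_) (trans (∑-cong κs (λ κ → *-zeroˡ (z S κ i))) (∑-0 κs))) (trans (*-zeroʳ (+ q * + q)) (sym (*-zeroʳ qᵏ))))
        ... | true = ≤-trans (≤-reflexive (cong (+ q * + q *_) (∑-cong κs (λ κ → *-identityˡ (z S κ i)))))
          (≤-trans (∑-z S (proj₂ (piv-nbr i S e))) (≤-reflexive (sym (*-identityʳ qᵏ))))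

    -- On `cut`, K is at least h and N - W at least N/ν, and a pivotal index is in B and touched
    -- with probability at least (q - 1)/q². The outcomes outside `cut`, where K vanishes, are paid
    -- for by `T`.
    Pos-bound : ∀ i → + h * N * ((+ q - 1ℤ) * qᵏ) * Π i ≤ + q * + q * (+ ν * Pos i + + h * N * T i)
    Pos-bound i = begin
      + h * N * ((+ q - 1ℤ) * qᵏ) * Π i
        ≡⟨ trans (assoc (+ h * N) ((+ q - 1ℤ) * qᵏ) (Π i)) (cong (+ h * N *_) (sym (∑-*ˡ Ss ((+ q - 1ℤ) * qᵏ) _))) ⟩
      + h * N * ∑ Ss (λ S → (+ q - 1ℤ) * qᵏ * ⟦ piv i S ⟧)
        ≤⟨ *-monoˡ (+ h * N) (0≤* {+ h} {N} 0≤+ 0≤+) (∑-mono Ss per-S) ⟩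
      + h * N * ∑ Ss (λ S → + q * + q * ∑ κs (λ κ → ⟦ piv i S ⟧ * y S κ i))
        ≡⟨ trans (cong (+ h * N *_) (∑-*ˡ Ss (+ q * + q) _)) (swap (+ h * N) (+ q) _) ⟩
      + q * + q * (+ h * N * E (λ S κ → ⟦ piv i S ⟧ * y S κ i))
        ≡⟨ cong (+ q * + q *_) (E-*ˡ (+ h * N) _) ⟨
      + q * + q * E (λ S κ → + h * N * (⟦ piv i S ⟧ * y S κ i))
        ≤⟨ *-monoˡ (+ q * + q) (0≤sq (+ q)) (E-mono pointwise) ⟩
      + q * + q * E (λ S κ → + ν * (⟦ piv i S ⟧ * (K S κ * (y S κ i * w̄ S κ))) + + h * N * ⟦ (inB κ i ∧ low i S) ∧ not (cut S κ) ⟧)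
        ≡⟨ cong (+ q * + q *_) (trans (E-+ _ _) (cong₂ _+_ (E-*ˡ (+ ν) _) (E-*ˡ (+ h * N) _))) ⟩
      + q * + q * (+ ν * Pos i + + h * N * T i) ∎
      where
        open ≤-Reasoning
        swap : ∀ c q x → c * (q * q * x) ≡ q * q * (c * x)
        swap = solve-∀
        assoc : ∀ a b c → a * b * c ≡ a * (b * c)
        assoc = solve-∀
        0≤hN : 0ℤ ≤ + h * N
        0≤hN = 0≤* {+ h} {N} 0≤+ 0≤+
        per-S : ∀ S → (+ q - 1ℤ) * qᵏ * ⟦ piv i S ⟧ ≤ + q * + q * ∑ κs (λ κ → ⟦ piv i S ⟧ * y S κ i)
        per-S S with piv i S in e
        ... | false = ≤-reflexive (trans (*-zeroʳ ((+ q - 1ℤ) * qᵏ)) (sym (trans (cong (+ q * + q *_) (trans (∑-cong κs (λ κ → *-zeroˡ (y S κ i))) (∑-0 κs))) (*-zeroʳ (+ q * + q)))))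
        ... | true = ≤-trans (≤-reflexive (*-identityʳ ((+ q - 1ℤ) * qᵏ))) (≤-trans (∑-y S (proj₂ (piv-nbr i S e)))
          (≤-reflexive (cong (+ q * + q *_) (∑-cong κs (λ κ → sym (*-identityˡ (y S κ i)))))))
        on-cut : ∀ c y w → + h ≤ c → 0ℤ ≤ y → N ≤ + ν * w → + h * N * (1ℤ * y) ≤ + ν * (1ℤ * (1ℤ * c * (y * w))) + + h * N * 0ℤ
        on-cut c y w h≤c 0≤y N≤νw = ≤-trans (≤-reflexive (left (+ h) N y)) (≤-trans
          (*-monoˡ y 0≤y (*-mono {+ h} {c} 0≤+ (≤-trans 0≤+ N≤νw) h≤c N≤νw)) (≤-reflexive (right (+ ν) c y w (+ h * N))))
          where
            left : ∀ h N y → h * N * (1ℤ * y) ≡ y * (h * N)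
            left = solve-∀
            right : ∀ ν c y w a → y * (c * (ν * w)) ≡ ν * (1ℤ * (1ℤ * c * (y * w))) + a * 0ℤ
            right = solve-∀
        y≤ : ∀ S κ → y S κ i ≤ ⟦ inB κ i ⟧
        y≤ S κ = ≤-trans (*-monoˡ ⟦ inB κ i ⟧ (0≤⟦⟧ (inB κ i)) (⟦⟧≤1 (touch S κ (lookup S i)))) (≤-reflexive (*-identityʳ _))
        off-cut : ∀ S κ b → y S κ i ≤ ⟦ b ⟧ → + h * N * (1ℤ * y S κ i) ≤ + ν * (1ℤ * (0ℤ * + C (W S κ) * (y S κ i * w̄ S κ))) + + h * N * ⟦ b ⟧
        off-cut S κ b y≤b = ≤-trans (*-monoˡ (+ h * N) 0≤hN (≤-trans (≤-reflexive (*-identityˡ _)) y≤b))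
          (≤-reflexive (pad (+ ν) (+ C (W S κ)) (y S κ i * w̄ S κ) (+ h * N * ⟦ b ⟧)))
          where
            pad : ∀ ν c u x → x ≡ ν * (1ℤ * (0ℤ * c * u)) + x
            pad = solve-∀
        pointwise : ∀ S κ → + h * N * (⟦ piv i S ⟧ * y S κ i) ≤ + ν * (⟦ piv i S ⟧ * (K S κ * (y S κ i * w̄ S κ))) + + h * N * ⟦ (inB κ i ∧ low i S) ∧ not (cut S κ) ⟧
        pointwise S κ with piv i S in pv
        ... | false = ≤-by (+ h * N * ⟦ (inB κ i ∧ low i S) ∧ not (cut S κ) ⟧) (0≤* 0≤hN (0≤⟦⟧ ((inB κ i ∧ low i S) ∧ not (cut S κ))))
                (cong (_+ + h * N * ⟦ (inB κ i ∧ low i S) ∧ not (cut S κ) ⟧) (nil (+ ν) (K S κ * (y S κ i * w̄ S κ)) (+ h * N) (y S κ i)))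
          where
            nil : ∀ ν u a y → ν * (0ℤ * u) ≡ a * (0ℤ * y)
            nil = solve-∀
        ... | true with cut S κ in ct
        ...   | true rewrite ∧-zeroʳ (inB κ i ∧ low i S) = on-cut (+ C (W S κ)) (y S κ i) (w̄ S κ) (h≤C (W S κ) (W≤n S κ)) (0≤y S κ i) (proj₁ (cut-true S κ ct))
        ...   | false rewrite proj₂ (∧-true {f S} pv) = off-cut S κ ((inB κ i ∧ true) ∧ true) (≤-trans (y≤ S κ) (≤-reflexive (cong ⟦_⟧ (sym (simp (inB κ i))))))
          where
            simp : ∀ b → (b ∧ true) ∧ true ≡ b
            simp true = refl
            simp false = refl

    -- Each of the k events has probability at most τ/k, so all of them together cost a constant.
    ∑T≤ : ∑ I T ≤ M * τ
    ∑T≤ = *-cancelˡ (+ k) (+≤+ 1≤k) (≤-trans (≤-reflexive (sym (∑-*ˡ I (+ k) T))) (≤-trans (∑-mono I rare-low) (≤-reflexive (∑-allFin-const k (M * τ)))))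

    -- The hypothesis makes twice the negative total at most the positive total up to the error `T`.
    -- The correlation bounds the positive total minus the negative one, so it bounds half of the
    -- positive total.
    Pos-total : + 2 * + ν * (+ h + 1ℤ) ≤ + h * (+ q - 1ℤ) → + ν * ∑ I Pos ≤ M * N * (+ k + + h * τ)
    Pos-total hq = ≤-by _ (0≤+⁺ (0≤-diff fX) (0≤-diff neg)) (finish (+ ν) (∑ I Pos) (∑ I Neg) M (+ k) N (+ h) τ)
      where
        open ≤-Reasoning
        finish : ∀ ν p s M k N h τ → M * N * (k + h * τ) ≡ ν * p + ((M * (k * N) - + 2 * ν * (p + - 1ℤ * s)) + (ν * p + h * N * (M * τ) - + 2 * ν * s))
        finish = solve-∀
        fX : + 2 * + ν * (∑ I Pos + - 1ℤ * ∑ I Neg) ≤ M * (+ k * N)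
        fX = ≤-trans (≤-reflexive (cong (+ 2 * + ν *_) (sym (trans E-fX (trans (∑-+ I Pos _) (cong (λ s → ∑ I Pos + s) (∑-*ˡ I (- 1ℤ) Neg)))))))
          (deviation-bound f 1ℤ refl)
        shift : ∀ q ν p → q * q * (+ 2 * ν * p) ≡ + 2 * ν * (q * q * p)
        shift = solve-∀
        regroup : ∀ ν N h Q p → + 2 * ν * (N * (h + 1ℤ) * Q * p) ≡ N * Q * p * (+ 2 * ν * (h + 1ℤ))
        regroup = solve-∀
        regroup′ : ∀ N h q Q p → N * Q * p * (h * (q - 1ℤ)) ≡ h * N * ((q - 1ℤ) * Q) * p
        regroup′ = solve-∀
        0≤ΣΠ : 0ℤ ≤ ∑ I Π
        0≤ΣΠ = ∑-nonneg I (λ i → ∑-nonneg Ss (λ S → 0≤⟦⟧ (piv i S)))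
        neg : + 2 * + ν * ∑ I Neg ≤ + ν * ∑ I Pos + + h * N * (M * τ)
        neg = *-cancelˡ (+ q * + q) (*-mono {1ℤ} {+ q} {1ℤ} {+ q} 0≤+ 0≤+ (+≤+ 1≤q) (+≤+ 1≤q)) (begin
          + q * + q * (+ 2 * + ν * ∑ I Neg)
            ≡⟨ trans (shift (+ q) (+ ν) (∑ I Neg)) (cong (+ 2 * + ν *_) (sym (∑-*ˡ I (+ q * + q) Neg))) ⟩
          + 2 * + ν * ∑ I (λ i → + q * + q * Neg i)
            ≤⟨ *-monoˡ (+ 2 * + ν) (0≤* {+ 2} {+ ν} 0≤+ 0≤+) (∑-mono I Neg-bound) ⟩
          + 2 * + ν * ∑ I (λ i → N * (+ h + 1ℤ) * qᵏ * Π i)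
            ≡⟨ trans (cong (+ 2 * + ν *_) (∑-*ˡ I (N * (+ h + 1ℤ) * qᵏ) Π)) (regroup (+ ν) N (+ h) qᵏ (∑ I Π)) ⟩
          N * qᵏ * ∑ I Π * (+ 2 * + ν * (+ h + 1ℤ))
            ≤⟨ *-monoˡ (N * qᵏ * ∑ I Π) (0≤* {N * qᵏ} (0≤* {N} {qᵏ} 0≤+ 0≤+) 0≤ΣΠ) hq ⟩
          N * qᵏ * ∑ I Π * (+ h * (+ q - 1ℤ))
            ≡⟨ trans (regroup′ N (+ h) (+ q) qᵏ (∑ I Π)) (sym (∑-*ˡ I (+ h * N * ((+ q - 1ℤ) * qᵏ)) Π)) ⟩
          ∑ I (λ i → + h * N * ((+ q - 1ℤ) * qᵏ) * Π i)
            ≤⟨ ∑-mono I Pos-bound ⟩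
          ∑ I (λ i → + q * + q * (+ ν * Pos i + + h * N * T i))
            ≡⟨ trans (∑-*ˡ I (+ q * + q) _) (cong (+ q * + q *_) (trans (∑-+ I _ _) (cong₂ _+_ (∑-*ˡ I (+ ν) Pos) (∑-*ˡ I (+ h * N) T)))) ⟩
          + q * + q * (+ ν * ∑ I Pos + + h * N * ∑ I T)
            ≤⟨ *-monoˡ (+ q * + q) (0≤sq (+ q)) (+-mono-≤ (≤-refl {+ ν * ∑ I Pos}) (*-monoˡ (+ h * N) (0≤* {+ h} {N} 0≤+ 0≤+) ∑T≤)) ⟩
          + q * + q * (+ ν * ∑ I Pos + + h * N * (M * τ)) ∎)

    -- Samples with exactly ℓ edges

    gd-piv : ∀ S κ i → ⟦ gd S ⟧ * y S κ i ≤ ⟦ piv i S ⟧ * y S κ i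
    gd-piv S κ i with gd S in good
    ... | false = ≤-trans (≤-reflexive (*-zeroˡ (y S κ i))) (0≤* (0≤⟦⟧ (piv i S)) (0≤y S κ i))
    ... | true with inB κ i in i∈B | touch S κ (lookup S i) in t
    ...   | false | _ = ≤-reflexive (sym (*-zeroʳ ⟦ piv i S ⟧))
    ...   | true | false = ≤-reflexive (sym (*-zeroʳ ⟦ piv i S ⟧))
    ...   | true | true = ≤-reflexive (cong (λ b → ⟦ b ⟧ * 1ℤ) (sym pivS))
      where
        fS : f S ≡ true
        fS = proj₁ (∧-true {f S} {D full S ℤ.≤ᵇ + L} good)
        D≤L : D full S ≤ + L
        D≤L = ≤ᵇℤ-true (D full S) (+ L) (proj₂ (∧-true {f S} {D full S ℤ.≤ᵇ + L} good))
        lowS : ∃[ j ] (inB κ j ≡ false × nbr S i j ≡ true) → low i S ≡ true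
        lowS (j , _ , e) with + L ℤ.≤ᵇ D (minus i) S in eq
        ... | false = refl
        ... | true = contradiction (≤-trans (+-mono-≤ (≤ᵇℤ-true (+ L) (D (minus i) S) eq) (≤-refl {1ℤ})) (≤-trans (D-minus<D i j S e) D≤L))
          (<⇒≱ (suc[i]≤j⇒i<j (≤-reflexive (+-comm 1ℤ (+ L)))))
        pivS : piv i S ≡ true
        pivS = ∧-intro {f S} {low i S} fS (lowS (touch-nbr S κ i i∈B t))

    module _ (hq : + 2 * + ν * (+ h + 1ℤ) ≤ + h * (+ q - 1ℤ)) where

      -- Where K does not vanish, N ≤ ν(N - W), so each touched index in B of a good sample is
      -- charged to its own positive contribution.
      E-gdKY : E (λ S κ → ⟦ gd S ⟧ * (K S κ * Y S κ)) ≤ M * (+ k + + h * τ)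
      E-gdKY = *-cancelˡ N (+≤+ 1≤n) (begin
        N * E (λ S κ → ⟦ gd S ⟧ * (K S κ * Y S κ))
          ≡⟨ E-*ˡ N _ ⟨
        E (λ S κ → N * (⟦ gd S ⟧ * (K S κ * Y S κ)))
          ≤⟨ E-mono pointwise ⟩
        E (λ S κ → ∑ I (λ i → + ν * (⟦ piv i S ⟧ * (K S κ * (y S κ i * w̄ S κ)))))
          ≡⟨ E-∑ (λ i S κ → + ν * (⟦ piv i S ⟧ * (K S κ * (y S κ i * w̄ S κ)))) ⟩
        ∑ I (λ i → E (λ S κ → + ν * (⟦ piv i S ⟧ * (K S κ * (y S κ i * w̄ S κ)))))
          ≡⟨ trans (∑-cong I (λ i → E-*ˡ (+ ν) _)) (∑-*ˡ I (+ ν) Pos) ⟩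
        + ν * ∑ I Pos
          ≤⟨ Pos-total hq ⟩
        M * N * (+ k + + h * τ)
          ≡⟨ commute M N (+ k + + h * τ) ⟩
        N * (M * (+ k + + h * τ)) ∎)
        where
          open ≤-Reasoning
          commute : ∀ M N x → M * N * x ≡ N * (M * x)
          commute = solve-∀
          spread : ∀ N g K y → N * (g * (K * y)) ≡ N * (g * K) * y
          spread = solve-∀
          spread′ : ∀ N K g y → N * (g * K) * y ≡ N * K * (g * y)
          spread′ = solve-∀
          dense : ∀ S κ → N * K S κ ≤ + ν * K S κ * w̄ S κ
          dense S κ with cut S κ in ct
          ... | false = ≤-reflexive (nil N (+ ν) (+ C (W S κ)) (w̄ S κ))
            where
              nil : ∀ N ν c w → N * (0ℤ * c) ≡ ν * (0ℤ * c) * w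
              nil = solve-∀
          ... | true = ≤-trans (≤-reflexive (*-comm N (1ℤ * + C (W S κ)))) (≤-trans (*-monoˡ (1ℤ * + C (W S κ)) (0≤* {1ℤ} {+ C (W S κ)} 0≤+ 0≤+) (proj₁ (cut-true S κ ct)))
              (≤-reflexive (move (1ℤ * + C (W S κ)) (+ ν) (w̄ S κ))))
            where
              move : ∀ c ν w → c * (ν * w) ≡ ν * c * w
              move = solve-∀
          collect : ∀ ν K w p y → ν * K * w * (p * y) ≡ ν * (p * (K * (y * w)))
          collect = solve-∀
          pointwise : ∀ S κ → N * (⟦ gd S ⟧ * (K S κ * Y S κ)) ≤ ∑ I (λ i → + ν * (⟦ piv i S ⟧ * (K S κ * (y S κ i * w̄ S κ))))
          pointwise S κ = begin
            N * (⟦ gd S ⟧ * (K S κ * Y S κ))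
              ≡⟨ trans (spread N ⟦ gd S ⟧ (K S κ) (Y S κ)) (sym (∑-*ˡ I (N * (⟦ gd S ⟧ * K S κ)) _)) ⟩
            ∑ I (λ i → N * (⟦ gd S ⟧ * K S κ) * y S κ i)
              ≤⟨ ∑-mono I (λ i → ≤-trans (≤-reflexive (spread′ N (K S κ) ⟦ gd S ⟧ (y S κ i)))
                   (≤-trans (*-mono {N * K S κ} (0≤* {N} 0≤+ (0≤K S κ)) (0≤* (0≤⟦⟧ (piv i S)) (0≤y S κ i)) (dense S κ) (gd-piv S κ i))
                     (≤-reflexive (collect (+ ν) (K S κ) (w̄ S κ) ⟦ piv i S ⟧ (y S κ i))))) ⟩
            ∑ I (λ i → + ν * (⟦ piv i S ⟧ * (K S κ * (y S κ i * w̄ S κ)))) ∎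

      -- K b W equals N K Y - X, and the correlation of -X with the good event is bounded by the
      -- case s = -1.
      E-gdKbW : + 2 * + ν * E (λ S κ → ⟦ gd S ⟧ * (K S κ * (+ b κ * + W S κ))) ≤ + 2 * + ν * (N * (M * (+ k + + h * τ))) + M * (+ k * N)
      E-gdKbW = begin
        + 2 * + ν * E (λ S κ → ⟦ gd S ⟧ * (K S κ * (+ b κ * + W S κ)))
          ≡⟨ cong (+ 2 * + ν *_) (trans (E-cong (λ S κ → trans (split ⟦ gd S ⟧ (K S κ) (+ b κ * + W S κ) N (Y S κ)) (cong (λ x → N * (⟦ gd S ⟧ * (K S κ * Y S κ)) + ⟦ gd S ⟧ * (- 1ℤ * x)) (sym (X-value S κ)))))
               (trans (E-+ _ _) (cong (_+ E (λ S κ → ⟦ gd S ⟧ * (- 1ℤ * X S κ))) (E-*ˡ N _)))) ⟩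
        + 2 * + ν * (N * E (λ S κ → ⟦ gd S ⟧ * (K S κ * Y S κ)) + E (λ S κ → ⟦ gd S ⟧ * (- 1ℤ * X S κ)))
          ≡⟨ distrib (+ 2 * + ν) (N * E (λ S κ → ⟦ gd S ⟧ * (K S κ * Y S κ))) (E (λ S κ → ⟦ gd S ⟧ * (- 1ℤ * X S κ))) ⟩
        + 2 * + ν * (N * E (λ S κ → ⟦ gd S ⟧ * (K S κ * Y S κ))) + + 2 * + ν * E (λ S κ → ⟦ gd S ⟧ * (- 1ℤ * X S κ))
          ≤⟨ +-mono-≤ (*-monoˡ (+ 2 * + ν) (0≤* {+ 2} {+ ν} 0≤+ 0≤+) (*-monoˡ N 0≤+ E-gdKY)) (deviation-bound gd (- 1ℤ) refl) ⟩
        + 2 * + ν * (N * (M * (+ k + + h * τ))) + M * (+ k * N) ∎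
        where
          open ≤-Reasoning
          distrib : ∀ a b c → a * (b + c) ≡ a * b + a * c
          distrib = solve-∀
          split : ∀ g K x N y → g * (K * x) ≡ N * (g * (K * y)) + g * (- 1ℤ * (K * (N * y - x)))
          split = solve-∀

      module _ (lam : ℕ) (lam⁴≤L : (lam ℕ.* lam) ℕ.* (lam ℕ.* lam) ℕ.≤ L) where

        λ² : ℤ
        λ² = + lam * + lam

        weighted : Vec (Fin n) k → Vec (Fin q) k → ℤ
        weighted S κ = + 9 * (N * (⟦ gd S ⟧ * (K S κ * Y S κ))) + + 20 * (⟦ gd S ⟧ * (K S κ * (+ b κ * + W S κ)))

        marked : ∀ S → gd S ≡ true → ∃[ m ] (count m ≡ lam ℕ.* lam × (∀ i → m i ≡ true → nonIsolated S i ≡ true))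
        marked S good = subset-of-size (nonIsolated S) (lam ℕ.* lam) (ℕP.≮⇒≥ λ c<λ² →
          ℕP.<⇒≱ (ℕP.*-mono-< c<λ² c<λ²) (ℕP.≤-trans lam⁴≤L (drop‿+≤+
            (≤-trans (≤ᵇℤ-true (+ L) (D full S) (proj₁ (∧-true {f S} {D full S ℤ.≤ᵇ + L} good))) (≤-trans (D≤nonIsolated² S) (≤-reflexive (sym (pos-* (count (nonIsolated S)) (count (nonIsolated S))))))))))

        -- Each of the λ² marked indices has a neighbour, so it is in B and touched with probability
        -- at least (q - 1)/q². The number of such indices is bounded by `amgm` on `cut`, and
        -- trivially by λ² elsewhere.
        per-good : ∀ S → gd S ≡ true → + 18 * (+ k * N) * (λ² * ((+ q - 1ℤ) * qᵏ)) ≤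
          + q * + q * ∑ κs (λ κ → + 18 * (+ k * N) * λ² * ⟦ not (cut S κ) ⟧ + + lam * + ν * (K S κ * (+ 9 * (N * Y S κ) + + 20 * (+ b κ * + W S κ))))
        per-good S good with marked S good
        ... | m , count-m , m⊆ = begin
          + 18 * (+ k * N) * (λ² * ((+ q - 1ℤ) * qᵏ))
            ≡⟨ cong (λ c → + 18 * (+ k * N) * (c * ((+ q - 1ℤ) * qᵏ))) ∑m≡λ² ⟨
          + 18 * (+ k * N) * (∑ I (λ i → ⟦ m i ⟧) * ((+ q - 1ℤ) * qᵏ))
            ≡⟨ cong (+ 18 * (+ k * N) *_) (trans (*-comm (∑ I (λ i → ⟦ m i ⟧)) ((+ q - 1ℤ) * qᵏ)) (sym (∑-*ˡ I ((+ q - 1ℤ) * qᵏ) _))) ⟩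
          + 18 * (+ k * N) * ∑ I (λ i → (+ q - 1ℤ) * qᵏ * ⟦ m i ⟧)
            ≤⟨ *-monoˡ (+ 18 * (+ k * N)) 0≤18kN (∑-mono I each) ⟩
          + 18 * (+ k * N) * ∑ I (λ i → + q * + q * ∑ κs (λ κ → ⟦ m i ⟧ * y S κ i))
            ≡⟨ trans (cong (+ 18 * (+ k * N) *_) (trans (∑-*ˡ I (+ q * + q) _) (cong (+ q * + q *_) (∑-swap I κs _)))) (swap (+ 18 * (+ k * N)) (+ q) _) ⟩
          + q * + q * (+ 18 * (+ k * N) * ∑ κs Ym)
            ≡⟨ cong (+ q * + q *_) (∑-*ˡ κs (+ 18 * (+ k * N)) Ym) ⟨
          + q * + q * ∑ κs (λ κ → + 18 * (+ k * N) * Ym κ)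
            ≤⟨ *-monoˡ (+ q * + q) (0≤sq (+ q)) (∑-mono κs pointwise) ⟩
          + q * + q * ∑ κs (λ κ → + 18 * (+ k * N) * λ² * ⟦ not (cut S κ) ⟧ + + lam * + ν * (K S κ * (+ 9 * (N * Y S κ) + + 20 * (+ b κ * + W S κ)))) ∎
          where
            open ≤-Reasoning
            0≤18kN : 0ℤ ≤ + 18 * (+ k * N)
            0≤18kN = 0≤* {+ 18} 0≤+ (0≤* {+ k} {N} 0≤+ 0≤+)
            Ym : Vec (Fin q) k → ℤ
            Ym κ = ∑ I (λ i → ⟦ m i ⟧ * y S κ i)
            0≤Ym : ∀ κ → 0ℤ ≤ Ym κ
            0≤Ym κ = ∑-nonneg I (λ i → 0≤* (0≤⟦⟧ (m i)) (0≤y S κ i))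
            ∑m≡λ² : ∑ I (λ i → ⟦ m i ⟧) ≡ λ²
            ∑m≡λ² = trans (sym (count-∑ m)) (trans (cong +_ count-m) (pos-* lam lam))
            swap : ∀ c q x → c * (q * q * x) ≡ q * q * (c * x)
            swap = solve-∀
            each : ∀ i → (+ q - 1ℤ) * qᵏ * ⟦ m i ⟧ ≤ + q * + q * ∑ κs (λ κ → ⟦ m i ⟧ * y S κ i)
            each i with m i in mi
            ... | false = ≤-trans (≤-reflexive (*-zeroʳ ((+ q - 1ℤ) * qᵏ))) (0≤* (0≤sq (+ q)) (∑-nonneg κs (λ κ → 0≤* {0ℤ} ≤-refl (0≤y S κ i))))
            ... | true with anyF-elim (nbr S i) (m⊆ i mi)
            ...   | j , e = ≤-trans (≤-reflexive (*-identityʳ ((+ q - 1ℤ) * qᵏ))) (≤-trans (∑-y S e)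
                      (≤-reflexive (cong (+ q * + q *_) (∑-cong κs (λ κ → sym (*-identityˡ (y S κ i)))))))
            y≤1 : ∀ κ i → y S κ i ≤ 1ℤ
            y≤1 κ i with inB κ i | touch S κ (lookup S i)
            ... | false | _ = 0≤+
            ... | true | true = ≤-refl
            ... | true | false = 0≤+
            Ym≤λ² : ∀ κ → Ym κ ≤ λ²
            Ym≤λ² κ = ≤-trans (∑-mono I (λ i → ≤-trans (*-monoˡ ⟦ m i ⟧ (0≤⟦⟧ (m i)) (y≤1 κ i)) (≤-reflexive (*-identityʳ ⟦ m i ⟧)))) (≤-reflexive ∑m≡λ²)
            Ym≤Y : ∀ κ → Ym κ ≤ Y S κ
            Ym≤Y κ = ∑-mono I (λ i → ≤-trans (*-mono {⟦ m i ⟧} {1ℤ} {y S κ i} {y S κ i} (0≤⟦⟧ (m i)) (0≤y S κ i) (⟦⟧≤1 (m i)) ≤-refl) (≤-reflexive (*-identityˡ (y S κ i))))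
            0≤Y : ∀ κ → 0ℤ ≤ Y S κ
            0≤Y κ = ∑-nonneg I (0≤y S κ)
            untouched : ∀ κ → W S κ ≡ 0 → Ym κ ≡ 0ℤ
            untouched κ W≡0 = trans (∑-cong I (λ i → trans (cong (λ t → ⟦ m i ⟧ * (⟦ inB κ i ⟧ * ⟦ t ⟧)) (count-0 (touch S κ) W≡0 (lookup S i))) (nil ⟦ m i ⟧ ⟦ inB κ i ⟧))) (∑-0 I)
              where
                nil : ∀ a b → a * (b * 0ℤ) ≡ 0ℤ
                nil = solve-∀
            0≤rhs : ∀ κ → 0ℤ ≤ + C (W S κ) * (+ 9 * (N * Y S κ) + + 20 * (+ b κ * + W S κ))
            0≤rhs κ = 0≤* {+ C (W S κ)} 0≤+ (0≤+⁺ (0≤* {+ 9} 0≤+ (0≤* {N} 0≤+ (0≤Y κ))) (0≤* {+ 20} 0≤+ (0≤* {+ b κ} {+ W S κ} 0≤+ 0≤+)))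
            on-cut : ∀ κ → cut S κ ≡ true → + 18 * (+ k * N) * Ym κ ≤ + lam * + ν * (+ C (W S κ) * (+ 9 * (N * Y S κ) + + 20 * (+ b κ * + W S κ)))
            on-cut κ ct with zero-or-positive (W S κ)
            ... | inj₁ W≡0 = ≤-trans (≤-reflexive (trans (cong (+ 18 * (+ k * N) *_) (untouched κ W≡0)) (*-zeroʳ (+ 18 * (+ k * N))))) (0≤* {+ lam * + ν} (0≤* {+ lam} {+ ν} 0≤+ 0≤+) (0≤rhs κ))
            ... | inj₂ 1≤W = amgm {+ k} {N} {+ ν} {+ lam} {+ C (W S κ)} {+ W S κ} {+ b κ} {Ym κ} {Y S κ} 0≤+ 0≤+ (+≤+ 1≤ν) 0≤+ 0≤+ 0≤+ (0≤Ym κ) (Ym≤λ² κ) (Ym≤Y κ)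
                    (kn≤2C²w (W S κ) 1≤W (W≤n S κ)) (≤-trans (proj₂ (cut-true S κ ct)) (≤-reflexive (cong (λ r → + 10 * (r * + b κ)) q≡ν²)))
            pointwise : ∀ κ → + 18 * (+ k * N) * Ym κ ≤ + 18 * (+ k * N) * λ² * ⟦ not (cut S κ) ⟧ + + lam * + ν * (K S κ * (+ 9 * (N * Y S κ) + + 20 * (+ b κ * + W S κ)))
            pointwise κ with cut S κ in ct
            ... | true = ≤-trans (on-cut κ ct) (≤-reflexive (shape (+ 18 * (+ k * N) * λ²) (+ lam * + ν) (+ C (W S κ)) (+ 9 * (N * Y S κ) + + 20 * (+ b κ * + W S κ))))
              where
                shape : ∀ a l c x → l * (c * x) ≡ a * 0ℤ + l * (1ℤ * c * x)
                shape = solve-∀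
            ... | false = ≤-trans (*-monoˡ (+ 18 * (+ k * N)) 0≤18kN (Ym≤λ² κ)) (≤-reflexive (shape (+ 18 * (+ k * N)) λ² (+ lam * + ν) (+ C (W S κ)) (+ 9 * (N * Y S κ) + + 20 * (+ b κ * + W S κ))))
              where
                shape : ∀ a l ν c x → a * l ≡ a * l * 1ℤ + ν * (0ℤ * c * x)
                shape = solve-∀

        per-sample : ∀ S → + 18 * (+ k * N) * (λ² * ((+ q - 1ℤ) * qᵏ)) * ⟦ gd S ⟧ ≤
          + q * + q * ∑ κs (λ κ → + 18 * (+ k * N) * λ² * ⟦ gd S ∧ not (cut S κ) ⟧ + + lam * + ν * weighted S κ)
        per-sample S = by-cases (gd S) (per-good S)
          where
            nil : ∀ a c N u v → 0ℤ ≡ a * 0ℤ + c * (+ 9 * (N * (0ℤ * u)) + + 20 * (0ℤ * v))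
            nil = solve-∀
            spread : ∀ a c K N y bw → a + c * (K * (+ 9 * (N * y) + + 20 * bw)) ≡ a + c * (+ 9 * (N * (1ℤ * (K * y))) + + 20 * (1ℤ * (K * bw)))
            spread = solve-∀
            by-cases : ∀ {A} c → (c ≡ true → A ≤ + q * + q * ∑ κs (λ κ → + 18 * (+ k * N) * λ² * ⟦ not (cut S κ) ⟧ + + lam * + ν * (K S κ * (+ 9 * (N * Y S κ) + + 20 * (+ b κ * + W S κ))))) →
              A * ⟦ c ⟧ ≤ + q * + q * ∑ κs (λ κ → + 18 * (+ k * N) * λ² * ⟦ c ∧ not (cut S κ) ⟧ +
                + lam * + ν * (+ 9 * (N * (⟦ c ⟧ * (K S κ * Y S κ))) + + 20 * (⟦ c ⟧ * (K S κ * (+ b κ * + W S κ)))))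
            by-cases {A} false _ = ≤-trans (≤-reflexive (*-zeroʳ A)) (0≤* (0≤sq (+ q)) (∑-nonneg κs (λ κ → ≤-reflexive (nil (+ 18 * (+ k * N) * λ²) (+ lam * + ν) N (K S κ * Y S κ) (K S κ * (+ b κ * + W S κ))))))
            by-cases {A} true le = ≤-trans (≤-reflexive (*-identityʳ A)) (≤-trans (le refl) (≤-reflexive (cong (+ q * + q *_)
              (∑-cong κs (λ κ → spread (+ 18 * (+ k * N) * λ² * ⟦ not (cut S κ) ⟧) (+ lam * + ν) (K S κ) N (Y S κ) (+ b κ * + W S κ))))))

        H : ℤ
        H = ∑ Ss (λ S → ⟦ gd S ⟧)

        total : + 18 * (+ k * N) * (λ² * ((+ q - 1ℤ) * qᵏ)) * H ≤
          + q * + q * (+ 18 * N * λ² * (M * τ) + + lam * (+ 29 * + ν * (N * (M * (+ k + + h * τ))) + + 10 * (M * (+ k * N))))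
        total = begin
          + 18 * (+ k * N) * (λ² * ((+ q - 1ℤ) * qᵏ)) * H
            ≡⟨ ∑-*ˡ Ss (+ 18 * (+ k * N) * (λ² * ((+ q - 1ℤ) * qᵏ))) _ ⟨
          ∑ Ss (λ S → + 18 * (+ k * N) * (λ² * ((+ q - 1ℤ) * qᵏ)) * ⟦ gd S ⟧)
            ≤⟨ ∑-mono Ss per-sample ⟩
          ∑ Ss (λ S → + q * + q * ∑ κs (λ κ → c * ⟦ gd S ∧ not (cut S κ) ⟧ + + lam * + ν * weighted S κ))
            ≡⟨ trans (∑-*ˡ Ss (+ q * + q) _) (cong (+ q * + q *_) (trans (E-+ _ _) (cong₂ _+_ (E-*ˡ c _) (trans (E-*ˡ (+ lam * + ν) weighted)
                 (cong (+ lam * + ν *_) (trans (E-+ _ _) (cong₂ _+_ (trans (E-*ˡ (+ 9) _) (cong (+ 9 *_) (E-*ˡ N _))) (E-*ˡ (+ 20) _)))))))) ⟩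
          + q * + q * (c * T₀ + + lam * + ν * (+ 9 * (N * A) + + 20 * B))
            ≡⟨ cong (+ q * + q *_) (regroup (+ k) N λ² T₀ (+ lam) (+ ν) A B) ⟩
          + q * + q * (+ 18 * N * λ² * (+ k * T₀) + + lam * (+ 9 * + ν * (N * A) + + 10 * (+ 2 * + ν * B)))
            ≤⟨ *-monoˡ (+ q * + q) (0≤sq (+ q)) (+-mono-≤ (*-monoˡ (+ 18 * N * λ²) (0≤* {+ 18 * N} (0≤* {+ 18} {N} 0≤+ 0≤+) (0≤sq (+ lam))) rare-gd)
                 (*-monoˡ (+ lam) 0≤+ (+-mono-≤ (*-monoˡ (+ 9 * + ν) (0≤* {+ 9} {+ ν} 0≤+ 0≤+) (*-monoˡ N 0≤+ E-gdKY)) (*-monoˡ (+ 10) 0≤+ E-gdKbW)))) ⟩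
          + q * + q * (+ 18 * N * λ² * (M * τ) + + lam * (+ 9 * + ν * (N * (M * (+ k + + h * τ))) + + 10 * (+ 2 * + ν * (N * (M * (+ k + + h * τ))) + M * (+ k * N))))
            -- 29 = 9 + 20, because the bound on K b W contains the bound on N K Y once more.
            ≡⟨ cong (λ r → + q * + q * (+ 18 * N * λ² * (M * τ) + + lam * r)) (collect (+ ν) (N * (M * (+ k + + h * τ))) (M * (+ k * N))) ⟩
          + q * + q * (+ 18 * N * λ² * (M * τ) + + lam * (+ 29 * + ν * (N * (M * (+ k + + h * τ))) + + 10 * (M * (+ k * N)))) ∎
          where
            open ≤-Reasoning
            c = + 18 * (+ k * N) * λ²
            T₀ = E (λ S κ → ⟦ gd S ∧ not (cut S κ) ⟧)
            A = E (λ S κ → ⟦ gd S ⟧ * (K S κ * Y S κ))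
            B = E (λ S κ → ⟦ gd S ⟧ * (K S κ * (+ b κ * + W S κ)))
            regroup : ∀ k N s t l ν a b → + 18 * (k * N) * s * t + l * ν * (+ 9 * (N * a) + + 20 * b) ≡ + 18 * N * s * (k * t) + l * (+ 9 * ν * (N * a) + + 10 * (+ 2 * ν * b))
            regroup = solve-∀
            collect : ∀ ν x m → + 9 * ν * x + + 10 * (+ 2 * ν * x + m) ≡ + 29 * ν * x + + 10 * m
            collect = solve-∀

        module _ (1≤lam : 1 ℕ.≤ lam) (lam-small : + 3 * (+ lam * τ) ≤ + k) (h-small : + 3 * (+ h * τ) ≤ + k) where

          -- One factor λ cancels, leaving a probability of order 1/λ. The two smallness conditions
          -- bound 54λτ by 18k and k + hτ by 4k/3, so 48 = 18 + 30 and 116 = 29 · 4.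
          sample-bound : + 54 * + lam * (+ q - 1ℤ) * H ≤ + q * + q * (+ 48 + + 116 * + ν) * nᵏ
          sample-bound = *-cancelˡ (+ k * (N * (+ lam * qᵏ))) positive-factor (begin
            + k * (N * (+ lam * qᵏ)) * (+ 54 * + lam * (+ q - 1ℤ) * H)
              ≡⟨ lhs (+ k) N (+ lam) qᵏ (+ q) H ⟩
            + 3 * (+ 18 * (+ k * N) * (λ² * ((+ q - 1ℤ) * qᵏ)) * H)
              ≤⟨ *-monoˡ (+ 3) 0≤+ total ⟩
            + 3 * (+ q * + q * (+ 18 * N * λ² * (M * τ) + + lam * (+ 29 * + ν * (N * (M * (+ k + + h * τ))) + + 10 * (M * (+ k * N)))))
              ≡⟨ factor (+ q * + q) N (+ lam) M τ (+ ν) (+ k) (+ k + + h * τ) ⟩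
            + q * + q * (N * (+ lam * M)) * (+ 3 * (+ 18 * (+ lam * τ) + + 29 * + ν * (+ k + + h * τ) + + 10 * + k))
              ≤⟨ *-monoˡ (+ q * + q * (N * (+ lam * M))) (0≤* (0≤sq (+ q)) (0≤* {N} 0≤+ (0≤* {+ lam} 0≤+ 0≤M)))
                  (≤-by (+ 18 * (+ k - + 3 * (+ lam * τ)) + + 29 * + ν * (+ k - + 3 * (+ h * τ)))
                    (0≤+⁺ (0≤* {+ 18} 0≤+ (0≤-diff lam-small)) (0≤* {+ 29 * + ν} (0≤* {+ 29} {+ ν} 0≤+ 0≤+) (0≤-diff h-small)))
                    (slack (+ lam) τ (+ ν) (+ k) (+ h))) ⟩
            + q * + q * (N * (+ lam * M)) * (+ k * (+ 48 + + 116 * + ν))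
              ≡⟨ rhs (+ q) N (+ lam) nᵏ qᵏ (+ ν) (+ k) ⟩
            + k * (N * (+ lam * qᵏ)) * (+ q * + q * (+ 48 + + 116 * + ν) * nᵏ) ∎)
            where
              open ≤-Reasoning
              1≤qᵏ : 1 ℕ.≤ q ℕ.^ k
              1≤qᵏ = ℕP.m^n>0 q {{ℕ.>-nonZero 1≤q}} k
              1* : ∀ {a b} → 1ℤ ≤ + a → 1ℤ ≤ b → 1ℤ ≤ + a * b
              1* {a} {b} p r = *-mono {1ℤ} {+ a} {1ℤ} {b} 0≤+ (≤-trans 0≤+ r) p r
              positive-factor : 1ℤ ≤ + k * (N * (+ lam * qᵏ))
              positive-factor = 1* {k} (+≤+ 1≤k) (1* {n} (+≤+ 1≤n) (1* {lam} (+≤+ 1≤lam) (+≤+ 1≤qᵏ)))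
              lhs : ∀ k N l Q q H → k * (N * (l * Q)) * (+ 54 * l * (q - 1ℤ) * H) ≡ + 3 * (+ 18 * (k * N) * (l * l * ((q - 1ℤ) * Q)) * H)
              lhs = solve-∀
              rhs : ∀ q N l P Q ν k → q * q * (N * (l * (P * Q))) * (k * (+ 48 + + 116 * ν)) ≡ k * (N * (l * Q)) * (q * q * (+ 48 + + 116 * ν) * P)
              rhs = solve-∀
              factor : ∀ q N l M τ ν k x → + 3 * (q * (+ 18 * N * (l * l) * (M * τ) + l * (+ 29 * ν * (N * (M * x)) + + 10 * (M * (k * N))))) ≡
                q * (N * (l * M)) * (+ 3 * (+ 18 * (l * τ) + + 29 * ν * x + + 10 * k))
              factor = solve-∀
              slack : ∀ l τ ν k h → k * (+ 48 + + 116 * ν) ≡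
                + 3 * (+ 18 * (l * τ) + + 29 * ν * (k + h * τ) + + 10 * k) + (+ 18 * (k - + 3 * (l * τ)) + + 29 * ν * (k - + 3 * (h * τ)))
              slack = solve-∀

  -- From k-sets to sequences of vertices

  open import Data.Nat.Combinatorics using (_C_; nCk+nC[k+1]≡[n+1]C[k+1])

  countTrue-++ : ∀ xs ys → countTrue (xs ++ ys) ≡ countTrue xs ℕ.+ countTrue ys
  countTrue-++ [] ys = refl
  countTrue-++ (true ∷ xs) ys = cong suc (countTrue-++ xs ys)
  countTrue-++ (false ∷ xs) ys = countTrue-++ xs ys

  countTrue-∑ : {A : Set} (p : A → Bool) (xs : List A) → + countTrue (map p xs) ≡ ∑ xs (λ x → ⟦ p x ⟧)
  countTrue-∑ p [] = refl
  countTrue-∑ p (x ∷ xs) with p x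
  ... | true = cong (λ c → 1ℤ + c) (countTrue-∑ p xs)
  ... | false = trans (countTrue-∑ p xs) (sym (+-identityˡ _))

  countTrue-concatMap : {A : Set} (f : A → List Bool) (xs : List A) →
    + countTrue (concatMap f xs) ≡ ∑ xs (λ x → + countTrue (f x))
  countTrue-concatMap f [] = refl
  countTrue-concatMap f (x ∷ xs) = trans (cong +_ (countTrue-++ (f x) (concatMap f xs)))
    (trans (pos-+ (countTrue (f x)) (countTrue (concatMap f xs))) (cong (λ c → + countTrue (f x) + c) (countTrue-concatMap f xs)))

  ∑-allSubsets-suc : ∀ n (φ : Subset (suc n) → ℤ) →
    ∑ (allSubsets (suc n)) φ ≡ ∑ (allSubsets n) (λ T → φ (true ∷ T)) + ∑ (allSubsets n) (λ T → φ (false ∷ T))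
  ∑-allSubsets-suc n φ = trans (∑-++ (map (true ∷_) (allSubsets n)) (map (false ∷_) (allSubsets n)) φ)
    (cong₂ _+_ (∑-map (true ∷_) (allSubsets n) φ) (∑-map (false ∷_) (allSubsets n) φ))

  size-∑ : ∀ {n} (T : Subset n) → ∑ (allFin n) (λ v → ⟦ lookup T v ⟧) ≡ + size T
  size-∑ [] = refl
  size-∑ {suc n} (true ∷ T) = trans (∑-allFin-suc n (λ v → ⟦ lookup (true ∷ T) v ⟧)) (cong (λ c → 1ℤ + c) (size-∑ T))
  size-∑ {suc n} (false ∷ T) = trans (∑-allFin-suc n (λ v → ⟦ lookup (false ∷ T) v ⟧)) (trans (+-identityˡ (∑ (allFin n) (λ v → ⟦ lookup T v ⟧))) (size-∑ T))

  -- T ↦ T ∪ {x} is a bijection from the subsets avoiding x to those containing x.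
  ∑-insert : ∀ {n} (x : Fin n) (p : ℕ → ℤ) (φ : Subset n → ℤ) →
    ∑ (allSubsets n) (λ T → p (suc (size T)) * (⟦ not (lookup T x) ⟧ * φ (T [ x ]≔ true))) ≡
    ∑ (allSubsets n) (λ T → p (size T) * (⟦ lookup T x ⟧ * φ T))
  ∑-insert {suc n} zero p φ = begin
    ∑ (allSubsets (suc n)) (λ T → p (suc (size T)) * (⟦ not (lookup T zero) ⟧ * φ (T [ zero ]≔ true)))
      ≡⟨ ∑-allSubsets-suc n _ ⟩
    ∑ (allSubsets n) (λ T → p (suc (suc (size T))) * (0ℤ * φ (true ∷ T))) + ∑ (allSubsets n) (λ T → p (suc (size T)) * (1ℤ * φ (true ∷ T)))
      ≡⟨ cong (_+ ∑ (allSubsets n) (λ T → p (suc (size T)) * (1ℤ * φ (true ∷ T)))) (∑-cong (allSubsets n) (λ T → nil (p (suc (suc (size T)))) (p (size T)) (φ (true ∷ T)) (φ (false ∷ T)))) ⟩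
    ∑ (allSubsets n) (λ T → p (size T) * (0ℤ * φ (false ∷ T))) + ∑ (allSubsets n) (λ T → p (suc (size T)) * (1ℤ * φ (true ∷ T)))
      ≡⟨ +-comm (∑ (allSubsets n) (λ T → p (size T) * (0ℤ * φ (false ∷ T)))) (∑ (allSubsets n) (λ T → p (suc (size T)) * (1ℤ * φ (true ∷ T)))) ⟩
    ∑ (allSubsets n) (λ T → p (suc (size T)) * (1ℤ * φ (true ∷ T))) + ∑ (allSubsets n) (λ T → p (size T) * (0ℤ * φ (false ∷ T)))
      ≡⟨ ∑-allSubsets-suc n _ ⟨
    ∑ (allSubsets (suc n)) (λ T → p (size T) * (⟦ lookup T zero ⟧ * φ T)) ∎
    where
      open ≡-Reasoning
      nil : ∀ a b x y → a * (0ℤ * x) ≡ b * (0ℤ * y)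
      nil = solve-∀
  ∑-insert {suc n} (suc x) p φ = trans (∑-allSubsets-suc n _) (trans
    (cong₂ _+_ (∑-insert x (p ∘ suc) (λ T → φ (true ∷ T))) (∑-insert x p (λ T → φ (false ∷ T))))
    (sym (∑-allSubsets-suc n _)))

  ∅ : ∀ n → Subset n
  ∅ n = replicate n false

  ∑-size-0 : ∀ n (φ : Subset n → ℤ) → ∑ (allSubsets n) (λ T → ⟦ size T ℕ.≡ᵇ 0 ⟧ * φ T) ≡ φ (∅ n)
  ∑-size-0 zero φ = trans (+-identityʳ _) (*-identityˡ (φ []))
  ∑-size-0 (suc n) φ = trans (∑-allSubsets-suc n _) (trans
    (cong₂ _+_ (trans (∑-cong (allSubsets n) (λ T → *-zeroˡ (φ (true ∷ T)))) (∑-0 (allSubsets n))) (∑-size-0 n (λ T → φ (false ∷ T)))) (+-identityˡ _))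

  ∑-size≡C : ∀ n k → ∑ (allSubsets n) (λ T → ⟦ size T ℕ.≡ᵇ k ⟧) ≡ + (n C k)
  ∑-size≡C n zero = trans (∑-cong (allSubsets n) (λ T → sym (*-identityʳ ⟦ size T ℕ.≡ᵇ 0 ⟧))) (∑-size-0 n (λ _ → 1ℤ))
  ∑-size≡C zero (suc k) = refl
  ∑-size≡C (suc n) (suc k) = trans (∑-allSubsets-suc n _) (trans (cong₂ _+_ (∑-size≡C n k) (∑-size≡C n (suc k)))
    (trans (sym (pos-+ (n C k) (n C suc k))) (cong +_ (nCk+nC[k+1]≡[n+1]C[k+1] n k))))

  module Sequences (n : ℕ) where

    image : ∀ {k} → Vec (Fin n) k → Subset n
    image [] = ∅ n
    image (x ∷ S) = image S [ x ]≔ true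

    distinct : ∀ {k} → Vec (Fin n) k → Bool
    distinct [] = true
    distinct (x ∷ S) = not (lookup (image S) x) ∧ distinct S

    ∑-insert-weight : ∀ (T : Subset n) x (F : Fin n → ℤ) → lookup T x ≡ false →
      ∑ (allFin n) (λ v → ⟦ lookup (T [ x ]≔ true) v ⟧ * F v) ≡ F x + ∑ (allFin n) (λ v → ⟦ lookup T v ⟧ * F v)
    ∑-insert-weight T x F x∉T = begin
      ∑ (allFin n) (λ v → ⟦ lookup (T [ x ]≔ true) v ⟧ * F v)
        ≡⟨ ∑-cong (allFin n) split ⟩
      ∑ (allFin n) (λ v → ⟦ not (neq v x) ⟧ * F v + ⟦ lookup T v ⟧ * F v)
        ≡⟨ ∑-+ (allFin n) _ _ ⟩
      ∑ (allFin n) (λ v → ⟦ not (neq v x) ⟧ * F v) + ∑ (allFin n) (λ v → ⟦ lookup T v ⟧ * F v)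
        ≡⟨ cong (_+ ∑ (allFin n) (λ v → ⟦ lookup T v ⟧ * F v)) (trans (∑-single x _ (λ v v≢x → trans (cong (λ b → ⟦ not b ⟧ * F v) (neq-true v≢x)) (*-zeroˡ (F v))))
             (trans (cong (λ b → ⟦ not b ⟧ * F x) (neq-refl x)) (*-identityˡ (F x)))) ⟩
      F x + ∑ (allFin n) (λ v → ⟦ lookup T v ⟧ * F v) ∎
      where
        open ≡-Reasoning
        here : ∀ y → 1ℤ * y ≡ 1ℤ * y + 0ℤ * y
        here = solve-∀
        there : ∀ a y → a * y ≡ 0ℤ * y + a * y
        there = solve-∀
        split : ∀ v → ⟦ lookup (T [ x ]≔ true) v ⟧ * F v ≡ ⟦ not (neq v x) ⟧ * F v + ⟦ lookup T v ⟧ * F v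
        split v with v FinP.≟ x
        ... | yes refl rewrite lookup∘update v T true | x∉T = here (F v)
        ... | no v≢x rewrite lookup∘update′ v≢x T true = there ⟦ lookup T v ⟧ (F v)

    not-true : ∀ {c} → not c ≡ true → c ≡ false
    not-true {false} _ = refl

    ∑-image : ∀ {k} (S : Vec (Fin n) k) (F : Fin n → ℤ) → distinct S ≡ true →
      ∑ (allFin n) (λ v → ⟦ lookup (image S) v ⟧ * F v) ≡ ∑ (allFin k) (λ j → F (lookup S j))
    ∑-image [] F _ = trans (∑-cong (allFin n) (λ v → trans (cong (λ c → ⟦ c ⟧ * F v) (lookup-replicate v false)) (*-zeroˡ (F v)))) (∑-0 (allFin n))
    ∑-image {suc k} (x ∷ S) F d = trans (∑-insert-weight (image S) x F (not-true (proj₁ (∧-true d))))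
      (trans (cong (λ c → F x + c) (∑-image S F (proj₂ (∧-true {not (lookup (image S) x)} d)))) (sym (∑-allFin-suc k (λ j → F (lookup (x ∷ S) j)))))

    -- Every k-set is the image of k! sequences.
    ∑-distinct : ∀ k (φ : Subset n → ℤ) →
      ∑ (vecs (allFin n) k) (λ S → ⟦ distinct S ⟧ * φ (image S)) ≡ + (k !) * ∑ (allSubsets n) (λ T → ⟦ size T ℕ.≡ᵇ k ⟧ * φ T)
    ∑-distinct zero φ = trans (+-identityʳ _) (cong (1ℤ *_) (sym (∑-size-0 n φ)))
    ∑-distinct (suc k) φ = begin
      ∑ (vecs V (suc k)) (λ S → ⟦ distinct S ⟧ * φ (image S))
        ≡⟨ ∑-vecs-suc V k _ ⟩
      ∑ V (λ x → ∑ (vecs V k) (λ S → ⟦ not (lookup (image S) x) ∧ distinct S ⟧ * φ (image S [ x ]≔ true)))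
        ≡⟨ ∑-swap V (vecs V k) _ ⟩
      ∑ (vecs V k) (λ S → ∑ V (λ x → ⟦ not (lookup (image S) x) ∧ distinct S ⟧ * φ (image S [ x ]≔ true)))
        ≡⟨ ∑-cong (vecs V k) (λ S → trans (∑-cong V (λ x → pull (not (lookup (image S) x)) (distinct S) (φ (image S [ x ]≔ true)))) (∑-*ˡ V ⟦ distinct S ⟧ _)) ⟩
      ∑ (vecs V k) (λ S → ⟦ distinct S ⟧ * φ′ (image S))
        ≡⟨ ∑-distinct k φ′ ⟩
      + (k !) * ∑ (allSubsets n) (λ T → ⟦ size T ℕ.≡ᵇ k ⟧ * φ′ T)
        ≡⟨ cong (+ (k !) *_) (trans (∑-cong (allSubsets n) (λ T → sym (∑-*ˡ V ⟦ size T ℕ.≡ᵇ k ⟧ _))) (∑-swap (allSubsets n) V _)) ⟩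
      + (k !) * ∑ V (λ x → ∑ (allSubsets n) (λ T → ⟦ size T ℕ.≡ᵇ k ⟧ * (⟦ not (lookup T x) ⟧ * φ (T [ x ]≔ true))))
        ≡⟨ cong (+ (k !) *_) (∑-cong V (λ x → ∑-insert x (λ s → ⟦ s ℕ.≡ᵇ suc k ⟧) φ)) ⟩
      + (k !) * ∑ V (λ x → ∑ (allSubsets n) (λ T → ⟦ size T ℕ.≡ᵇ suc k ⟧ * (⟦ lookup T x ⟧ * φ T)))
        ≡⟨ cong (+ (k !) *_) (trans (∑-swap V (allSubsets n) _) (trans (∑-cong (allSubsets n) per-set) (∑-*ˡ (allSubsets n) (+ suc k) _))) ⟩
      + (k !) * (+ suc k * ∑ (allSubsets n) (λ T → ⟦ size T ℕ.≡ᵇ suc k ⟧ * φ T))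
        ≡⟨ trans (assoc (+ (k !)) (+ suc k) _) (cong (_* ∑ (allSubsets n) (λ T → ⟦ size T ℕ.≡ᵇ suc k ⟧ * φ T)) (sym (pos-* (suc k) (k !)))) ⟩
      + (suc k !) * ∑ (allSubsets n) (λ T → ⟦ size T ℕ.≡ᵇ suc k ⟧ * φ T) ∎
      where
        open ≡-Reasoning
        V = allFin n
        φ′ : Subset n → ℤ
        φ′ T = ∑ V (λ x → ⟦ not (lookup T x) ⟧ * φ (T [ x ]≔ true))
        assoc : ∀ a b c → a * (b * c) ≡ b * a * c
        assoc = solve-∀
        rotate : ∀ a b c → a * (b * c) ≡ a * c * b
        rotate = solve-∀
        pull : ∀ a b x → ⟦ a ∧ b ⟧ * x ≡ ⟦ b ⟧ * (⟦ a ⟧ * x)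
        pull true b x = cong (⟦ b ⟧ *_) (sym (*-identityˡ x))
        pull false b x = trans (*-zeroˡ x) (sym (trans (cong (⟦ b ⟧ *_) (*-zeroˡ x)) (*-zeroʳ ⟦ b ⟧)))
        per-set : ∀ T → ∑ V (λ x → ⟦ size T ℕ.≡ᵇ suc k ⟧ * (⟦ lookup T x ⟧ * φ T)) ≡ + suc k * (⟦ size T ℕ.≡ᵇ suc k ⟧ * φ T)
        per-set T = trans (∑-cong V (λ x → rotate ⟦ size T ℕ.≡ᵇ suc k ⟧ ⟦ lookup T x ⟧ (φ T)))
          (trans (∑-*ˡ V (⟦ size T ℕ.≡ᵇ suc k ⟧ * φ T) _) (trans (cong (⟦ size T ℕ.≡ᵇ suc k ⟧ * φ T *_) (size-∑ T)) known))
          where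
            known : ⟦ size T ℕ.≡ᵇ suc k ⟧ * φ T * + size T ≡ + suc k * (⟦ size T ℕ.≡ᵇ suc k ⟧ * φ T)
            known with size T ℕ.≡ᵇ suc k in eq
            ... | false = trans (cong (_* + size T) (*-zeroˡ (φ T))) (trans (*-zeroˡ (+ size T)) (sym (trans (cong (+ suc k *_) (*-zeroˡ (φ T))) (*-zeroʳ (+ suc k)))))
            ... | true = trans (cong (λ s → 1ℤ * φ T * + s) (ℕP.≡ᵇ⇒≡ (size T) (suc k) (subst IsTrue (sym eq) _))) (*-comm (1ℤ * φ T) (+ suc k))

    #distinct : ℕ → ℤ
    #distinct k = ∑ (vecs (allFin n) k) (λ S → ⟦ distinct S ⟧)

    #distinct≡ : ∀ k → #distinct k ≡ + (k !) * + (n C k)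
    #distinct≡ k = trans (∑-cong (vecs (allFin n) k) (λ S → sym (*-identityʳ ⟦ distinct S ⟧)))
      (trans (∑-distinct k (λ _ → 1ℤ)) (cong (+ (k !) *_) (trans (∑-cong (allSubsets n) (λ T → *-identityʳ ⟦ size T ℕ.≡ᵇ k ⟧)) (∑-size≡C n k))))

    #distinct-suc : ∀ k → #distinct (suc k) ≡ (+ n - + k) * #distinct k
    #distinct-suc k = begin
      #distinct (suc k)
        ≡⟨ trans (∑-vecs-suc V k _) (∑-swap V (vecs V k) _) ⟩
      ∑ (vecs V k) (λ S → ∑ V (λ x → ⟦ not (lookup (image S) x) ∧ distinct S ⟧))
        ≡⟨ ∑-cong (vecs V k) per-S ⟩
      ∑ (vecs V k) (λ S → (+ n - + k) * ⟦ distinct S ⟧)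
        ≡⟨ ∑-*ˡ (vecs V k) (+ n - + k) _ ⟩
      (+ n - + k) * #distinct k ∎
      where
        open ≡-Reasoning
        V = allFin n
        compl : ∀ c → ⟦ not c ∧ true ⟧ ≡ 1ℤ + - 1ℤ * (⟦ c ⟧ * 1ℤ)
        compl true = refl
        compl false = refl
        collect : ∀ n k → n * 1ℤ + - 1ℤ * (k * 1ℤ) ≡ (n - k) * 1ℤ
        collect = solve-∀
        per-S : ∀ S → ∑ V (λ x → ⟦ not (lookup (image S) x) ∧ distinct S ⟧) ≡ (+ n - + k) * ⟦ distinct S ⟧
        per-S S with distinct S in d
        ... | false = trans (∑-cong V (λ x → cong ⟦_⟧ (∧-zeroʳ (not (lookup (image S) x))))) (trans (∑-0 V) (sym (*-zeroʳ (+ n - + k))))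
        ... | true = begin
          ∑ V (λ x → ⟦ not (lookup (image S) x) ∧ true ⟧)
            ≡⟨ trans (∑-cong V (λ x → compl (lookup (image S) x))) (∑-+ V _ _) ⟩
          ∑ V (λ _ → 1ℤ) + ∑ V (λ x → - 1ℤ * (⟦ lookup (image S) x ⟧ * 1ℤ))
            ≡⟨ cong₂ _+_ (∑-allFin-const n 1ℤ) (trans (∑-*ˡ V (- 1ℤ) _) (cong (- 1ℤ *_) (trans (∑-image S (λ _ → 1ℤ) d) (∑-allFin-const k 1ℤ)))) ⟩
          + n * 1ℤ + - 1ℤ * (+ k * 1ℤ)
            ≡⟨ collect (+ n) (+ k) ⟩
          (+ n - + k) * 1ℤ ∎

    -- A birthday bound: at most a fraction k²/n of the sequences repeat a vertex.
    #distinct-lower : ∀ k → k ℕ.≤ n → + (n ℕ.^ k) * (+ n - + k * + k) ≤ + n * #distinct k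
    #distinct-lower zero _ = ≤-reflexive (base (+ n))
      where
        base : ∀ n → 1ℤ * (n - 0ℤ * 0ℤ) ≡ n * (1ℤ * 1ℤ + 0ℤ)
        base = solve-∀
    #distinct-lower (suc k) k<n = begin
      + (n ℕ.* n ℕ.^ k) * (+ n - + suc k * + suc k)
        ≡⟨ cong₂ (λ a c → a * (+ n - c * c)) (pos-* n (n ℕ.^ k)) (pos-+ 1 k) ⟩
      + n * + (n ℕ.^ k) * (+ n - (1ℤ + + k) * (1ℤ + + k))
        ≤⟨ ≤-by (+ (n ℕ.^ k) * (+ n * (1ℤ + + k) + + k * (+ k * + k))) (0≤* {+ (n ℕ.^ k)} 0≤+ (0≤+⁺ (0≤* {+ n} {1ℤ + + k} 0≤+ 0≤+) (0≤* {+ k} 0≤+ (0≤sq (+ k))))) (expand (+ n) (+ (n ℕ.^ k)) (+ k)) ⟩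
      (+ n - + k) * (+ (n ℕ.^ k) * (+ n - + k * + k))
        ≤⟨ *-monoˡ (+ n - + k) (0≤-diff (+≤+ (ℕP.<⇒≤ k<n))) (#distinct-lower k (ℕP.<⇒≤ k<n)) ⟩
      (+ n - + k) * (+ n * #distinct k)
        ≡⟨ trans (commute (+ n - + k) (+ n) (#distinct k)) (cong (+ n *_) (sym (#distinct-suc k))) ⟩
      + n * #distinct (suc k) ∎
      where
        open ≤-Reasoning
        expand : ∀ n P k → (n - k) * (P * (n - k * k)) ≡ n * P * (n - (1ℤ + k) * (1ℤ + k)) + P * (n * (1ℤ + k) + k * (k * k))
        expand = solve-∀
        commute : ∀ a b c → a * (b * c) ≡ b * (a * c)
        commute = solve-∀

  module GraphCount {n : ℕ} (G : Graph n) where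

    open Sequences n

    -- The entries of G that `edgesIn` reads; `adj` is the symmetric graph that they encode.
    upper : Fin n → Fin n → Bool
    upper u v = (toℕ u ℕ.<ᵇ toℕ v) ∧ G u v

    adj : Fin n → Fin n → Bool
    adj u v = upper u v ∨ upper v u

    adj-sym : ∀ u v → adj u v ≡ adj v u
    adj-sym u v = ∨-comm (upper u v) (upper v u)

    private
      <ᵇ-asym : ∀ a b → (a ℕ.<ᵇ b) ≡ true → (b ℕ.<ᵇ a) ≡ true → true ≡ false
      <ᵇ-asym a b p r = contradiction (ℕP.<ᵇ⇒< b a (subst IsTrue (sym r) _)) (ℕP.<-asym (ℕP.<ᵇ⇒< a b (subst IsTrue (sym p) _)))

    ⟦adj⟧ : ∀ u v → ⟦ adj u v ⟧ ≡ ⟦ upper u v ⟧ + ⟦ upper v u ⟧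
    ⟦adj⟧ u v with upper u v in p | upper v u in r
    ... | false | false = refl
    ... | false | true = refl
    ... | true | false = refl
    ... | true | true = contradiction (<ᵇ-asym (toℕ u) (toℕ v) (proj₁ (∧-true p)) (proj₁ (∧-true r))) λ ()

    adj-irrefl : ∀ v → adj v v ≡ false
    adj-irrefl v with upper v v in p
    ... | false = refl
    ... | true = <ᵇ-asym (toℕ v) (toℕ v) (proj₁ (∧-true p)) (proj₁ (∧-true p))

    edgesIn-∑ : ∀ T → + edgesIn G T ≡ ∑ (allFin n) (λ u → ⟦ lookup T u ⟧ * ∑ (allFin n) (λ v → ⟦ lookup T v ⟧ * ⟦ upper u v ⟧))
    edgesIn-∑ T = trans (countTrue-concatMap _ (allFin n)) (∑-cong (allFin n) (λ u → trans (countTrue-∑ _ (allFin n))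
      (trans (∑-cong (allFin n) (λ v → expand (toℕ u ℕ.<ᵇ toℕ v) (lookup T u) (lookup T v) (G u v))) (∑-*ˡ (allFin n) ⟦ lookup T u ⟧ _))))
      where
        expand : ∀ a s t e → ⟦ a ∧ s ∧ t ∧ e ⟧ ≡ ⟦ s ⟧ * (⟦ t ⟧ * ⟦ a ∧ e ⟧)
        expand true true true true = refl
        expand true true true false = refl
        expand true true false e = sym (cong (1ℤ *_) (*-zeroˡ ⟦ e ⟧))
        expand true false t e = sym (*-zeroˡ (⟦ t ⟧ * ⟦ e ⟧))
        expand false s t e = sym (trans (cong (⟦ s ⟧ *_) (*-zeroʳ ⟦ t ⟧)) (*-zeroʳ ⟦ s ⟧))

    module _ (k : ℕ) where

      open IndexGraph adj adj-sym k

      -- As `adj` has no loops, the condition that the indices differ is automatic. The ordered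
      -- pairs then split into two equal sums over the upper triangle.
      D-image : ∀ S → distinct S ≡ true → D full S ≡ + 2 * + edgesIn G (image S)
      D-image S d = begin
        D full S
          ≡⟨ ∑-cong (allFin k) (λ i → ∑-cong (allFin k) (λ j → cong ⟦_⟧ (drop-neq i j))) ⟩
        ∑ (allFin k) (λ i → ∑ (allFin k) (λ j → ⟦ adj (lookup S i) (lookup S j) ⟧))
          ≡⟨ ∑-cong (allFin k) (λ i → ∑-image S (λ v → ⟦ adj (lookup S i) v ⟧) d) ⟨
        ∑ (allFin k) (λ i → ∑ V (λ v → t v * ⟦ adj (lookup S i) v ⟧))
          ≡⟨ ∑-image S (λ u → ∑ V (λ v → t v * ⟦ adj u v ⟧)) d ⟨
        ∑ V (λ u → t u * ∑ V (λ v → t v * ⟦ adj u v ⟧))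
          ≡⟨ ∑-cong V (λ u → trans (cong (t u *_) (trans (∑-cong V (λ v → trans (cong (t v *_) (⟦adj⟧ u v)) (distrib (t v) ⟦ upper u v ⟧ ⟦ upper v u ⟧))) (∑-+ V _ _)))
               (distrib (t u) _ _)) ⟩
        ∑ V (λ u → t u * ∑ V (λ v → t v * ⟦ upper u v ⟧) + t u * ∑ V (λ v → t v * ⟦ upper v u ⟧))
          ≡⟨ ∑-+ V _ _ ⟩
        ∑ V (λ u → t u * ∑ V (λ v → t v * ⟦ upper u v ⟧)) + ∑ V (λ u → t u * ∑ V (λ v → t v * ⟦ upper v u ⟧))
          ≡⟨ cong₂ _+_ (sym (edgesIn-∑ (image S))) (trans transpose (sym (edgesIn-∑ (image S)))) ⟩
        + edgesIn G (image S) + + edgesIn G (image S)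
          ≡⟨ double (+ edgesIn G (image S)) ⟩
        + 2 * + edgesIn G (image S) ∎
        where
          open ≡-Reasoning
          V = allFin n
          t : Fin n → ℤ
          t v = ⟦ lookup (image S) v ⟧
          distrib : ∀ a b c → a * (b + c) ≡ a * b + a * c
          distrib = solve-∀
          double : ∀ a → a + a ≡ + 2 * a
          double = solve-∀
          rotate : ∀ a b c → a * (b * c) ≡ b * (a * c)
          rotate = solve-∀
          transpose : ∑ V (λ u → t u * ∑ V (λ v → t v * ⟦ upper v u ⟧)) ≡ ∑ V (λ u → t u * ∑ V (λ v → t v * ⟦ upper u v ⟧))
          transpose = trans (∑-cong V (λ u → sym (∑-*ˡ V (t u) _))) (trans (∑-swap V V _)
            (∑-cong V (λ v → trans (∑-cong V (λ u → rotate (t u) (t v) ⟦ upper v u ⟧)) (∑-*ˡ V (t v) _))))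
          drop-neq : ∀ i j → neq i j ∧ adj (lookup S i) (lookup S j) ≡ adj (lookup S i) (lookup S j)
          drop-neq i j with i FinP.≟ j
          ... | yes refl = sym (adj-irrefl (lookup S i))
          ... | no _ = refl

      k!*hits : ∀ ℓ → + (k !) * + hits n k ℓ G ≡ ∑ (vecs (allFin n) k) (λ S → ⟦ distinct S ⟧ * ⟦ edgesIn G (image S) ℕ.≡ᵇ ℓ ⟧)
      k!*hits ℓ = sym (trans (∑-distinct k (λ T → ⟦ edgesIn G T ℕ.≡ᵇ ℓ ⟧)) (cong (+ (k !) *_)
        (sym (trans (countTrue-∑ _ (allSubsets n)) (∑-cong (allSubsets n) (λ T → ⟦∧⟧ (size T ℕ.≡ᵇ k) (edgesIn G T ℕ.≡ᵇ ℓ)))))))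
        where
          ⟦∧⟧ : ∀ a b → ⟦ a ∧ b ⟧ ≡ ⟦ a ⟧ * ⟦ b ⟧
          ⟦∧⟧ true b = sym (*-identityˡ ⟦ b ⟧)
          ⟦∧⟧ false b = sym (*-zeroˡ ⟦ b ⟧)

      -- Enlarging the right side by sequences with repeated vertices turns it into a count over
      -- independent uniform vertices.
      k!*hits≤ : ∀ ℓ → + (k !) * + hits n k ℓ G ≤
        ∑ (vecs (allFin n) k) (λ S → ⟦ (+ (2 ℕ.* ℓ) ℤ.≤ᵇ D full S) ∧ (D full S ℤ.≤ᵇ + (2 ℕ.* ℓ)) ⟧)
      k!*hits≤ ℓ = ≤-trans (≤-reflexive (k!*hits ℓ)) (∑-mono (vecs (allFin n) k) le)
        where
          le : ∀ S → ⟦ distinct S ⟧ * ⟦ edgesIn G (image S) ℕ.≡ᵇ ℓ ⟧ ≤ ⟦ (+ (2 ℕ.* ℓ) ℤ.≤ᵇ D full S) ∧ (D full S ℤ.≤ᵇ + (2 ℕ.* ℓ)) ⟧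
          le S with distinct S in d
          ... | false = ≤-trans (≤-reflexive (*-zeroˡ ⟦ edgesIn G (image S) ℕ.≡ᵇ ℓ ⟧)) (0≤⟦⟧ ((+ (2 ℕ.* ℓ) ℤ.≤ᵇ D full S) ∧ (D full S ℤ.≤ᵇ + (2 ℕ.* ℓ))))
          ... | true with edgesIn G (image S) ℕ.≡ᵇ ℓ in e
          ...   | false = 0≤⟦⟧ ((+ (2 ℕ.* ℓ) ℤ.≤ᵇ D full S) ∧ (D full S ℤ.≤ᵇ + (2 ℕ.* ℓ)))
          ...   | true = ≤-reflexive (cong ⟦_⟧ (sym (∧-intro (≤ᵇℤ-intro _ _ (≤-reflexive (sym D≡2ℓ))) (≤ᵇℤ-intro _ _ (≤-reflexive D≡2ℓ)))))
            where
              D≡2ℓ : D full S ≡ + (2 ℕ.* ℓ)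
              D≡2ℓ = trans (D-image S d) (trans (cong (λ c → + 2 * + c) (ℕP.≡ᵇ⇒≡ (edgesIn G (image S)) ℓ (subst IsTrue (sym e) _))) (sym (pos-* 2 ℓ)))

      hits≤C : ∀ ℓ → hits n k ℓ G ℕ.≤ n C k
      hits≤C ℓ = drop‿+≤+ (≤-trans (≤-reflexive (countTrue-∑ _ (allSubsets n)))
        (≤-trans (∑-mono (allSubsets n) (λ T → ⟦⟧-mono _ _ (λ e → proj₁ (∧-true e)))) (≤-reflexive (∑-size≡C n k))))

  -- The bound for a fixed graph

  -- The witness is ⌊√(M/w)⌋, which grows by at most one when M does.
  root : ∀ w → 1 ℕ.≤ w → ∀ M → ∃[ r ] (r ℕ.* r ℕ.* w ℕ.≤ M × M ℕ.< suc r ℕ.* suc r ℕ.* w)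
  root w 1≤w zero = 0 , ℕ.z≤n , ℕP.≤-trans 1≤w (ℕP.≤-reflexive (sym (ℕP.*-identityˡ w)))
  root w 1≤w (suc M) with root w 1≤w M
  ... | r , lo , hi with suc r ℕ.* suc r ℕ.* w ℕP.≤? suc M
  ...   | yes p = suc r , p , ℕP.≤-<-trans hi (ℕP.*-monoˡ-< w {{ℕ.>-nonZero 1≤w}} (ℕP.*-mono-< (ℕP.n<1+n (suc r)) (ℕP.n<1+n (suc r))))
  ...   | no p = r , ℕP.m≤n⇒m≤1+n lo , ℕP.≰⇒> p

  sqrt : ∀ M → ∃[ r ] (r ℕ.* r ℕ.≤ M × M ℕ.< suc r ℕ.* suc r)
  sqrt M with root 1 ℕP.≤-refl M
  ... | r , lo , hi = r , ℕP.≤-trans (ℕP.≤-reflexive (sym (ℕP.*-identityʳ (r ℕ.* r)))) lo , ℕP.≤-trans hi (ℕP.≤-reflexive (ℕP.*-identityʳ (suc r ℕ.* suc r)))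

  square-reflects : ∀ {a b} → a ℕ.* a ℕ.< suc b ℕ.* suc b → a ℕ.≤ b
  square-reflects {a} {b} lt = ℕP.≮⇒≥ λ b<a → ℕP.<⇒≱ lt (ℕP.*-mono-≤ b<a b<a)

  -- For w ≥ 1 the weight is ⌊√(kn/w)⌋. At w = 0 it is set to h, the least value that the lower
  -- bound permits; the upper bounds then have a zero left side.
  make-weight : ∀ n k h → h ℕ.* h ℕ.≤ k → k ℕ.< suc h ℕ.* suc h → 3 ℕ.≤ h → Weight n k h
  make-weight n k h h²≤k k<h² 3≤h = record
    { C = C
    ; C²w≤kn = λ { zero _ → ≤-trans (≤-reflexive (*-zeroʳ (+ h * + h))) 0≤kn
                 ; (suc w) _ → ≤-trans (≤-reflexive (sym (pos³ (r w) (r w) (suc w)))) (≤-trans (+≤+ (lo w)) (≤-reflexive (pos-* k n))) }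
    ; h≤C = λ { zero _ → ≤-refl ; (suc w) w≤n → +≤+ (h≤r w w≤n) }
    ; Cw≤ = λ { zero _ → ≤-trans (≤-reflexive (*-zeroʳ (+ h))) (0≤* {+ n} {+ h + 1ℤ} 0≤+ 0≤+) ; (suc w) w≤n → rw≤ w w≤n }
    ; kn≤2C²w = λ { (suc w) _ w≤n → kn≤ w w≤n }
    }
    where
      0≤kn : 0ℤ ≤ + k * + n
      0≤kn = 0≤* {+ k} {+ n} 0≤+ 0≤+
      spec : ∀ w → ∃[ r ] (r ℕ.* r ℕ.* suc w ℕ.≤ k ℕ.* n × k ℕ.* n ℕ.< suc r ℕ.* suc r ℕ.* suc w)
      spec w = root (suc w) (ℕ.s≤s ℕ.z≤n) (k ℕ.* n)
      r : ℕ → ℕ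
      r w = proj₁ (spec w)
      lo : ∀ w → r w ℕ.* r w ℕ.* suc w ℕ.≤ k ℕ.* n
      lo w = proj₁ (proj₂ (spec w))
      hi : ∀ w → k ℕ.* n ℕ.< suc (r w) ℕ.* suc (r w) ℕ.* suc w
      hi w = proj₂ (proj₂ (spec w))
      C : ℕ → ℕ
      C zero = h
      C (suc w) = r w
      pos³ : ∀ a b c → + (a ℕ.* b ℕ.* c) ≡ + a * + b * + c
      pos³ a b c = trans (pos-* (a ℕ.* b) c) (cong (_* + c) (pos-* a b))
      h≤r : ∀ w → suc w ℕ.≤ n → h ℕ.≤ r w
      h≤r w w≤n = ℕP.≮⇒≥ λ r<h → ℕP.<⇒≱ (hi w) (ℕP.≤-trans (ℕP.*-monoˡ-≤ (suc w) (ℕP.*-mono-≤ r<h r<h)) (ℕP.*-mono-≤ h²≤k w≤n))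
      rw≤ : ∀ w → suc w ℕ.≤ n → + r w * + suc w ≤ + n * (+ h + 1ℤ)
      rw≤ w w≤n = square-cancel (0≤* {+ n} {+ h + 1ℤ} 0≤+ 0≤+) (begin
        + r w * + suc w * (+ r w * + suc w)
          ≡⟨ regroup (+ r w) (+ suc w) ⟩
        + r w * + r w * + suc w * + suc w
          ≤⟨ *-mono {+ r w * + r w * + suc w} (≤-trans 0≤+ (≤-reflexive (pos³ (r w) (r w) (suc w)))) 0≤+
               (≤-trans (≤-reflexive (sym (pos³ (r w) (r w) (suc w)))) (≤-trans (+≤+ (ℕP.≤-trans (lo w) (ℕP.*-monoˡ-≤ n (ℕP.<⇒≤ k<h²)))) (≤-reflexive (pos³ (suc h) (suc h) n)))) (+≤+ w≤n) ⟩
        + suc h * + suc h * + n * + n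
          ≡⟨ trans (cong (λ c → c * c * + n * + n) (trans (pos-+ 1 h) (+-comm 1ℤ (+ h)))) (regroup′ (+ n) (+ h + 1ℤ)) ⟩
        + n * (+ h + 1ℤ) * (+ n * (+ h + 1ℤ)) ∎)
        where
          open ≤-Reasoning
          regroup : ∀ r w → r * w * (r * w) ≡ r * r * w * w
          regroup = solve-∀
          regroup′ : ∀ n h → h * h * n * n ≡ n * h * (n * h)
          regroup′ = solve-∀
      kn≤ : ∀ w → suc w ℕ.≤ n → + k * + n ≤ + 2 * (+ r w * + r w * + suc w)
      kn≤ w w≤n = begin
        + k * + n
          ≡⟨ pos-* k n ⟨
        + (k ℕ.* n)
          ≤⟨ +≤+ (ℕP.<⇒≤ (hi w)) ⟩
        + (suc (r w) ℕ.* suc (r w) ℕ.* suc w)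
          ≡⟨ trans (pos³ (suc (r w)) (suc (r w)) (suc w)) (cong (λ c → c * c * + suc w) (pos-+ 1 (r w))) ⟩
        (1ℤ + + r w) * (1ℤ + + r w) * + suc w
          -- 2r² - (r + 1)² = (r - 3)(r + 1) + 2 is positive because r ≥ h ≥ 3.
          ≤⟨ ≤-by (((+ r w - + 3) * (+ r w + 1ℤ) + + 2) * + suc w) (0≤* (0≤+⁺ (0≤* {+ r w - + 3} {+ r w + 1ℤ} (0≤-diff (+≤+ (ℕP.≤-trans 3≤h (h≤r w w≤n)))) 0≤+) 0≤+) 0≤+) (expand (+ r w) (+ suc w)) ⟩
        + 2 * (+ r w * + r w * + suc w) ∎
        where
          open ≤-Reasoning
          expand : ∀ r w → + 2 * (r * r * w) ≡ (1ℤ + r) * (1ℤ + r) * w + ((r - + 3) * (r + 1ℤ) + + 2) * w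
          expand = solve-∀

  -- Choice of the numerical parameters

  tail : ℕ → ℕ
  tail ν = ν ℕ.* ν ℕ.* (24 ℕ.* (ν ℕ.* ν) ℕ.+ 112)

  -- For k above (3τ)² the root h = ⌊√k⌋ is at least 3τ, so 3xτ ≤ h² ≤ k for every x ≤ h; this is
  -- applied to x = λ and x = h.
  threshold : ℕ → ℕ
  threshold ν = (3 ℕ.* tail ν) ℕ.* (3 ℕ.* tail ν)

  constant : ℕ → ℕ
  constant ν = 81 ℕ.* (ν ℕ.* ν ℕ.* (ν ℕ.* ν) ℕ.* (48 ℕ.+ 116 ℕ.* ν))

  1≤tail : ∀ {ν} → 3 ℕ.≤ ν → 1 ℕ.≤ tail ν
  1≤tail {ν} 3≤ν = ℕP.*-mono-≤ {1} {ν ℕ.* ν} {1} (ℕP.*-mono-≤ 1≤ν 1≤ν) (ℕP.≤-trans (ℕ.s≤s ℕ.z≤n) (ℕP.m≤n+m 112 (24 ℕ.* (ν ℕ.* ν))))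
    where
      1≤ν : 1 ℕ.≤ ν
      1≤ν = ℕP.≤-trans (ℕ.s≤s ℕ.z≤n) 3≤ν

  -- With 81k² vertices, passing from sequences to sets costs only the factor 81/80.
  vertices : ℕ → ℕ
  vertices k = 81 ℕ.* (k ℕ.* k)

  distinct-fraction : ∀ k → 1 ℕ.≤ k → + 80 * + (vertices k ℕ.^ k) ≤ + 81 * (+ (k !) * + (vertices k C k))
  distinct-fraction k 1≤k = *-cancelˡ (+ k * + k) 1≤k² (begin
    + k * + k * (+ 80 * P)
      ≡⟨ regroup (+ k) P ⟩
    P * (+ 81 * (+ k * + k) - + k * + k)
      ≡⟨ cong (λ c → P * (c - + k * + k)) vertices≡ ⟨
    P * (+ vertices k - + k * + k)
      ≤⟨ Sequences.#distinct-lower (vertices k) k k≤ ⟩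
    + vertices k * Sequences.#distinct (vertices k) k
      ≡⟨ cong₂ _*_ vertices≡ (Sequences.#distinct≡ (vertices k) k) ⟩
    + 81 * (+ k * + k) * (+ (k !) * + (vertices k C k))
      ≡⟨ regroup′ (+ k) (+ (k !) * + (vertices k C k)) ⟩
    + k * + k * (+ 81 * (+ (k !) * + (vertices k C k))) ∎)
    where
      open ≤-Reasoning
      P = + (vertices k ℕ.^ k)
      1≤k² : 1ℤ ≤ + k * + k
      1≤k² = *-mono {1ℤ} {+ k} {1ℤ} {+ k} 0≤+ 0≤+ (+≤+ 1≤k) (+≤+ 1≤k)
      vertices≡ : + vertices k ≡ + 81 * (+ k * + k)
      vertices≡ = trans (pos-* 81 (k ℕ.* k)) (cong (+ 81 *_) (pos-* k k))
      k≤ : k ℕ.≤ vertices k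
      k≤ = ℕP.≤-trans (ℕP.≤-reflexive (sym (ℕP.*-identityʳ k))) (ℕP.≤-trans (ℕP.*-monoʳ-≤ k 1≤k) (ℕP.m≤n*m (k ℕ.* k) 81))
      regroup : ∀ k P → k * k * (+ 80 * P) ≡ P * (+ 81 * (k * k) - k * k)
      regroup = solve-∀
      regroup′ : ∀ k c → + 81 * (k * k) * c ≡ k * k * (+ 81 * c)
      regroup′ = solve-∀

  1≤k! : ∀ k → 1 ℕ.≤ k !
  1≤k! zero = ℕP.≤-refl
  1≤k! (suc k) = ℕP.*-mono-≤ {1} {suc k} {1} (ℕ.s≤s ℕ.z≤n) (1≤k! k)

  -- Combines the sample bound with the fraction of distinct sequences: 4320 = 54 · 80, and the 81
  -- sits in `constant`.
  hits-bound : ∀ ν → 3 ℕ.≤ ν → ∀ k ℓ lam → threshold ν ℕ.≤ k →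
    3 ℕ.* k ℕ.+ 2 ℕ.* ν ℕ.* (1 ℕ.+ 2 ℕ.* ℓ) ℕ.≤ 2 ℕ.* ν ℕ.* k →
    1 ℕ.≤ lam → lam ℕ.* lam ℕ.* (lam ℕ.* lam) ℕ.≤ ℓ → (G : Graph (vertices k)) →
    4320 ℕ.* ((ν ℕ.* ν ℕ.∸ 1) ℕ.* (lam ℕ.* hits (vertices k) k ℓ G)) ℕ.≤ constant ν ℕ.* (vertices k C k)
  hits-bound ν 3≤ν k ℓ lam k-large few 1≤lam lam⁴≤ℓ G = drop‿+≤+ (*-cancelˡ (+ (k !)) (+≤+ (1≤k! k)) (begin
    + (k !) * + (4320 ℕ.* ((q ℕ.∸ 1) ℕ.* (lam ℕ.* hh)))
      ≡⟨ cong (+ (k !) *_) (trans (pos-* 4320 ((q ℕ.∸ 1) ℕ.* (lam ℕ.* hh))) (cong (+ 4320 *_) (trans (pos-* (q ℕ.∸ 1) (lam ℕ.* hh)) (cong₂ _*_ q-1 (pos-* lam hh))))) ⟩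
    + (k !) * (+ 4320 * ((+ q - 1ℤ) * (+ lam * + hh)))
      ≡⟨ regroup (+ (k !)) (+ q) (+ lam) (+ hh) ⟩
    + 80 * (+ 54 * + lam * (+ q - 1ℤ) * (+ (k !) * + hh))
      ≤⟨ *-monoˡ (+ 80) 0≤+ (*-monoˡ (+ 54 * + lam * (+ q - 1ℤ)) (0≤* {+ 54 * + lam} (0≤* {+ 54} {+ lam} 0≤+ 0≤+) (0≤-diff (+≤+ 1≤q))) (GraphCount.k!*hits≤ G k ℓ)) ⟩
    + 80 * (+ 54 * + lam * (+ q - 1ℤ) * ∑ (vecs (allFin n) k) (λ S → ⟦ gd S ⟧))
      ≤⟨ *-monoˡ (+ 80) 0≤+ (sample-bound hq lam lam⁴≤L 1≤lam lam-small h-small) ⟩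
    + 80 * (+ q * + q * (+ 48 + + 116 * + ν) * + (n ℕ.^ k))
      ≡⟨ commute (+ q * + q * (+ 48 + + 116 * + ν)) (+ (n ℕ.^ k)) ⟩
    + q * + q * (+ 48 + + 116 * + ν) * (+ 80 * + (n ℕ.^ k))
      ≤⟨ *-monoˡ (+ q * + q * (+ 48 + + 116 * + ν)) 0≤coefficient (distinct-fraction k 1≤k) ⟩
    + q * + q * (+ 48 + + 116 * + ν) * (+ 81 * (+ (k !) * + (n C k)))
      ≡⟨ regroup′ (+ q * + q * (+ 48 + + 116 * + ν)) (+ (k !)) (+ (n C k)) ⟩
    + (k !) * (+ 81 * (+ q * + q * (+ 48 + + 116 * + ν)) * + (n C k))
      ≡⟨ cong (λ c → + (k !) * (c * + (n C k))) constant≡ ⟨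
    + (k !) * (+ constant ν * + (n C k))
      ≡⟨ cong (+ (k !) *_) (pos-* (constant ν) (n C k)) ⟨
    + (k !) * + (constant ν ℕ.* (n C k)) ∎))
    where
      open ≤-Reasoning
      n = vertices k
      hh = hits n k ℓ G
      1≤ν : 1 ℕ.≤ ν
      1≤ν = ℕP.≤-trans (ℕ.s≤s ℕ.z≤n) 3≤ν
      h = proj₁ (sqrt k)
      h²≤k : h ℕ.* h ℕ.≤ k
      h²≤k = proj₁ (proj₂ (sqrt k))
      k<h² : k ℕ.< suc h ℕ.* suc h
      k<h² = proj₂ (proj₂ (sqrt k))
      3τ≤h : 3 ℕ.* tail ν ℕ.≤ h
      3τ≤h = square-reflects (ℕP.≤-<-trans k-large k<h²)
      3≤h : 3 ℕ.≤ h
      3≤h = ℕP.≤-trans (ℕP.*-monoʳ-≤ 3 (1≤tail 3≤ν)) 3τ≤h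
      1≤k : 1 ℕ.≤ k
      1≤k = ℕP.≤-trans (ℕP.*-mono-≤ {1} {3 ℕ.* tail ν} {1} 1≤3τ 1≤3τ) k-large
        where
          1≤3τ : 1 ℕ.≤ 3 ℕ.* tail ν
          1≤3τ = ℕP.≤-trans (1≤tail 3≤ν) (ℕP.m≤n*m (tail ν) 3)
      1≤n : 1 ℕ.≤ n
      1≤n = ℕP.*-mono-≤ {1} {81} {1} (ℕ.s≤s ℕ.z≤n) (ℕP.*-mono-≤ 1≤k 1≤k)
      fewℤ : + 3 * + k + + 2 * + ν * (1ℤ + + (2 ℕ.* ℓ)) ≤ + 2 * + ν * + k
      fewℤ = ≤-trans (≤-reflexive (sym (trans (pos-+ (3 ℕ.* k) _) (cong₂ _+_ (pos-* 3 k) (trans (pos-* (2 ℕ.* ν) _) (cong₂ _*_ (pos-* 2 ν) (pos-+ 1 (2 ℕ.* ℓ))))))))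
        (≤-trans (+≤+ few) (≤-reflexive (trans (pos-* (2 ℕ.* ν) k) (cong (_* + k) (pos-* 2 ν)))))
      open GraphCount G using (adj; adj-sym)
      open Anticoncentration {n} 1≤n adj adj-sym k 1≤k ν 1≤ν {h} (make-weight n k h h²≤k k<h² 3≤h) (2 ℕ.* ℓ) fewℤ
      q-1 : + (q ℕ.∸ 1) ≡ + q - 1ℤ
      q-1 = trans (sym (⊖-≥ 1≤q)) (sym (m-n≡m⊖n q 1))
      τ≡ : + q * (+ 24 * (+ ν * + ν) + + 112) ≡ + tail ν
      τ≡ = sym (trans (pos-* q _) (cong (+ q *_) (trans (pos-+ (24 ℕ.* q) 112) (cong (_+ + 112) (trans (pos-* 24 q) (cong (+ 24 *_) q≡ν²))))))
      constant≡ : + constant ν ≡ + 81 * (+ q * + q * (+ 48 + + 116 * + ν))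
      constant≡ = trans (pos-* 81 (q ℕ.* q ℕ.* (48 ℕ.+ 116 ℕ.* ν))) (cong (+ 81 *_) (trans (pos-* (q ℕ.* q) (48 ℕ.+ 116 ℕ.* ν)) (cong₂ _*_ (pos-* q q) (trans (pos-+ 48 (116 ℕ.* ν)) (cong (λ c → + 48 + c) (pos-* 116 ν))))))
      hq : + 2 * + ν * (+ h + 1ℤ) ≤ + h * (+ q - 1ℤ)
      -- Equality holds at ν = h = 3, so the difference is expanded around that point, where it has
      -- no constant term and no negative coefficient.
      hq = ≤-trans (≤-by (+ 10 * a + + 3 * (a * a) + + 2 * c + + 4 * (a * c) + a * a * c)
          (0≤+⁺ (0≤+⁺ (0≤+⁺ (0≤+⁺ (0≤* {+ 10} 0≤+ 0≤a) (0≤* {+ 3} 0≤+ (0≤sq a))) (0≤* {+ 2} 0≤+ 0≤c)) (0≤* {+ 4} 0≤+ (0≤* 0≤a 0≤c))) (0≤* (0≤sq a) 0≤c)) (expand (+ ν) (+ h)))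
          (≤-reflexive (cong (λ x → + h * (x - 1ℤ)) (sym q≡ν²)))
        where
          a = + ν - + 3
          c = + h - + 3
          0≤a : 0ℤ ≤ a
          0≤a = 0≤-diff (+≤+ 3≤ν)
          0≤c : 0ℤ ≤ c
          0≤c = 0≤-diff (+≤+ 3≤h)
          expand : ∀ ν h → h * (ν * ν - 1ℤ) ≡ + 2 * ν * (h + 1ℤ) +
            (+ 10 * (ν - + 3) + + 3 * ((ν - + 3) * (ν - + 3)) + + 2 * (h - + 3) + + 4 * ((ν - + 3) * (h - + 3)) + (ν - + 3) * (ν - + 3) * (h - + 3))
          expand = solve-∀
      2ℓ≤k : 2 ℕ.* ℓ ℕ.≤ k
      2ℓ≤k = ℕP.*-cancelˡ-≤ (2 ℕ.* ν) {{ℕ.>-nonZero (ℕP.*-mono-≤ {1} {2} {1} (ℕ.s≤s ℕ.z≤n) 1≤ν)}}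
        (ℕP.≤-trans (ℕP.≤-trans (ℕP.*-monoʳ-≤ (2 ℕ.* ν) (ℕP.n≤1+n (2 ℕ.* ℓ))) (ℕP.m≤n+m _ (3 ℕ.* k))) few)
      ℓ≤2ℓ : ℓ ℕ.≤ 2 ℕ.* ℓ
      ℓ≤2ℓ = ℕP.m≤n*m ℓ 2
      lam⁴≤L : (lam ℕ.* lam) ℕ.* (lam ℕ.* lam) ℕ.≤ 2 ℕ.* ℓ
      lam⁴≤L = ℕP.≤-trans lam⁴≤ℓ ℓ≤2ℓ
      lam≤h : lam ℕ.≤ h
      lam≤h = square-reflects (ℕP.≤-<-trans (ℕP.≤-trans (ℕP.≤-trans (ℕP.≤-reflexive (sym (ℕP.*-identityʳ (lam ℕ.* lam)))) (ℕP.*-monoʳ-≤ (lam ℕ.* lam) (ℕP.*-mono-≤ 1≤lam 1≤lam))) (ℕP.≤-trans lam⁴≤L 2ℓ≤k)) k<h²)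
      small : ∀ x → x ℕ.≤ h → + 3 * (+ x * (+ q * (+ 24 * (+ ν * + ν) + + 112))) ≤ + k
      small x x≤h = ≤-trans (≤-reflexive (trans (cong (λ t → + 3 * (+ x * t)) τ≡) (trans (rotate (+ x) (+ tail ν)) (trans (cong (+ x *_) (sym (pos-* 3 (tail ν)))) (sym (pos-* x (3 ℕ.* tail ν)))))))
        (+≤+ (ℕP.≤-trans (ℕP.*-mono-≤ x≤h 3τ≤h) h²≤k))
        where
          rotate : ∀ x t → + 3 * (x * t) ≡ x * (+ 3 * t)
          rotate = solve-∀
      lam-small = small lam lam≤h
      h-small = small h ℕP.≤-refl
      0≤coefficient : 0ℤ ≤ + q * + q * (+ 48 + + 116 * + ν)
      0≤coefficient = 0≤* (0≤sq (+ q)) (0≤+⁺ {+ 48} {+ 116 * + ν} 0≤+ (0≤* {+ 116} {+ ν} 0≤+ 0≤+))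
      regroup : ∀ f q l h → f * (+ 4320 * ((q - 1ℤ) * (l * h))) ≡ + 80 * (+ 54 * l * (q - 1ℤ) * (f * h))
      regroup = solve-∀
      commute : ∀ a b → + 80 * (a * b) ≡ a * (+ 80 * b)
      commute = solve-∀
      regroup′ : ∀ a f c → a * (+ 81 * (f * c)) ≡ f * (+ 81 * a * c)
      regroup′ = solve-∀

  1≤C : ∀ k → 1 ℕ.≤ k → 1 ℕ.≤ vertices k C k
  1≤C k 1≤k with zero-or-positive (vertices k C k)
  ... | inj₂ 1≤C = 1≤C
  ... | inj₁ C≡0 = contradiction (begin
    1ℤ
      ≤⟨ +≤+ (ℕP.m^n>0 (vertices k) {{ℕ.>-nonZero 1≤n}} k) ⟩
    P
      ≤⟨ ≤-by (+ 79 * P) (0≤* {+ 79} {P} 0≤+ 0≤+) (expand P) ⟩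
    + 80 * P
      ≤⟨ distinct-fraction k 1≤k ⟩
    + 81 * (+ (k !) * + (vertices k C k))
      ≡⟨ cong (λ c → + 81 * (+ (k !) * + c)) C≡0 ⟩
    + 81 * (+ (k !) * 0ℤ)
      ≡⟨ cong (+ 81 *_) (*-zeroʳ (+ (k !))) ⟩
    0ℤ ∎) λ { (+≤+ ()) }
    where
      open ≤-Reasoning
      P = + (vertices k ℕ.^ k)
      1≤n : 1 ℕ.≤ vertices k
      1≤n = ℕP.*-mono-≤ {1} {81} {1} (ℕ.s≤s ℕ.z≤n) (ℕP.*-mono-≤ 1≤k 1≤k)
      expand : ∀ P → + 80 * P ≡ P + + 79 * P
      expand = solve-∀

-- Comparison with the real bounds

open SampleCounting using (sqrt; threshold; constant; vertices; hits-bound; 1≤C; module GraphCount)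
open import Data.Nat using (ℕ; _+_; _*_; _≤_; _<_; _^_; _∸_; suc; z≤n; s≤s; >-nonZero)
open import Data.Nat.Properties using (≤-trans; ≤-refl; ≤-reflexive; ≤-total; <-≤-trans; ≤-<-trans; ≮⇒≥; ≰⇒>; <⇒≱; <⇒≤; *-mono-≤; *-monoˡ-≤; *-monoʳ-≤; +-mono-≤; +-monoʳ-≤; *-cancelˡ-≤; *-cancelˡ-<; *-assoc; *-comm; *-monoˡ-<; ^-monoˡ-≤; ^-monoʳ-≤; ^-*-assoc; m≤m+n; m≤n+m; m≤n*m; m≤m*n; ∸-monoˡ-≤; ≤ᵇ⇒≤; _<?_; *-identityʳ; module ≤-Reasoning)
open import Data.Nat.Tactic.RingSolver using (solve-∀)
open import Data.Nat.Combinatorics using (_C_)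
open import Data.Product using (_×_; ∃-syntax; _,_; proj₁; proj₂)
open import Data.Sum using ([_,_]′)
open import Data.Unit using (tt)
open import Relation.Binary.PropositionalEquality using (_≡_; sym; trans; cong)
open import Relation.Nullary using (Dec; yes; no)

^4-* : ∀ a b → (a * b) ^ 4 ≡ a ^ 4 * b ^ 4
^4-* = expand
  where
    expand : ∀ a b → a * b * (a * b * (a * b * (a * b * 1))) ≡ a * (a * (a * (a * 1))) * (b * (b * (b * (b * 1))))
    expand = solve-∀

^4-reflects-< : ∀ {a b} → a ^ 4 < b ^ 4 → a < b
^4-reflects-< {a} {b} lt = ≰⇒> λ b≤a → <⇒≱ lt (^-monoˡ-≤ 4 b≤a)

fourth-root : ∀ ℓ → ∃[ r ] (r * r * (r * r) ≤ ℓ × ℓ < suc r ^ 4)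
fourth-root ℓ with sqrt ℓ
... | s , s²≤ℓ , ℓ<s² with sqrt s
...   | r , r²≤s , s<r² = r , ≤-trans (*-mono-≤ r²≤s r²≤s) s²≤ℓ , <-≤-trans ℓ<s² (≤-trans (*-mono-≤ s<r² s<r²) (≤-reflexive (expand (suc r))))
  where
    expand : ∀ x → x * x * (x * x) ≡ x * (x * (x * (x * 1)))
    expand = solve-∀

below-combine : ∀ c {x h q p m} → x * h ≤ c * m → c * q < p * x → 1 ≤ m → h * q < p * m
below-combine c {x} {h} {q} {p} {m} xh≤cm cq<px 1≤m = *-cancelˡ-< x (h * q) (p * m) (begin-strict
  x * (h * q)    ≡⟨ *-assoc x h q ⟨
  x * h * q      ≤⟨ *-monoˡ-≤ q xh≤cm ⟩
  c * m * q      ≡⟨ rotate c m q ⟩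
  c * q * m      <⟨ *-monoˡ-< m {{>-nonZero 1≤m}} cq<px ⟩
  p * x * m      ≡⟨ rotate′ p x m ⟩
  x * (p * m)    ∎)
  where
    open ≤-Reasoning
    rotate : ∀ a b c → a * b * c ≡ a * c * b
    rotate = solve-∀
    rotate′ : ∀ a b c → a * b * c ≡ b * (a * c)
    rotate′ = solve-∀

-- The exact quotient is about 75.2. The margin between 76 and 90 pays for rounding the fourth root
-- of ℓ down.
constant-3 : ∀ x m → 4320 * ((3 * 3 ∸ 1) * x) ≤ constant 3 * m → x ≤ 76 * m
constant-3 x m le = *-cancelˡ-≤ (4320 * (3 * 3 ∸ 1)) (begin
  4320 * (3 * 3 ∸ 1) * x          ≡⟨ *-assoc 4320 (3 * 3 ∸ 1) x ⟩
  4320 * ((3 * 3 ∸ 1) * x)        ≤⟨ le ⟩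
  constant 3 * m                  ≤⟨ *-monoˡ-≤ m (≤ᵇ⇒≤ (constant 3) (4320 * (3 * 3 ∸ 1) * 76) tt) ⟩
  4320 * (3 * 3 ∸ 1) * 76 * m     ≡⟨ *-assoc (4320 * (3 * 3 ∸ 1)) 76 m ⟩
  4320 * (3 * 3 ∸ 1) * (76 * m)   ∎)
  where open ≤-Reasoning

below-linear : ∀ {c q p ℓ r} → c ^ 4 * q ^ 4 < p ^ 4 * ℓ → ℓ ≤ r ^ 4 → c * q < p * r
below-linear {c} {q} {p} {ℓ} {r} lt ℓ≤r⁴ = ^4-reflects-< (begin-strict
  (c * q) ^ 4    ≡⟨ ^4-* c q ⟩
  c ^ 4 * q ^ 4  <⟨ lt ⟩
  p ^ 4 * ℓ      ≤⟨ *-monoʳ-≤ (p ^ 4) ℓ≤r⁴ ⟩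
  p ^ 4 * r ^ 4  ≡⟨ ^4-* p r ⟨
  (p * r) ^ 4    ∎)
  where open ≤-Reasoning

below-linear′ : ∀ {c a q p k r b} → c ^ 4 * a ^ 4 * q ^ 4 < p ^ 4 * k * b ^ 4 → k ≤ r ^ 4 → c * a * q < p * r * b
below-linear′ {c} {a} {q} {p} {k} {r} {b} lt k≤r⁴ = ^4-reflects-< (begin-strict
  (c * a * q) ^ 4          ≡⟨ trans (^4-* (c * a) q) (cong (_* q ^ 4) (^4-* c a)) ⟩
  c ^ 4 * a ^ 4 * q ^ 4    <⟨ lt ⟩
  p ^ 4 * k * b ^ 4        ≤⟨ *-monoˡ-≤ (b ^ 4) (*-monoʳ-≤ (p ^ 4) k≤r⁴) ⟩
  p ^ 4 * r ^ 4 * b ^ 4    ≡⟨ trans (^4-* (p * r) b) (cong (_* b ^ 4) (^4-* p r)) ⟨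
  (p * r * b) ^ 4          ∎)
  where open ≤-Reasoning

-- For ℓ ≥ k/log⁴ k one has ℓ^(-1/4) ≤ k^(-1/4) log k; here a/b stands in for the logarithm.
below-transfer : ∀ {c a q p k b ℓ} → c ^ 4 * a ^ 4 * q ^ 4 < p ^ 4 * k * b ^ 4 → k * b ^ 4 ≤ ℓ * a ^ 4 →
  c ^ 4 * q ^ 4 < p ^ 4 * ℓ
below-transfer {c} {a} {q} {p} {k} {b} {ℓ} lt kb⁴≤ = *-cancelˡ-< (a ^ 4) (c ^ 4 * q ^ 4) (p ^ 4 * ℓ) (begin-strict
  a ^ 4 * (c ^ 4 * q ^ 4)    ≡⟨ rotate (a ^ 4) (c ^ 4) (q ^ 4) ⟩
  c ^ 4 * a ^ 4 * q ^ 4      <⟨ lt ⟩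
  p ^ 4 * k * b ^ 4          ≡⟨ *-assoc (p ^ 4) k (b ^ 4) ⟩
  p ^ 4 * (k * b ^ 4)        ≤⟨ *-monoʳ-≤ (p ^ 4) kb⁴≤ ⟩
  p ^ 4 * (ℓ * a ^ 4)        ≡⟨ rotate′ (p ^ 4) ℓ (a ^ 4) ⟩
  a ^ 4 * (p ^ 4 * ℓ)        ∎)
  where
    open ≤-Reasoning
    rotate : ∀ x y z → x * (y * z) ≡ y * x * z
    rotate = solve-∀
    rotate′ : ∀ x y z → x * (y * z) ≡ z * (x * y)
    rotate′ = solve-∀

-- If p x were at most 76q with x ≥ 90, then p ≤ q, so replacing x by x + 1 would reach only 77q.
drop-suc : ∀ {q p x} → 90 ≤ x → 90 * q < p * suc x → 76 * q < p * x
drop-suc {q} {p} {x} 90≤x lt = ≰⇒> λ px≤76q → <⇒≱ lt (begin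
  p * suc x      ≡⟨ expand p x ⟩
  p * x + p      ≤⟨ +-mono-≤ px≤76q (p≤q px≤76q) ⟩
  76 * q + q     ≡⟨ collect q ⟩
  77 * q         ≤⟨ *-monoˡ-≤ q (≤ᵇ⇒≤ 77 90 tt) ⟩
  90 * q         ∎)
  where
    open ≤-Reasoning
    expand : ∀ p x → p * (1 + x) ≡ p * x + p
    expand = solve-∀
    collect : ∀ q → 76 * q + q ≡ 77 * q
    collect = solve-∀
    p≤q : p * x ≤ 76 * q → p ≤ q
    p≤q px≤ = *-cancelˡ-≤ 90 (begin
      90 * p    ≡⟨ *-comm 90 p ⟩
      p * 90    ≤⟨ *-monoʳ-≤ p 90≤x ⟩
      p * x     ≤⟨ px≤ ⟩
      76 * q    ≤⟨ *-monoˡ-≤ q (≤ᵇ⇒≤ 76 90 tt) ⟩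
      90 * q    ∎)

-- The regimes ℓ ≤ k/6 and ℓ ≥ k/6

k≤vertices : ∀ {k} → 1 ≤ k → k ≤ vertices k
k≤vertices {k} 1≤k = ≤-trans (m≤m*n k k {{>-nonZero 1≤k}}) (m≤n*m (k * k) 81)

sparse : ∀ {k ℓ} → threshold 3 ≤ k → 6 ≤ k → 6 * ℓ ≤ k → IndLe k ℓ (BelowA ℓ)
sparse {k} {ℓ} k-large 6≤k 6ℓ≤k p q 1≤q below = vertices k , k≤vertices 1≤k , bound
  where
    1≤k : 1 ≤ k
    1≤k = ≤-trans (s≤s z≤n) 6≤k
    r = proj₁ (fourth-root ℓ)
    r⁴≤ℓ : r * r * (r * r) ≤ ℓ
    r⁴≤ℓ = proj₁ (proj₂ (fourth-root ℓ))
    ℓ<r⁴ : ℓ < suc r ^ 4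
    ℓ<r⁴ = proj₂ (proj₂ (fourth-root ℓ))
    few : 3 * k + 2 * 3 * (1 + 2 * ℓ) ≤ 2 * 3 * k
    few = begin
      3 * k + 2 * 3 * (1 + 2 * ℓ)     ≡⟨ expand k ℓ ⟩
      3 * k + (6 + 2 * (6 * ℓ))       ≤⟨ +-monoʳ-≤ (3 * k) (+-mono-≤ 6≤k (*-monoʳ-≤ 2 6ℓ≤k)) ⟩
      3 * k + (k + 2 * k)             ≡⟨ collect k ⟩
      2 * 3 * k                       ∎
      where
        open ≤-Reasoning
        expand : ∀ k ℓ → 3 * k + 2 * 3 * (1 + 2 * ℓ) ≡ 3 * k + (6 + 2 * (6 * ℓ))
        expand = solve-∀
        collect : ∀ k → 3 * k + (k + 2 * k) ≡ 2 * 3 * k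
        collect = solve-∀
    bound : IBelow (vertices k) k ℓ p q
    bound G = by-size (r <? 90)
      where
        by-size : Dec (r < 90) → hits (vertices k) k ℓ G * q < p * (vertices k C k)
        -- Here ℓ < 90⁴, so 90 ℓ^(-1/4) exceeds 1 and the trivial bound on a probability is enough.
        by-size (yes r<90) = ≤-<-trans (≤-trans (*-monoˡ-≤ q (GraphCount.hits≤C G k ℓ)) (≤-reflexive (*-comm (vertices k C k) q))) (*-monoˡ-< (vertices k C k) {{>-nonZero (1≤C k 1≤k)}} q<p)
          where
            q<p : q < p
            q<p = *-cancelˡ-< 90 q p (<-≤-trans (below-linear {90} {q} {p} {ℓ} {90} below (<⇒≤ (<-≤-trans {ℓ} {suc r ^ 4} {90 ^ 4} ℓ<r⁴ (^-monoˡ-≤ 4 r<90)))) (≤-reflexive (*-comm p 90)))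
        by-size (no r≮90) = below-combine 76 {r} {hits (vertices k) k ℓ G} {q} {p} {vertices k C k}
            (constant-3 (r * hits (vertices k) k ℓ G) (vertices k C k) (hits-bound 3 ≤-refl k ℓ r k-large few (≤-trans (s≤s z≤n) 90≤r) r⁴≤ℓ G))
            (drop-suc {q} {p} {r} 90≤r (below-linear {90} {q} {p} {ℓ} {suc r} below (<⇒≤ ℓ<r⁴))) (1≤C k 1≤k)
          where
            90≤r : 90 ≤ r
            90≤r = ≮⇒≥ r≮90

-- The hit probability is at most c/r with c depending on ν only. As k ≥ 2^c, the factor log k in
-- the claim is at least c.
dense : ∀ ν {k ℓ} → 3 ≤ ν → threshold ν ≤ k → 2 ^ constant ν ≤ k → 1 ≤ k → k ≤ 6 * ℓ →
  3 * k + 2 * ν * (1 + 2 * ℓ) ≤ 2 * ν * k → IndLe k ℓ (BelowB k)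
dense ν {k} {ℓ} 3≤ν k-large k-huge 1≤k k≤6ℓ few p q 1≤q (a , b , 1≤b , kᵇ<2ᵃ , below) = vertices k , k≤vertices 1≤k , bound
  where
    c = constant ν
    r = proj₁ (fourth-root ℓ)
    r⁴≤ℓ : r * r * (r * r) ≤ ℓ
    r⁴≤ℓ = proj₁ (proj₂ (fourth-root ℓ))
    ℓ<r⁴ : ℓ < suc r ^ 4
    ℓ<r⁴ = proj₂ (proj₂ (fourth-root ℓ))
    1≤r : 1 ≤ r
    1≤r = ≮⇒≥ λ r<1 → <⇒≱ (<-≤-trans ℓ<r⁴ (^-monoˡ-≤ 4 r<1)) (*-cancelˡ-< 6 0 ℓ (≤-trans 1≤k k≤6ℓ))
    cb≤a : c * b ≤ a
    cb≤a = ≮⇒≥ λ a<cb → <⇒≱ kᵇ<2ᵃ (begin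
      2 ^ a          ≤⟨ ^-monoʳ-≤ 2 (<⇒≤ a<cb) ⟩
      2 ^ (c * b)    ≡⟨ ^-*-assoc 2 c b ⟨
      (2 ^ c) ^ b    ≤⟨ ^-monoˡ-≤ b k-huge ⟩
      k ^ b          ∎)
      where open ≤-Reasoning
    k≤ : k ≤ (2 * suc r) ^ 4
    k≤ = begin
      k                    ≤⟨ k≤6ℓ ⟩
      -- 6 ≤ 2⁴, so the fourth root of k is at most 2(r + 1), hence at most 4r; the claimed factor
      -- 90 covers this 4.
      6 * ℓ                ≤⟨ *-mono-≤ (≤ᵇ⇒≤ 6 16 tt) (<⇒≤ ℓ<r⁴) ⟩
      2 ^ 4 * suc r ^ 4    ≡⟨ ^4-* 2 (suc r) ⟨
      (2 * suc r) ^ 4      ∎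
      where open ≤-Reasoning
    linear : 90 * a * q < p * (2 * suc r) * b
    linear = below-linear′ {90} {a} {q} {p} {k} {2 * suc r} {b} below k≤
    cq<pr : c * q < p * r
    cq<pr = ≰⇒> λ pr≤cq → <⇒≱ linear (begin
      p * (2 * suc r) * b      ≤⟨ *-monoˡ-≤ b (*-monoʳ-≤ p (*-monoʳ-≤ 2 (+-mono-≤ 1≤r ≤-refl))) ⟩
      p * (2 * (r + r)) * b    ≡⟨ collect p r b ⟩
      4 * (p * r) * b          ≤⟨ *-monoˡ-≤ b (*-mono-≤ (≤ᵇ⇒≤ 4 90 tt) pr≤cq) ⟩
      90 * (c * q) * b         ≡⟨ rotate 90 c q b ⟩
      90 * (c * b) * q         ≤⟨ *-monoˡ-≤ q (*-monoʳ-≤ 90 cb≤a) ⟩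
      90 * a * q               ∎)
      where
        open ≤-Reasoning
        collect : ∀ p r b → p * (2 * (r + r)) * b ≡ 4 * (p * r) * b
        collect = solve-∀
        rotate : ∀ n c q b → n * (c * q) * b ≡ n * (c * b) * q
        rotate = solve-∀
    1≤ν²-1 : 1 ≤ ν * ν ∸ 1
    1≤ν²-1 = ∸-monoˡ-≤ 1 (≤-trans (≤ᵇ⇒≤ 2 9 tt) (*-mono-≤ 3≤ν 3≤ν))
    bound : IBelow (vertices k) k ℓ p q
    bound G = below-combine c {r} {hits (vertices k) k ℓ G} {q} {p} {vertices k C k} (≤-trans (≤-trans (m≤n*m _ (ν * ν ∸ 1) {{>-nonZero 1≤ν²-1}}) (m≤n*m _ 4320)) (hits-bound ν 3≤ν k ℓ r k-large few 1≤r r⁴≤ℓ G)) cq<pr (1≤C k 1≤k)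

-- T stands for threshold 3: abstracting it keeps this closed term from being evaluated to a huge numeral.
module _ (e₁ e₂ : ℕ) (1≤e₁ : 1 ≤ e₁) (1≤e₂ : 1 ≤ e₂) (T : ℕ) (threshold₃≤T : threshold 3 ≤ T) where

  private
    ν : ℕ
    -- The hypothesis on ℓ gives k - 2ℓ ≥ k e₁/e₂, whereas k - 1 - 2ℓ ≥ 3k/(8e₂) is required; the 1
    -- is covered by k ≥ 8e₂.
    ν = 4 * e₂

  cutoff : ℕ
  cutoff = T + (threshold ν + (2 ^ constant ν + (8 * e₂ + 6)))

  module _ {k ℓ : ℕ} (large : cutoff ≤ k) where

    private
      t₃ : threshold 3 ≤ k
      t₃ = ≤-trans (≤-trans threshold₃≤T (m≤m+n T (threshold ν + (2 ^ constant ν + (8 * e₂ + 6))))) large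
      rest₁ : threshold ν + (2 ^ constant ν + (8 * e₂ + 6)) ≤ k
      rest₁ = ≤-trans (m≤n+m (threshold ν + (2 ^ constant ν + (8 * e₂ + 6))) T) large
      tν : threshold ν ≤ k
      tν = ≤-trans (m≤m+n (threshold ν) (2 ^ constant ν + (8 * e₂ + 6))) rest₁
      rest₂ : 2 ^ constant ν + (8 * e₂ + 6) ≤ k
      rest₂ = ≤-trans (m≤n+m (2 ^ constant ν + (8 * e₂ + 6)) (threshold ν)) rest₁
      huge : 2 ^ constant ν ≤ k
      huge = ≤-trans (m≤m+n (2 ^ constant ν) (8 * e₂ + 6)) rest₂
      rest₃ : 8 * e₂ + 6 ≤ k
      rest₃ = ≤-trans (m≤n+m (8 * e₂ + 6) (2 ^ constant ν)) rest₂
      8e₂≤k : 8 * e₂ ≤ k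
      8e₂≤k = ≤-trans (m≤m+n (8 * e₂) 6) rest₃
      6≤k : 6 ≤ k
      6≤k = ≤-trans (m≤n+m 6 (8 * e₂)) rest₃
      1≤k : 1 ≤ k
      1≤k = ≤-trans (s≤s z≤n) 6≤k

    small-ℓ : SmallL k ℓ → IndLe k ℓ (BelowA ℓ)
    small-ℓ small = sparse t₃ 6≤k (begin
      6 * ℓ      ≤⟨ *-monoˡ-≤ ℓ (≤ᵇ⇒≤ 6 16 tt) ⟩
      16 * ℓ     ≡⟨ *-comm 16 ℓ ⟩
      -- The rational 2/1 lies below log k because k > 4, so `SmallL` already yields 16ℓ ≤ k.
      ℓ * 2 ^ 4  ≤⟨ small 2 1 ≤-refl (≤-trans (≤-trans (≤ᵇ⇒≤ 5 6 tt) 6≤k) (≤-reflexive (sym (*-identityʳ k)))) ⟩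
      k * 1 ^ 4  ≡⟨ *-identityʳ k ⟩
      k          ∎)
      where open ≤-Reasoning

    large-ℓ : LargeL k ℓ → 2 * ℓ * e₂ + e₁ * k ≤ e₂ * k → IndLe k ℓ (BelowB k)
    -- When ℓ is at most k/6, the bound 90 ℓ^(-1/4) still holds, and `LargeL` makes it the stronger
    -- of the two.
    large-ℓ largeL gap p q 1≤q below = [ (λ 6ℓ≤k → sparse t₃ 6≤k 6ℓ≤k p q 1≤q (toBelowA p q below)) , (λ k≤6ℓ → dense ν 3≤ν tν huge 1≤k k≤6ℓ few p q 1≤q below) ]′ (≤-total (6 * ℓ) k)
      where
        3≤ν : 3 ≤ ν
        3≤ν = ≤-trans (≤ᵇ⇒≤ 3 4 tt) (m≤m*n 4 e₂ {{>-nonZero 1≤e₂}})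
        toBelowA : ∀ p q → BelowB k p q → BelowA ℓ p q
        toBelowA p q (a , b , 1≤b , kᵇ<2ᵃ , below) = below-transfer {90} {a} {q} {p} {k} {b} {ℓ} below (largeL a b 1≤b kᵇ<2ᵃ)
        4k≤ : 3 * k + k ≤ 8 * (e₁ * k)
        4k≤ = ≤-trans (≤-reflexive (quadruple k)) (*-mono-≤ (≤ᵇ⇒≤ 4 8 tt) (m≤n*m k e₁ {{>-nonZero 1≤e₁}}))
          where
            quadruple : ∀ k → 3 * k + k ≡ 4 * k
            quadruple = solve-∀
        few : 3 * k + 2 * ν * (1 + 2 * ℓ) ≤ 2 * ν * k
        few = begin
          3 * k + 2 * ν * (1 + 2 * ℓ)             ≡⟨ expand k e₂ ℓ ⟩
          3 * k + 8 * e₂ + 8 * (2 * ℓ * e₂)       ≤⟨ +-mono-≤ (+-monoʳ-≤ (3 * k) 8e₂≤k) ≤-refl ⟩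
          3 * k + k + 8 * (2 * ℓ * e₂)            ≤⟨ +-mono-≤ 4k≤ ≤-refl ⟩
          8 * (e₁ * k) + 8 * (2 * ℓ * e₂)         ≡⟨ collect (e₁ * k) (2 * ℓ * e₂) ⟩
          8 * (2 * ℓ * e₂ + e₁ * k)               ≤⟨ *-monoʳ-≤ 8 gap ⟩
          8 * (e₂ * k)                            ≡⟨ regroup e₂ k ⟩
          2 * ν * k                               ∎
          where
            open ≤-Reasoning
            expand : ∀ k e ℓ → 3 * k + 2 * (4 * e) * (1 + 2 * ℓ) ≡ 3 * k + 8 * e + 8 * (2 * ℓ * e)
            expand = solve-∀
            collect : ∀ x y → 8 * x + 8 * y ≡ 8 * (y + x)
            collect = solve-∀
            regroup : ∀ e k → 8 * (e * k) ≡ 2 * (4 * e) * k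
            regroup = solve-∀

theorem1p3 : (e₁ e₂ : ℕ) → 1 ≤ e₁ → 1 ≤ e₂ →
    ∃[ K ] ((k : ℕ) → K ≤ k → (ℓ : ℕ) →
    ((1 ≤ ℓ → SmallL k ℓ → IndLe k ℓ (BelowA ℓ))
    × (LargeL k ℓ → 2 * ℓ * e₂ + e₁ * k ≤ e₂ * k → IndLe k ℓ (BelowB k))))
theorem1p3 e₁ e₂ 1≤e₁ 1≤e₂ = cutoff e₁ e₂ 1≤e₁ 1≤e₂ T T≤T , λ k large ℓ →
  (λ _ → small-ℓ e₁ e₂ 1≤e₁ 1≤e₂ T T≤T large) , large-ℓ e₁ e₂ 1≤e₁ 1≤e₂ T T≤T large
  where
    T = threshold 3
    T≤T : T ≤ T
    T≤T = ≤-refl {T}
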